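{- Let $n\ge 1$ and let $f$ be an arbitrary $n$-ary quasigroup of order $4$. Then $$|\mathrm{Atp}(f)|\ \geqslant\ 2^{\lfloor n/2\rfloor+2}.$$ If $n\geqslant 5$, then this bound is sharp, i.e. for every $n\ge 5$ there exists an $n$-ary quasigroup $f$ of order $4$ with $|\mathrm{Atp}(f)|=2^{\lfloor n/2\rfloor+2}$.
   Context: Let $\Sigma=\{0,1,2,3\}$. An $n$-ary quasigroup of order $4$ is a function $f:\Sigma^n\to\Sigma$ that is invertible in each argument (for every $i$ and every fixing of the other arguments, the map $x_i\mapsto f(x_1,\ldots,x_n)$ is a bijection of $\Sigma$). An autotopy of $f$ is a tuple $\theta=(\theta_0,\theta_1,\ldots,\theta_n)$ of permutations of $\Sigma$ such that $f(x_1,\ldots,x_n)=\theta_0^{ -1}f(\theta_1x_1,\ldots,\theta_nx_n)$ for all $x_1,\ldots,x_n\in\Sigma$. The autotopies of $f$ form a group $\mathrm{Atp}(f)$ under (componentwise) composition. -}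

module Defs where

open import Algebra.Bundles using (Group)
open import Data.Fin.Base using (Fin; zero; suc)
open import Data.Fin.Permutation
  using (Permutation′; _⟨$⟩ʳ_; _⟨$⟩ˡ_; _∘ₚ_; flip; inverseˡ; inverseʳ)
  renaming (id to idₚ; _≈_ to _≈ₚ_)
open import Data.Nat.Base using (ℕ; suc)
open import Data.Product.Base using (∃; _,_; proj₁)
open import Data.Vec.Base using (Vec; lookup; tabulate; _[_]≔_)
open import Data.Vec.Functional using (Vector)
open import Data.Vec.Properties using (lookup∘tabulate; tabulate-cong; tabulate∘lookup)
open import Function.Bundles using (Inverse)
open import Function.Definitions using (Bijective)
open import Level using (Level; 0ℓ; _⊔_)
open import Relation.Binary.PropositionalEquality

private
  variable
    n : ℕ
    c ℓ : Level

Symbol : Set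
Symbol = Fin 4

Operation : ℕ → Set
Operation n = Vec Symbol n → Symbol

-- The value of x at i is irrelevant below: only the other arguments are fixed.
IsQuasigroup : Operation n → Set
IsQuasigroup {n} f = ∀ (i : Fin n) (x : Vec Symbol n) →
  Bijective _≡_ _≡_ (λ a → f (x [ i ]≔ a))

record Quasigroup (n : ℕ) : Set where
  field
    op           : Operation n
    isQuasigroup : IsQuasigroup op

-- (θ₀ , θ₁ , … , θₙ)
Perms : ℕ → Set
Perms n = Vector (Permutation′ 4) (suc n)

act : Perms n → Vec Symbol n → Vec Symbol n
act θ x = tabulate (λ i → θ (suc i) ⟨$⟩ʳ lookup x i)

IsAutotopy : Operation n → Perms n → Set
IsAutotopy {n} f θ = ∀ (x : Vec Symbol n) → f x ≡ θ zero ⟨$⟩ˡ f (act θ x)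

-- π ∘ₚ ρ applies π first, so this is the usual composition "θ after φ".
_∙ₚ_ : Perms n → Perms n → Perms n
(θ ∙ₚ φ) i = φ i ∘ₚ θ i

εₚ : Perms n
εₚ _ = idₚ

_⁻¹ₚ : Perms n → Perms n
(θ ⁻¹ₚ) i = flip (θ i)

act-∙ : (θ φ : Perms n) (x : Vec Symbol n) → act θ (act φ x) ≡ act (θ ∙ₚ φ) x
act-∙ θ φ x = tabulate-cong λ i → cong (θ (suc i) ⟨$⟩ʳ_) (lookup∘tabulate _ i)

act-inverseʳ : (θ : Perms n) (x : Vec Symbol n) → act θ (act (θ ⁻¹ₚ) x) ≡ x
act-inverseʳ θ x = trans (act-∙ θ (θ ⁻¹ₚ) x)
  (trans (tabulate-cong λ i → inverseʳ (θ (suc i))) (tabulate∘lookup x))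

module _ (f : Operation n) where

  ∙-isAutotopy : ∀ {θ φ} → IsAutotopy f θ → IsAutotopy f φ → IsAutotopy f (θ ∙ₚ φ)
  ∙-isAutotopy {θ} {φ} p q x = trans (q x) (cong (φ zero ⟨$⟩ˡ_)
    (trans (p (act φ x)) (cong (λ y → θ zero ⟨$⟩ˡ f y) (act-∙ θ φ x))))

  ε-isAutotopy : IsAutotopy f εₚ
  ε-isAutotopy x = cong f (sym (tabulate∘lookup x))

  ⁻¹-isAutotopy : ∀ {θ} → IsAutotopy f θ → IsAutotopy f (θ ⁻¹ₚ)
  ⁻¹-isAutotopy {θ} p x = sym (trans (cong (θ zero ⟨$⟩ʳ_) (p (act (θ ⁻¹ₚ) x)))
    (trans (inverseʳ (θ zero)) (cong f (act-inverseʳ θ x))))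

-- Permutations carry proofs of invertibility, so tuples are identified
-- when they agree pointwise as functions, rather than by _≡_.
Atp : Quasigroup n → Group 0ℓ 0ℓ
Atp Q = record
  { Carrier = ∃ (IsAutotopy op)
  ; _≈_     = λ θ φ → ∀ i → proj₁ θ i ≈ₚ proj₁ φ i
  ; _∙_     = λ (θ , p) (φ , q) → θ ∙ₚ φ , ∙-isAutotopy op {θ} {φ} p q
  ; ε       = εₚ , ε-isAutotopy op
  ; _⁻¹     = λ (θ , p) → θ ⁻¹ₚ , ⁻¹-isAutotopy op {θ} p
  ; isGroup = record
    { isMonoid = record
      { isSemigroup = record
        { isMagma = record
          { isEquivalence = record
            { refl  = λ _ _ → refl
            ; sym   = λ e i a → sym (e i a)
            ; trans = λ d e i a → trans (d i a) (e i a)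
            }
          ; ∙-cong = λ {_} {(θ′ , _)} {(φ , _)} d e i a →
              trans (d i (φ i ⟨$⟩ʳ a)) (cong (θ′ i ⟨$⟩ʳ_) (e i a))
          }
        ; assoc = λ _ _ _ _ _ → refl
        }
      ; identity = (λ _ _ _ → refl) , (λ _ _ _ → refl)
      }
    ; inverse = (λ (θ , _) i _ → inverseˡ (θ i)) , (λ (θ , _) i _ → inverseʳ (θ i))
    ; ⁻¹-cong = λ {(θ , _)} {(φ , _)} e i a →
        trans (sym (inverseˡ (φ i)))
          (cong (φ i ⟨$⟩ˡ_) (trans (sym (e i (θ i ⟨$⟩ˡ a))) (inverseʳ (θ i))))
    }
  }
  where
  open Quasigroup Q

HasOrder : Group c ℓ → ℕ → Set (c ⊔ ℓ)
HasOrder G k = Inverse (Group.setoid G) (setoid (Fin k))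

{-# OPTIONS --safe #-}
module Submission where

-- Identify Σ with 𝔽₂². At a point x every two-dimensional face of f is isotopic to ℤ₂² or to ℤ₄; in the second case
-- its colour is the value c ≠ 0 such that {0 , c} is the image of the subgroup of order two. This colours the edges of
-- the complete graph on the coordinates; there are no rainbow triangles, and moving x along one of three coordinates
-- changes the colour of the edge between the other two in a controlled way.
--
-- Lower bound. Take a point x and a largest set J of coordinates having a partition into two parts with all cross
-- edges of one colour c. This picture persists under all moves that preserve f modulo {0 , c}, and it follows that
-- f modulo {0 , c} is, for some c, a sum of functions in disjoint sets of variables. The level sets of an indecomposable
-- summand are connected, so f is a semilinear function g (h₁ , … , hₘ), m ≥ 2, of quasigroups in these sets of variables.
-- Symmetries of the hᵢ that fix their values, or shift an even number of them by c, are symmetries of f, and induction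
-- gives enough of them, unless m = 2 and both arities are odd; there ℤ₂² and ℤ₄ have extra autotopies.
--
-- Upper bound. Compose ternary (and, for even n, one quaternary) irreducible semilinear quasigroups in a chain such that
-- consecutive ones are semilinear with respect to different subgroups of order two. Then an autotopy acts as the identity
-- on every inner edge of the chain, and on the remaining edges by translations.

-- The bound rounds n/2 down, so an induction on the number of symmetries alone would lose a factor
-- two at each component of odd size. The induction therefore also records how symmetries act on the
-- value of f: by all translations, by one, by none, or by some other permutation. A component of
-- size s contributes the exponent ⌊s/2⌋ + 1, where one factor two in total may be replaced by a
-- shift by c. Twice this exponent exceeds s by one or two; a total excess of three suffices, and
-- only two odd components fall short of it.
--
-- The existence of c rests on more than the absence of rainbow triangles. A path on four
-- coordinates in one colour whose complement has a second colour is excluded as well, and, as for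
-- cographs, this lets a cut grow: a new coordinate either yields a larger cut or is joined to the
-- old ones harmlessly.
--
-- Smaller quasigroups are never formed. Instead, coordinates are frozen at a base point, so that
-- every component is a set of coordinates of the same f.

open import Defs
open import Algebra.Bundles using (Group)
open import Data.Bool.Base using (Bool; true; false; not; _∧_; _∨_; _xor_; if_then_else_)
import Data.Bool.Properties as Bool
open import Data.Empty using (⊥; ⊥-elim)
open import Data.Fin.Base using (Fin; zero; suc; remQuot; combine; funToFin; finToFun)
open import Data.Fin.Patterns
open import Data.Fin.Permutation using (Permutation′; permutation; _⟨$⟩ʳ_; _⟨$⟩ˡ_; _∘ₚ_; inverseˡ; inverseʳ) renaming (id to idₚ)
open import Data.Fin.Properties using (_≟_; all?; any?; remQuot-combine; combine-remQuot; combine-injective; finToFun-funToFin; funToFin-finToFin; injective⇒≤)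
open import Data.Maybe.Base using (Maybe; just; nothing)
open import Data.Maybe.Properties using (just-injective) renaming (≡-dec to Maybe-≡-dec)
open import Data.Nat.Base using (ℕ; zero; suc; _+_; _*_; _^_; _≤_; _<_; _≥_; z≤n; s≤s; ⌊_/2⌋)
import Data.Nat.Properties as ℕ
open import Data.Nat.Tactic.RingSolver using (solve-∀)
open import Data.Product.Base using (_×_; _,_; proj₁; proj₂; ∃; ∃-syntax; Σ-syntax)
open import Data.Sum.Base using (_⊎_; inj₁; inj₂; [_,_]′)
open import Data.Unit.Base using (tt)
open import Data.Vec.Base using (Vec; []; _∷_; lookup; tabulate; _[_]≔_)
open import Data.Vec.Properties using ([]≔-commutes; []≔-idempotent; []≔-lookup; lookup∘update; lookup∘update′; lookup∘tabulate; tabulate∘lookup; tabulate-cong)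
open import Function.Base using (_∘_; case_of_; id)
open import Function.Definitions using (Bijective)
open import Relation.Binary.PropositionalEquality hiding (J)
open import Relation.Nullary using (¬_)
open import Relation.Nullary.Decidable using (Dec; yes; no; does; toWitness; _×-dec_; _→-dec_; _⊎-dec_; ¬?; map′; dec-true; dec-false)

-- The symbols as vectors of 𝔽₂²

infixl 6 _⊕_

_⊕_ : Symbol → Symbol → Symbol
0F ⊕ b  = b
a  ⊕ 0F = a
1F ⊕ 1F = 0F
1F ⊕ 2F = 3F
1F ⊕ 3F = 2F
2F ⊕ 1F = 3F
2F ⊕ 2F = 0F
2F ⊕ 3F = 1F
3F ⊕ 1F = 2F
3F ⊕ 2F = 1F
3F ⊕ 3F = 0F

abstract
  ⊕-identityʳ : ∀ a → a ⊕ 0F ≡ a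
  ⊕-identityʳ = toWitness {a? = all? λ a → a ⊕ 0F ≟ a} tt

  ⊕-self : ∀ a → a ⊕ a ≡ 0F
  ⊕-self = toWitness {a? = all? λ a → a ⊕ a ≟ 0F} tt

  ⊕-comm : ∀ a b → a ⊕ b ≡ b ⊕ a
  ⊕-comm = toWitness {a? = all? λ a → all? λ b → a ⊕ b ≟ b ⊕ a} tt

  ⊕-assoc : ∀ a b c → (a ⊕ b) ⊕ c ≡ a ⊕ (b ⊕ c)
  ⊕-assoc = toWitness {a? = all? λ a → all? λ b → all? λ c → (a ⊕ b) ⊕ c ≟ a ⊕ (b ⊕ c)} tt

  ⊕-cancelˡ : ∀ a b → a ⊕ (a ⊕ b) ≡ b
  ⊕-cancelˡ = toWitness {a? = all? λ a → all? λ b → a ⊕ (a ⊕ b) ≟ b} tt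

  ⊕-injectiveˡ : ∀ a {b c} → a ⊕ b ≡ a ⊕ c → b ≡ c
  ⊕-injectiveˡ a {b} {c} p = trans (sym (⊕-cancelˡ a b)) (trans (cong (a ⊕_) p) (⊕-cancelˡ a c))

-- For c ≠ 0 this is the quotient map of 𝔽₂² by {0 , c}, written with values in `Bool`; f modulo {0
-- , c} is its composition with f.
outside : Symbol → Symbol → Bool
outside c a = not (does (a ≟ 0F)) ∧ not (does (a ≟ c))

-- For χ = 0 the group ℤ₂², otherwise ℤ₄ with χ as its element of order two.
square : Symbol → Symbol → Symbol → Symbol
square χ a b = a ⊕ b ⊕ (if outside χ a ∧ outside χ b then χ else 0F)

-- On the diagonal of `square χ` stands χ at the symbols outside {0 , χ} and 0 at the others. The
-- cell of 1 thus reveals χ = 2 and χ = 3, and the cell of 2 then tells χ = 1 from χ = 0.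
colour : Symbol → Symbol → Symbol
colour 0F b = b
colour a  _ = a

-- A backtracking search over the nine free cells of a normalised Latin square; the premises are its pruning conditions.
abstract
  latin-square : ∀ a → a ≢ 1F → ∀ b → b ≢ 1F → b ≢ 2F → b ≢ a → ∀ c → c ≢ 1F → c ≢ 3F → c ≢ a → c ≢ b →
    ∀ d → d ≢ 2F → d ≢ 1F → d ≢ a → ∀ e → e ≢ 2F → e ≢ b → e ≢ d →
    ∀ f → f ≢ 2F → f ≢ 3F → f ≢ c → f ≢ d → f ≢ e →
    ∀ g → g ≢ 3F → g ≢ 1F → g ≢ a → g ≢ d →
    ∀ h → h ≢ 3F → h ≢ 2F → h ≢ b → h ≢ e → h ≢ g →
    ∀ k → k ≢ 3F → k ≢ c → k ≢ f → k ≢ g → k ≢ h →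
    let χ = colour a e in
    (a ≡ square χ 1F 1F × b ≡ square χ 1F 2F × c ≡ square χ 1F 3F) ×
    (d ≡ square χ 2F 1F × e ≡ square χ 2F 2F × f ≡ square χ 2F 3F) ×
    (g ≡ square χ 3F 1F × h ≡ square χ 3F 2F × k ≡ square χ 3F 3F)
  latin-square = toWitness {a? =
    all? λ a → ¬? (a ≟ 1F) →-dec all? λ b → ¬? (b ≟ 1F) →-dec ¬? (b ≟ 2F) →-dec ¬? (b ≟ a) →-dec
    all? λ c → ¬? (c ≟ 1F) →-dec ¬? (c ≟ 3F) →-dec ¬? (c ≟ a) →-dec ¬? (c ≟ b) →-dec
    all? λ d → ¬? (d ≟ 2F) →-dec ¬? (d ≟ 1F) →-dec ¬? (d ≟ a) →-dec
    all? λ e → ¬? (e ≟ 2F) →-dec ¬? (e ≟ b) →-dec ¬? (e ≟ d) →-dec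
    all? λ f → ¬? (f ≟ 2F) →-dec ¬? (f ≟ 3F) →-dec ¬? (f ≟ c) →-dec ¬? (f ≟ d) →-dec ¬? (f ≟ e) →-dec
    all? λ g → ¬? (g ≟ 3F) →-dec ¬? (g ≟ 1F) →-dec ¬? (g ≟ a) →-dec ¬? (g ≟ d) →-dec
    all? λ h → ¬? (h ≟ 3F) →-dec ¬? (h ≟ 2F) →-dec ¬? (h ≟ b) →-dec ¬? (h ≟ e) →-dec ¬? (h ≟ g) →-dec
    all? λ k → ¬? (k ≟ 3F) →-dec ¬? (k ≟ c) →-dec ¬? (k ≟ f) →-dec ¬? (k ≟ g) →-dec ¬? (k ≟ h) →-dec
    let χ = colour a e in
    ((a ≟ square χ 1F 1F) ×-dec (b ≟ square χ 1F 2F) ×-dec (c ≟ square χ 1F 3F)) ×-dec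
    ((d ≟ square χ 2F 1F) ×-dec (e ≟ square χ 2F 2F) ×-dec (f ≟ square χ 2F 3F)) ×-dec
    ((g ≟ square χ 3F 1F) ×-dec (h ≟ square χ 3F 2F) ×-dec (k ≟ square χ 3F 3F))} tt

-- Layer g of a normalised Latin cube: χ₁ and χ₂ are the colours of its two vertical faces through the origin,
-- χ is the colour of the layer, and the summands g renormalise the layer at the point (0, 0, g).
layer : Symbol → Symbol → Symbol → Symbol → Symbol → Symbol → Symbol
layer χ₁ χ₂ g χ a b = g ⊕ square χ (g ⊕ square χ₁ a g) (g ⊕ square χ₂ b g)

Disjoint : Symbol → Symbol → Symbol → Symbol → Symbol → Symbol → Set
Disjoint χ₁ χ₂ g χ h ψ = ∀ a b → layer χ₁ χ₂ g χ a b ≢ layer χ₁ χ₂ h ψ a b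

disjoint? : ∀ χ₁ χ₂ g χ h ψ → Dec (Disjoint χ₁ χ₂ g χ h ψ)
disjoint? χ₁ χ₂ g χ h ψ = all? λ a → all? λ b → ¬? (layer χ₁ χ₂ g χ a b ≟ layer χ₁ χ₂ h ψ a b)

-- For coordinates i, j, k the symbols χ₀, χ₁, χ₂ are the colours of ij, ik, jk at one point, and l
-- lists the colour of ij in the four layers along k. A colour also serves as the number of a layer:
-- in layer c the value at the origin has increased by c.
CubeFacts : Symbol → Symbol → Vec Symbol 4 → Set
CubeFacts χ₁ χ₂ l = let χ₀ = lookup l 0F in
  ¬ (χ₀ ≢ χ₁ × χ₀ ≢ χ₂ × χ₁ ≢ χ₂) ×
  (χ₀ ≢ 0F → χ₁ ≡ 0F ⊎ χ₁ ≡ χ₀ → lookup l χ₀ ≡ χ₀) ×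
  (χ₁ ≡ χ₂ → χ₁ ≢ 0F → χ₀ ≢ 0F → χ₁ ≢ χ₀ → lookup l χ₀ ≡ χ₀ ⊕ χ₁) ×
  (χ₀ ≡ χ₁ → χ₁ ≢ 0F → χ₂ ≢ 0F → χ₂ ≢ χ₁ → lookup l χ₂ ≡ χ₀)

abstract
  -- Six colours determine a normalised cube, so the search runs over colours rather than over
  -- cubes. Disjointness of any two layers is the Latin condition in the third direction; each layer
  -- is tested against the earlier ones as soon as its colour is chosen.
  latin-cube : ∀ χ₁ χ₂ a b → Disjoint χ₁ χ₂ 0F a 1F b →
    ∀ c → Disjoint χ₁ χ₂ 0F a 2F c → Disjoint χ₁ χ₂ 1F b 2F c →
    ∀ d → Disjoint χ₁ χ₂ 0F a 3F d → Disjoint χ₁ χ₂ 1F b 3F d → Disjoint χ₁ χ₂ 2F c 3F d →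
    CubeFacts χ₁ χ₂ (a ∷ b ∷ c ∷ d ∷ [])
  latin-cube = toWitness {a? = all? λ χ₁ → all? λ χ₂ → all? λ a → all? λ b → disjoint? χ₁ χ₂ 0F a 1F b →-dec
    all? λ c → disjoint? χ₁ χ₂ 0F a 2F c →-dec disjoint? χ₁ χ₂ 1F b 2F c →-dec
    all? λ d → disjoint? χ₁ χ₂ 0F a 3F d →-dec disjoint? χ₁ χ₂ 1F b 3F d →-dec disjoint? χ₁ χ₂ 2F c 3F d →-dec
    let l = a ∷ b ∷ c ∷ d ∷ []
        χ₀ = a in
    ¬? (¬? (χ₀ ≟ χ₁) ×-dec ¬? (χ₀ ≟ χ₂) ×-dec ¬? (χ₁ ≟ χ₂)) ×-dec
    (¬? (χ₀ ≟ 0F) →-dec ((χ₁ ≟ 0F) ⊎-dec (χ₁ ≟ χ₀)) →-dec (lookup l χ₀ ≟ χ₀)) ×-dec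
    ((χ₁ ≟ χ₂) →-dec ¬? (χ₁ ≟ 0F) →-dec ¬? (χ₀ ≟ 0F) →-dec ¬? (χ₁ ≟ χ₀) →-dec (lookup l χ₀ ≟ χ₀ ⊕ χ₁)) ×-dec
    ((χ₀ ≟ χ₁) →-dec ¬? (χ₁ ≟ 0F) →-dec ¬? (χ₂ ≟ 0F) →-dec ¬? (χ₂ ≟ χ₁) →-dec (lookup l χ₂ ≟ χ₀)) } tt

-- Colours of the faces of a quasigroup

abstract
  colour-square : ∀ χ → colour (square χ 1F 1F) (square χ 2F 2F) ≡ χ
  colour-square = toWitness {a? = all? λ χ → colour (square χ 1F 1F) (square χ 2F 2F) ≟ χ} tt

  -- The origin of the table moves to the cell (e, 0), and β is the old label of the column whose
  -- new label is b. The renormalised table has the same χ, which is why a colour belongs to the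
  -- face and not to the point in it.
  square-shift : ∀ χ e b β → square χ e β ≡ e ⊕ b → ∀ a → square χ (a ⊕ e) β ≡ e ⊕ square χ a b
  square-shift = toWitness {a? = all? λ χ → all? λ e → all? λ b → all? λ β →
    (square χ e β ≟ e ⊕ b) →-dec all? λ a → square χ (a ⊕ e) β ≟ e ⊕ square χ a b} tt

  square-0ˡ : ∀ χ b → square χ 0F b ≡ b
  square-0ˡ = toWitness {a? = all? λ χ → all? λ b → square χ 0F b ≟ b} tt

  square-0ʳ : ∀ χ a → square χ a 0F ≡ a
  square-0ʳ = toWitness {a? = all? λ χ → all? λ a → square χ a 0F ≟ a} tt

  outside-⊕ : ∀ c → c ≢ 0F → ∀ a b → outside c (a ⊕ b) ≡ outside c a xor outside c b
  outside-⊕ = toWitness {a? = all? λ c → ¬? (c ≟ 0F) →-dec all? λ a → all? λ b →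
    outside c (a ⊕ b) Bool.≟ (outside c a xor outside c b)} tt

  -- The correction term of `square` is 0 or χ, hence vanishes modulo {0 , c}.
  square-linear : ∀ c χ → c ≢ 0F → outside c χ ≡ false → ∀ a b →
    outside c (square χ a b) ≡ outside c a xor outside c b
  square-linear = toWitness {a? = all? λ c → all? λ χ → ¬? (c ≟ 0F) →-dec (outside c χ Bool.≟ false) →-dec
    all? λ a → all? λ b → outside c (square χ a b) Bool.≟ (outside c a xor outside c b)} tt

  -- The opposite case: {0 , c} is not a subgroup of the ℤ₄ with involution χ, so the level sets are
  -- not made of blocks, and rook moves inside the level set of the origin reach each of its cells
  -- through (0, s), (r, s), (r, t) and (a, t).
  square-connected : ∀ c χ → c ≢ 0F → outside c χ ≡ true → ∀ a b → outside c (square χ a b) ≡ false →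
    ∃[ s ] outside c (square χ 0F s) ≡ false × ∃[ r ] outside c (square χ r s) ≡ false ×
    ∃[ t ] outside c (square χ r t) ≡ false × outside c (square χ a t) ≡ false
  square-connected = toWitness {a? = all? λ c → all? λ χ → ¬? (c ≟ 0F) →-dec (outside c χ Bool.≟ true) →-dec
    all? λ a → all? λ b → (outside c (square χ a b) Bool.≟ false) →-dec
    any? λ s → (outside c (square χ 0F s) Bool.≟ false) ×-dec any? λ r → (outside c (square χ r s) Bool.≟ false) ×-dec
    any? λ t → (outside c (square χ r t) Bool.≟ false) ×-dec (outside c (square χ a t) Bool.≟ false)} tt

  outside-false : ∀ c a → outside c a ≡ false → a ≡ 0F ⊎ a ≡ c
  outside-false = toWitness {a? = all? λ c → all? λ a → (outside c a Bool.≟ false) →-dec ((a ≟ 0F) ⊎-dec (a ≟ c))} tt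

  outside-true : ∀ c a → outside c a ≡ true → a ≢ 0F × a ≢ c
  outside-true = toWitness {a? = all? λ c → all? λ a → (outside c a Bool.≟ true) →-dec ¬? (a ≟ 0F) ×-dec ¬? (a ≟ c)} tt

module Colouring {n : ℕ} (Q : Quasigroup n) where

  open Quasigroup Q public renaming (op to f)

  Word : Set
  Word = Vec Symbol n

  value : Fin n → Symbol → Word → Symbol
  value i a x = proj₁ (proj₂ (isQuasigroup i x) (f x ⊕ a))

  -- The point of the line through x in direction i where f has increased by a.
  move : Fin n → Symbol → Word → Word
  move i a x = x [ i ]≔ value i a x

  f-move : ∀ i a x → f (move i a x) ≡ f x ⊕ a
  f-move i a x = proj₂ (proj₂ (isQuasigroup i x) (f x ⊕ a)) refl

  f-injective : ∀ i x {a b} → f (x [ i ]≔ a) ≡ f (x [ i ]≔ b) → a ≡ b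
  f-injective i x = proj₁ (isQuasigroup i x)

  value-unique : ∀ i x a {b} → f (x [ i ]≔ b) ≡ f x ⊕ a → b ≡ value i a x
  value-unique i x a p = f-injective i x (trans p (sym (f-move i a x)))

  value-0 : ∀ i x → value i 0F x ≡ lookup x i
  value-0 i x = sym (value-unique i x 0F (trans (cong f ([]≔-lookup x i)) (sym (⊕-identityʳ (f x)))))

  value-injective : ∀ i x {a b} → value i a x ≡ value i b x → a ≡ b
  value-injective i x {a} {b} p = ⊕-injectiveˡ (f x)
    (trans (sym (f-move i a x)) (trans (cong (λ v → f (x [ i ]≔ v)) p) (f-move i b x)))

  value-surjective : ∀ i x b → b ≡ value i (f x ⊕ f (x [ i ]≔ b)) x
  value-surjective i x b = value-unique i x _ (sym (⊕-cancelˡ (f x) _))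

  move-0 : ∀ i x → move i 0F x ≡ x
  move-0 i x = trans (cong (x [ i ]≔_) (value-0 i x)) ([]≔-lookup x i)

  face : Fin n → Fin n → Word → Symbol → Symbol → Word
  face i j x a b = x [ i ]≔ value i a x [ j ]≔ value j b x

  -- The face through x in directions i and j is, after relabelling its lines by the values of f, the table square (χ i j x).
  χ : Fin n → Fin n → Word → Symbol
  χ i j x = colour (f x ⊕ f (face i j x 1F 1F)) (f x ⊕ f (face i j x 2F 2F))

  face-sym : ∀ {i j} → i ≢ j → ∀ x a b → face i j x a b ≡ face j i x b a
  face-sym {i} {j} i≢j x a b = []≔-commutes x i j i≢j

  χ-sym : ∀ {i j} → i ≢ j → ∀ x → χ i j x ≡ χ j i x
  χ-sym i≢j x = cong₂ (λ p q → colour (f x ⊕ f p) (f x ⊕ f q)) (face-sym i≢j x 1F 1F) (face-sym i≢j x 2F 2F)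

  face-0ʳ : ∀ {i j} → i ≢ j → ∀ x a → face i j x a 0F ≡ move i a x
  face-0ʳ {i} {j} i≢j x a = trans (cong (move i a x [ j ]≔_)
    (trans (value-0 j x) (sym (lookup∘update′ (i≢j ∘ sym) x _)))) ([]≔-lookup (move i a x) j)

  face-0ˡ : ∀ {i j} → i ≢ j → ∀ x b → face i j x 0F b ≡ move j b x
  face-0ˡ {i} {j} i≢j x b = trans (face-sym i≢j x 0F b) (face-0ʳ (i≢j ∘ sym) x b)

  module _ {i j : Fin n} (i≢j : i ≢ j) (x : Word) where
    private
      L : Symbol → Symbol → Symbol
      L a b = f x ⊕ f (face i j x a b)

      L-0ʳ : ∀ a → L a 0F ≡ a
      L-0ʳ a = trans (cong (λ y → f x ⊕ f y) (face-0ʳ i≢j x a)) (trans (cong (f x ⊕_) (f-move i a x)) (⊕-cancelˡ (f x) a))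

      L-0ˡ : ∀ b → L 0F b ≡ b
      L-0ˡ b = trans (cong (λ y → f x ⊕ f y) (face-0ˡ i≢j x b)) (trans (cong (f x ⊕_) (f-move j b x)) (⊕-cancelˡ (f x) b))

      row : ∀ {a b c} → b ≢ c → L a b ≢ L a c
      row b≢c p = b≢c (value-injective j x (f-injective j _ (⊕-injectiveˡ (f x) p)))

      col : ∀ {a b c} → a ≢ b → L a c ≢ L b c
      col {a} {b} {c} a≢b p = a≢b (value-injective i x (f-injective i _
        (trans (cong f (sym (face-sym i≢j x a c))) (trans (⊕-injectiveˡ (f x) p) (cong f (face-sym i≢j x b c))))))

      row0 : ∀ a {b} → b ≢ 0F → L a b ≢ a
      row0 a b≢0 p = row b≢0 (trans p (sym (L-0ʳ a)))

      col0 : ∀ b {a} → a ≢ 0F → L a b ≢ b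
      col0 b a≢0 p = col a≢0 (trans p (sym (L-0ˡ b)))

      cells = latin-square
        (L 1F 1F) (row0 1F λ ()) (L 1F 2F) (row0 1F λ ()) (col0 2F λ ()) (row λ ())
        (L 1F 3F) (row0 1F λ ()) (col0 3F λ ()) (row λ ()) (row λ ())
        (L 2F 1F) (row0 2F λ ()) (col0 1F λ ()) (col λ ()) (L 2F 2F) (row0 2F λ ()) (col λ ()) (row λ ())
        (L 2F 3F) (row0 2F λ ()) (col0 3F λ ()) (col λ ()) (row λ ()) (row λ ())
        (L 3F 1F) (row0 3F λ ()) (col0 1F λ ()) (col λ ()) (col λ ())
        (L 3F 2F) (row0 3F λ ()) (col0 2F λ ()) (col λ ()) (col λ ()) (row λ ())
        (L 3F 3F) (row0 3F λ ()) (col λ ()) (col λ ()) (row λ ()) (row λ ())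

      L-square : ∀ a b → L a b ≡ square (χ i j x) a b
      L-square 0F b = trans (L-0ˡ b) (sym (square-0ˡ (χ i j x) b))
      L-square 1F 0F = trans (L-0ʳ _) (sym (square-0ʳ (χ i j x) _))
      L-square 2F 0F = trans (L-0ʳ _) (sym (square-0ʳ (χ i j x) _))
      L-square 3F 0F = trans (L-0ʳ _) (sym (square-0ʳ (χ i j x) _))
      L-square 1F 1F = proj₁ (proj₁ cells)
      L-square 1F 2F = proj₁ (proj₂ (proj₁ cells))
      L-square 1F 3F = proj₂ (proj₂ (proj₁ cells))
      L-square 2F 1F = proj₁ (proj₁ (proj₂ cells))
      L-square 2F 2F = proj₁ (proj₂ (proj₁ (proj₂ cells)))
      L-square 2F 3F = proj₂ (proj₂ (proj₁ (proj₂ cells)))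
      L-square 3F 1F = proj₁ (proj₂ (proj₂ cells))
      L-square 3F 2F = proj₁ (proj₂ (proj₂ (proj₂ cells)))
      L-square 3F 3F = proj₂ (proj₂ (proj₂ (proj₂ cells)))

    f-face : ∀ a b → f (face i j x a b) ≡ f x ⊕ square (χ i j x) a b
    f-face a b = trans (sym (⊕-cancelˡ (f x) _)) (cong (f x ⊕_) (L-square a b))

    χ-unique : ∀ ψ → (∀ a b → f (face i j x a b) ≡ f x ⊕ square ψ a b) → χ i j x ≡ ψ
    χ-unique ψ p = trans (cong₂ colour (q 1F 1F) (q 2F 2F)) (colour-square ψ)
      where
      q : ∀ a b → L a b ≡ square ψ a b
      q a b = trans (cong (f x ⊕_) (p a b)) (⊕-cancelˡ (f x) _)

  χ-update-move : ∀ {i j} → i ≢ j → ∀ e x → χ i j (move i e x) ≡ χ i j x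
  χ-update-move {i} {j} i≢j e x = χ-unique i≢j y ψ λ a b →
    let β = value j b y
        -- The label at x of the column that has label b at y.
        β′ = f x ⊕ f (x [ j ]≔ β)
        β≡ : β ≡ value j β′ x
        β≡ = value-surjective j x β
        y-β : f (face i j x e β′) ≡ f y ⊕ b
        y-β = trans (cong (λ v → f (y [ j ]≔ v)) (sym β≡)) (f-move j b y)
        e-eq : square ψ e β′ ≡ e ⊕ b
        e-eq = ⊕-injectiveˡ (f x) (trans (sym (f-face i≢j x e β′)) (trans y-β
                 (trans (cong (_⊕ b) (f-move i e x)) (⊕-assoc (f x) e b))))
        α≡ : value i a y ≡ value i (a ⊕ e) x
        α≡ = value-unique i x (a ⊕ e) (trans (cong f (sym ([]≔-idempotent x i)))
               (trans (f-move i a y) (trans (cong (_⊕ a) (f-move i e x))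
               (trans (⊕-assoc (f x) e a) (cong (f x ⊕_) (⊕-comm e a))))))
    in begin
      f (face i j y a b)                      ≡⟨ cong (λ z → f (z [ j ]≔ β)) ([]≔-idempotent x i) ⟩
      f (x [ i ]≔ value i a y [ j ]≔ β)       ≡⟨ cong₂ (λ u v → f (x [ i ]≔ u [ j ]≔ v)) α≡ β≡ ⟩
      f (face i j x (a ⊕ e) β′)               ≡⟨ f-face i≢j x (a ⊕ e) β′ ⟩
      f x ⊕ square ψ (a ⊕ e) β′               ≡⟨ cong (f x ⊕_) (square-shift ψ e b β′ e-eq a) ⟩
      f x ⊕ (e ⊕ square ψ a b)                ≡⟨ ⊕-assoc (f x) e _ ⟨
      f x ⊕ e ⊕ square ψ a b                  ≡⟨ cong (_⊕ square ψ a b) (f-move i e x) ⟨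
      f y ⊕ square ψ a b                      ∎
    where
    open ≡-Reasoning
    y = move i e x
    ψ = χ i j x

  χ-updateˡ : ∀ {i j} → i ≢ j → ∀ x v → χ i j (x [ i ]≔ v) ≡ χ i j x
  χ-updateˡ {i} {j} i≢j x v = trans (cong (λ w → χ i j (x [ i ]≔ w)) (value-surjective i x v))
    (χ-update-move i≢j (f x ⊕ f (x [ i ]≔ v)) x)

  χ-updateʳ : ∀ {i j} → i ≢ j → ∀ x v → χ i j (x [ j ]≔ v) ≡ χ i j x
  χ-updateʳ i≢j x v = trans (χ-sym i≢j _) (trans (χ-updateˡ (i≢j ∘ sym) x v) (χ-sym (i≢j ∘ sym) x))

  module _ {i j k : Fin n} (i≢j : i ≢ j) (i≢k : i ≢ k) (j≢k : j ≢ k) (x : Word) where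
    private
      χ₁ = χ i k x
      χ₂ = χ j k x
      χ′ : Symbol → Symbol
      χ′ g = χ i j (move k g x)

      point : Symbol → Symbol → Symbol → Word
      point g a b = x [ k ]≔ value k g x [ i ]≔ value i a x [ j ]≔ value j b x

      -- A letter with label a at x has another label at the point of layer g; this is the origin of
      -- the inner terms of `layer`.
      value-layer : ∀ {l} → l ≢ k → ∀ g a → value l a x ≡ value l (g ⊕ square (χ l k x) a g) (move k g x)
      value-layer {l} l≢k g a = value-unique l (move k g x) _ (begin
        f (move k g x [ l ]≔ value l a x)             ≡⟨ cong f (face-sym l≢k x a g) ⟨
        f (face l k x a g)                            ≡⟨ f-face l≢k x a g ⟩
        f x ⊕ s                                       ≡⟨ cong (f x ⊕_) (⊕-cancelˡ g s) ⟨
        f x ⊕ (g ⊕ (g ⊕ s))                           ≡⟨ ⊕-assoc (f x) g _ ⟨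
        f x ⊕ g ⊕ (g ⊕ s)                             ≡⟨ cong (_⊕ (g ⊕ s)) (f-move k g x) ⟨
        f (move k g x) ⊕ (g ⊕ s)                      ∎)
        where
        open ≡-Reasoning
        s = square (χ l k x) a g

      f-point : ∀ g a b → f (point g a b) ≡ f x ⊕ layer χ₁ χ₂ g (χ′ g) a b
      f-point g a b = trans (cong₂ (λ u v → f (move k g x [ i ]≔ u [ j ]≔ v)) (value-layer i≢k g a) (value-layer j≢k g b))
        (trans (f-face i≢j (move k g x) _ _)
        (trans (cong (_⊕ square (χ′ g) (g ⊕ square χ₁ a g) (g ⊕ square χ₂ b g)) (f-move k g x)) (⊕-assoc (f x) g _)))

      point-k : ∀ g a b → point g a b ≡ x [ i ]≔ value i a x [ j ]≔ value j b x [ k ]≔ value k g x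
      point-k g a b = trans (cong (_[ j ]≔ value j b x) ([]≔-commutes x k i (i≢k ∘ sym)))
        ([]≔-commutes _ k j (j≢k ∘ sym))

      disjoint : ∀ g h → g ≢ h → ∀ {p q} → χ′ g ≡ p → χ′ h ≡ q → Disjoint χ₁ χ₂ g p h q
      disjoint g h g≢h refl refl a b p = g≢h (value-injective k x (f-injective k _
        (trans (cong f (sym (point-k g a b))) (trans (trans (f-point g a b) (trans (cong (f x ⊕_) p) (sym (f-point h a b))))
        (cong f (point-k h a b))))))

      l : Vec Symbol 4
      l = χ i j x ∷ χ′ 1F ∷ χ′ 2F ∷ χ′ 3F ∷ []

      χ′-0 : χ′ 0F ≡ χ i j x
      χ′-0 = cong (χ i j) (move-0 k x)

      l-χ′ : ∀ g → lookup l g ≡ χ′ g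
      l-χ′ 0F = sym χ′-0
      l-χ′ 1F = refl
      l-χ′ 2F = refl
      l-χ′ 3F = refl

      facts : CubeFacts χ₁ χ₂ l
      facts = latin-cube χ₁ χ₂ (χ i j x) (χ′ 1F) (disjoint 0F 1F (λ ()) χ′-0 refl)
        (χ′ 2F) (disjoint 0F 2F (λ ()) χ′-0 refl) (disjoint 1F 2F (λ ()) refl refl)
        (χ′ 3F) (disjoint 0F 3F (λ ()) χ′-0 refl) (disjoint 1F 3F (λ ()) refl refl) (disjoint 2F 3F (λ ()) refl refl)

    no-rainbow : ¬ (χ i j x ≢ χ i k x × χ i j x ≢ χ j k x × χ i k x ≢ χ j k x)
    no-rainbow = proj₁ facts

    colour-stays : ∀ {c} → χ i j x ≡ c → c ≢ 0F → χ i k x ≡ 0F ⊎ χ i k x ≡ c → χ i j (move k c x) ≡ c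
    colour-stays refl c≢0 p = trans (sym (l-χ′ _)) (proj₁ (proj₂ facts) c≢0 p)

    -- Of the three rules for moving k this one produces the third colour, from which
    -- `no-alternating-path` obtains its rainbow triangle.
    colour-flips : ∀ {c d} → χ i j x ≡ c → c ≢ 0F → χ i k x ≡ d → χ j k x ≡ d → d ≢ 0F → d ≢ c →
      χ i j (move k c x) ≡ c ⊕ d
    colour-flips refl c≢0 refl p d≢0 d≢c = trans (sym (l-χ′ _)) (proj₁ (proj₂ (proj₂ facts)) (sym p) d≢0 c≢0 d≢c)

    colour-survives : ∀ {c d} → χ i j x ≡ d → χ i k x ≡ d → d ≢ 0F → χ j k x ≡ c → c ≢ 0F → c ≢ d →
      χ i j (move k c x) ≡ d
    colour-survives refl p d≢0 refl c≢0 c≢d = trans (sym (l-χ′ _))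
      (proj₂ (proj₂ (proj₂ facts)) (sym p) (d≢0 ∘ trans (sym p)) c≢0 (c≢d ∘ (λ q → trans q p)))

-- Sets of coordinates

by-cases : ∀ (b : Bool) {P : Set} → (b ≡ true → P) → (b ≡ false → P) → P
by-cases true  p q = p refl
by-cases false p q = q refl

Region : ℕ → Set
Region n = Fin n → Bool

count : ∀ {n} → Region n → ℕ
count {zero}  A = 0
count {suc n} A = (if A zero then 1 else 0) + count (A ∘ suc)

count≤n : ∀ {n} (A : Region n) → count A ≤ n
count≤n {zero}  A = z≤n
count≤n {suc n} A with A zero
... | true  = s≤s (count≤n (A ∘ suc))
... | false = ℕ.m≤n⇒m≤1+n (count≤n (A ∘ suc))

count-cong : ∀ {n} {A B : Region n} → (∀ i → A i ≡ B i) → count A ≡ count B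
count-cong {zero}  p = refl
count-cong {suc n} p = cong₂ (λ b m → (if b then 1 else 0) + m) (p zero) (count-cong (p ∘ suc))

insert : ∀ {n} → Fin n → Region n → Region n
insert i A j = does (j ≟ i) ∨ A j

insert-self : ∀ {n} (i : Fin n) A → insert i A i ≡ true
insert-self i A = cong (_∨ A i) (dec-true (i ≟ i) refl)

insert-⊆ : ∀ {n} (i : Fin n) A j → A j ≡ true → insert i A j ≡ true
insert-⊆ i A j p = trans (cong (does (j ≟ i) ∨_) p) (Bool.∨-zeroʳ _)

insert-true : ∀ {n} {i : Fin n} {A} j → insert i A j ≡ true → j ≡ i ⊎ A j ≡ true
insert-true {i = i} j p with j ≟ i
... | yes q = inj₁ q
... | no  _ = inj₂ p

count-insert : ∀ {n} (i : Fin n) A → A i ≡ false → count (insert i A) ≡ suc (count A)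
count-insert zero    A p rewrite p = cong suc (count-cong {A = insert zero A ∘ suc} {A ∘ suc} λ j → refl)
count-insert (suc i) A p = trans (cong ((if A zero then 1 else 0) +_) (trans (count-cong q) (count-insert i (A ∘ suc) p)))
  (ℕ.+-suc _ _)
  where
  q : ∀ j → insert (suc i) A (suc j) ≡ insert i (A ∘ suc) j
  q j with j ≟ i
  ... | yes _ = refl
  ... | no  _ = refl

any-word? : ∀ {n} {P : Vec Symbol n → Set} → (∀ x → Dec (P x)) → Dec (∃ P)
any-word? {zero}  P? = map′ ([] ,_) (λ { ([] , p) → p }) (P? [])
any-word? {suc n} P? = map′ (λ { (a , x , p) → a ∷ x , p }) (λ { (a ∷ x , p) → a , x , p })
  (any? λ a → any-word? λ x → P? (a ∷ x))

infix 4 _≈[_]_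

-- S plays the role of the free coordinates, everything else being frozen. As a record the relation
-- keeps S and both words visible to inference, which the bare function type would not.
record _≈[_]_ {n} (x : Vec Symbol n) (S : Region n) (y : Vec Symbol n) : Set where
  constructor agreeing
  field agree : ∀ i → S i ≡ false → lookup x i ≡ lookup y i

open _≈[_]_ public

≈-refl : ∀ {n} {S : Region n} {x} → x ≈[ S ] x
≈-refl = agreeing λ _ _ → refl

≈-sym : ∀ {n} {S : Region n} {x y} → x ≈[ S ] y → y ≈[ S ] x
≈-sym p = agreeing λ i q → sym (agree p i q)

≈-trans : ∀ {n} {S : Region n} {x y z} → x ≈[ S ] y → y ≈[ S ] z → x ≈[ S ] z
≈-trans p q = agreeing λ i r → trans (agree p i r) (agree q i r)

≈-update : ∀ {n} {S : Region n} {x y} i a → S i ≡ true → x ≈[ S ] y → x [ i ]≔ a ≈[ S ] y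
≈-update {S = S} {x} {y} i a Si p = agreeing q
  where
  q : ∀ j → S j ≡ false → lookup (x [ i ]≔ a) j ≡ lookup y j
  q j Sj with j ≟ i
  ... | yes refl = case trans (sym Si) Sj of λ ()
  ... | no j≢i   = trans (lookup∘update′ j≢i x a) (agree p j Sj)

-- The letters are replaced from left to right, and a letter already replaced is absorbed into R.
≈-invariant : ∀ {n} (S : Region n) (R : Vec Symbol n → Set) →
  (∀ x i a → S i ≡ true → R x → R (x [ i ]≔ a)) → ∀ x y → x ≈[ S ] y → R x → R y
≈-invariant S R r []      []      p q = q
≈-invariant S R r (a ∷ x) (b ∷ y) p q =
  ≈-invariant (S ∘ suc) (R ∘ (b ∷_)) (λ z i → r (b ∷ z) (suc i)) x y (agreeing (agree p ∘ suc)) (head (S zero) refl)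
  where
  head : ∀ s → S zero ≡ s → R (b ∷ x)
  head true  Sz = r (a ∷ x) zero b Sz q
  head false Sz = subst (λ d → R (d ∷ x)) (agree p zero Sz) q

module Component {n : ℕ} (E : Fin n → Fin n → Set) (E? : ∀ i j → Dec (E i j)) where

  Generated : Fin n → Region n → Set₁
  Generated i₀ A = (C : Fin n → Set) → C i₀ → (∀ {i j} → A i ≡ true → C i → E i j → C j) → ∀ j → A j ≡ true → C j

  record IsComponent (i₀ : Fin n) (A : Region n) : Set₁ where
    field
      contains  : A i₀ ≡ true
      closed    : ∀ {i j} → A i ≡ true → E i j → A j ≡ true
      generated : Generated i₀ A

  private
    -- Each round inserts one new coordinate and |A| never exceeds n, so fuel of at least n - |A|
    -- cannot run out.
    grow : ∀ i₀ fuel A → n ≤ fuel + count A → A i₀ ≡ true → Generated i₀ A → ∃ (IsComponent i₀)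
    grow i₀ fuel A bound i₀∈A gen
      with any? (λ i → any? λ j → (A i Bool.≟ true) ×-dec (A j Bool.≟ false) ×-dec E? i j)
    ... | no ¬exit = A , record { contains = i₀∈A ; generated = gen ; closed = λ {i} {j} i∈A e → inside i∈A e (A j) refl }
      where
      inside : ∀ {i j} → A i ≡ true → E i j → ∀ b → A j ≡ b → A j ≡ true
      inside i∈A e true  p = p
      inside i∈A e false p = ⊥-elim (¬exit (_ , _ , i∈A , p , e))
    ... | yes (i , j , i∈A , j∉A , e) = next fuel bound
      where
      gen′ : Generated i₀ (insert j A)
      gen′ C c₀ step k k∈ with insert-true {i = j} {A} k k∈
      ... | inj₂ k∈A  = gen C c₀ (λ {i} p → step (insert-⊆ j A i p)) k k∈A
      ... | inj₁ refl = step (insert-⊆ j A i i∈A)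
        (gen C c₀ (λ {i} p → step (insert-⊆ j A i p)) i i∈A) e
      size = count-insert j A j∉A
      next : ∀ fuel → n ≤ fuel + count A → ∃ (IsComponent i₀)
      next zero bound = ⊥-elim (ℕ.<-irrefl refl (ℕ.≤-trans (s≤s bound) (subst (_≤ n) size (count≤n (insert j A)))))
      next (suc fuel) bound = grow i₀ fuel (insert j A)
        (subst (n ≤_) (trans (sym (ℕ.+-suc fuel (count A))) (cong (fuel +_) (sym size))) bound)
        (insert-⊆ j A i₀ i₀∈A) gen′

  component : ∀ i₀ → ∃ (IsComponent i₀)
  component i₀ = grow i₀ n (insert i₀ λ _ → false) (ℕ.m≤m+n n _) (insert-self i₀ _) λ C c₀ _ j j∈ →
    case insert-true {i = i₀} {λ _ → false} j j∈ of λ { (inj₁ refl) → c₀ }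

-- Connectedness of the level sets of f modulo {0 , c}

module Levels {n : ℕ} (Q : Quasigroup n) where
  open Colouring Q public

  class : Symbol → Word → Bool
  class c x = outside c (f x)

  class-⊕ : ∀ {c} → c ≢ 0F → ∀ x y → outside c (f x ⊕ f y) ≡ class c x xor class c y
  class-⊕ c≢0 x y = outside-⊕ _ c≢0 (f x) (f y)

  module _ {c : Symbol} (c≢0 : c ≢ 0F) where

    class-move : ∀ i a x → class c (move i a x) ≡ class c x xor outside c a
    class-move i a x = trans (cong (outside c) (f-move i a x)) (outside-⊕ c c≢0 (f x) a)

    class-face : ∀ {i j} → i ≢ j → ∀ x a b → class c (face i j x a b) ≡ class c x xor outside c (square (χ i j x) a b)
    class-face i≢j x a b = trans (cong (outside c) (f-face i≢j x a b)) (outside-⊕ c c≢0 (f x) _)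

    class-linear : ∀ {i j} → i ≢ j → ∀ x → outside c (χ i j x) ≡ false → ∀ u v →
      class c (x [ i ]≔ u [ j ]≔ v) ≡ class c x xor (class c x xor class c (x [ i ]≔ u)) xor (class c x xor class c (x [ j ]≔ v))
    class-linear {i} {j} i≢j x lin u v = begin
      class c (x [ i ]≔ u [ j ]≔ v)
        ≡⟨ cong₂ (λ p q → class c (x [ i ]≔ p [ j ]≔ q)) (value-surjective i x u) (value-surjective j x v) ⟩
      class c (face i j x a b)                                    ≡⟨ class-face i≢j x a b ⟩
      class c x xor outside c (square (χ i j x) a b)
        ≡⟨ cong (class c x xor_) (trans (square-linear c _ c≢0 lin a b) (cong₂ _xor_ (class-⊕ c≢0 x _) (class-⊕ c≢0 x _))) ⟩
      class c x xor (class c x xor class c (x [ i ]≔ u)) xor (class c x xor class c (x [ j ]≔ v)) ∎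
      where
      open ≡-Reasoning
      a = f x ⊕ f (x [ i ]≔ u)
      b = f x ⊕ f (x [ j ]≔ v)

    module Joined (A : Region n) where

      -- Connectedness by single-letter changes in A that preserve f modulo {0 , c}.
      infix 4 _∼_

      data _∼_ : Word → Word → Set where
        done : ∀ {x} → x ∼ x
        step : ∀ {x y} i a → A i ≡ true → class c (x [ i ]≔ a) ≡ class c x → x [ i ]≔ a ∼ y → x ∼ y

      ∼-trans : ∀ {x y z} → x ∼ y → y ∼ z → x ∼ z
      ∼-trans done             q = q
      ∼-trans (step i a m e p) q = step i a m e (∼-trans p q)

      ∼-reflexive : ∀ {x y} → x ≡ y → x ∼ y
      ∼-reflexive refl = done

      ∼-sym : ∀ {x y} → x ∼ y → y ∼ x
      ∼-sym done = done
      ∼-sym {x} (step i a m e p) = ∼-trans (∼-sym p)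
        (step i (lookup x i) m (trans (cong (class c) back) (sym e)) (∼-reflexive back))
        where
        back : x [ i ]≔ a [ i ]≔ lookup x i ≡ x
        back = trans ([]≔-idempotent x i) ([]≔-lookup x i)

      class-∼ : ∀ {x y} → x ∼ y → class c y ≡ class c x
      class-∼ done             = refl
      class-∼ (step i a m e p) = trans (class-∼ p) e

      ∼-line : ∀ {i} → A i ≡ true → ∀ x a b → class c (x [ i ]≔ a) ≡ class c (x [ i ]≔ b) → x [ i ]≔ a ∼ x [ i ]≔ b
      ∼-line {i} m x a b e = step i b m (trans (cong (class c) ([]≔-idempotent x i)) (sym e)) (∼-reflexive ([]≔-idempotent x i))

      ∼-line₀ : ∀ {i} → A i ≡ true → ∀ x a → class c (x [ i ]≔ a) ≡ class c x → x ∼ x [ i ]≔ a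
      ∼-line₀ {i} m x a e = step i a m e done

      -- The five rook moves of `square-connected` are five changes of a single letter, none of
      -- which leaves the class of x.
      ∼-face : ∀ {i j} → A i ≡ true → A j ≡ true → i ≢ j → ∀ x → outside c (χ i j x) ≡ true →
        ∀ u v → class c (x [ i ]≔ u [ j ]≔ v) ≡ class c x → x ∼ x [ i ]≔ u [ j ]≔ v
      ∼-face {i} {j} mi mj i≢j x nonlin u v e =
        let s , ps , r , pr , t , pt , p = square-connected c (χ i j x) c≢0 nonlin a b flat
        in subst₂ _∼_ (trans (face-0ˡ i≢j x 0F) (move-0 j x)) (sym uv≡)
          (∼-trans (∼-j 0F 0F s (outside-0 c (χ i j x)) ps)
          (∼-trans (∼-i 0F r s ps pr)
          (∼-trans (∼-j r s t pr pt)
          (∼-trans (∼-i r a t pt p)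
          (∼-j a t b p flat)))))
        where
        a = f x ⊕ f (x [ i ]≔ u)
        b = f x ⊕ f (x [ j ]≔ v)
        uv≡ : x [ i ]≔ u [ j ]≔ v ≡ face i j x a b
        uv≡ = cong₂ (λ p q → x [ i ]≔ p [ j ]≔ q) (value-surjective i x u) (value-surjective j x v)
        outside-0 : ∀ c χ → outside c (square χ 0F 0F) ≡ false
        outside-0 c χ = cong (outside c) (square-0ˡ χ 0F)
        xor-cancel : ∀ p q → p xor q ≡ p → q ≡ false
        xor-cancel false q e = e
        xor-cancel true false e = refl
        flat : outside c (square (χ i j x) a b) ≡ false
        flat = xor-cancel (class c x) _ (trans (sym (class-face i≢j x a b)) (trans (cong (class c) (sym uv≡)) e))
        Flat : Symbol → Symbol → Set
        Flat a b = outside c (square (χ i j x) a b) ≡ false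
        level : ∀ a b → Flat a b → class c (face i j x a b) ≡ class c x
        level a b p = trans (class-face i≢j x a b) (trans (cong (class c x xor_) p) (Bool.xor-identityʳ _))
        ∼-j : ∀ a b b′ → Flat a b → Flat a b′ → face i j x a b ∼ face i j x a b′
        ∼-j a b b′ p p′ = ∼-line mj (x [ i ]≔ _) _ _ (trans (level a b p) (sym (level a b′ p′)))
        ∼-i : ∀ a a′ b → Flat a b → Flat a′ b → face i j x a b ∼ face i j x a′ b
        ∼-i a a′ b p p′ = subst₂ _∼_ (sym (face-sym i≢j x a b)) (sym (face-sym i≢j x a′ b))
          (∼-line mi (x [ j ]≔ _) _ _ (subst₂ (λ y z → class c y ≡ class c z) (face-sym i≢j x a b) (face-sym i≢j x a′ b)
            (trans (level a b p) (sym (level a′ b p′)))))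

∃outside : ∀ c → c ≢ 0F → ∃[ d ] outside c d ≡ true
∃outside 0F p = ⊥-elim (p refl)
∃outside 1F _ = 2F , refl
∃outside 2F _ = 1F , refl
∃outside 3F _ = 1F , refl

xor-not : ∀ a → a xor true ≡ not a
xor-not a = Bool.xor-comm a true

xor-false : ∀ p q → p xor q ≡ false → p ≡ q
xor-false false false _ = refl
xor-false true  true  _ = refl

-- The coordinates in S are active and the others are frozen at x₀. This stands for the quasigroup
-- of arity |S| that f induces, and lets the induction pass to components without changing Q or the
-- type of words.
module Active {n : ℕ} (Q : Quasigroup n) (S : Region n) (x₀ : Vec Symbol n) where
  open Levels Q public

  ≈? : ∀ x → Dec (x ≈[ S ] x₀)
  ≈? x = map′ agreeing agree (all? λ i → (S i Bool.≟ false) →-dec (lookup x i ≟ lookup x₀ i))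

  -- f modulo {0 , c} is not a sum of a function independent of xᵢ and one independent of xⱼ.
  Edge : Symbol → Fin n → Fin n → Set
  Edge c i j = S i ≡ true × S j ≡ true × i ≢ j × ∃[ x ] (x ≈[ S ] x₀ × outside c (χ i j x) ≡ true)

  edge? : ∀ c i j → Dec (Edge c i j)
  edge? c i j = (S i Bool.≟ true) ×-dec (S j Bool.≟ true) ×-dec ¬? (i ≟ j) ×-dec
    any-word? λ x → ≈? x ×-dec (outside c (χ i j x) Bool.≟ true)

  module Comp (c : Symbol) = Component (Edge c) (edge? c)
  open Comp public using (IsComponent)

  module _ {c : Symbol} (c≢0 : c ≢ 0F) {i₀ : Fin n} (S∋i₀ : S i₀ ≡ true) {A : Region n} (isC : IsComponent c i₀ A) where
    open Component.IsComponent isC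
    open Joined c≢0 A

    component-⊆ : ∀ j → A j ≡ true → S j ≡ true
    component-⊆ = generated (λ j → S j ≡ true) S∋i₀ (λ _ _ e → proj₁ (proj₂ e))

    closed-linear : ∀ {i j} → A i ≡ true → A j ≡ false → S j ≡ true → ∀ {x} → x ≈[ S ] x₀ →
      outside c (χ i j x) ≡ false
    closed-linear {i} {j} i∈A j∉A j∈S {x} x≈ = go _ refl
      where
      i≢j : i ≢ j
      i≢j refl = case trans (sym i∈A) j∉A of λ ()
      go : ∀ b → outside c (χ i j x) ≡ b → outside c (χ i j x) ≡ false
      go false p = p
      go true  p = case trans (sym (closed i∈A (component-⊆ i i∈A , j∈S , i≢j , x , x≈ , p))) j∉A of λ ()

    class-parallel : ∀ {i j} → i ≢ j → ∀ x → outside c (χ i j x) ≡ false → ∀ u v →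
      class c (x [ i ]≔ u [ j ]≔ v) xor class c (x [ j ]≔ v) ≡ class c (x [ i ]≔ u) xor class c x
    class-parallel i≢j x lin u v = trans (cong (_xor class c (x [ _ ]≔ v)) (class-linear c≢0 i≢j x lin u v))
      (lemma (class c x) (class c (x [ _ ]≔ u)) (class c (x [ _ ]≔ v)))
      where
      lemma : ∀ p q r → (p xor (p xor q) xor (p xor r)) xor r ≡ q xor p
      lemma false false false = refl
      lemma false false true  = refl
      lemma false true  false = refl
      lemma false true  true  = refl
      lemma true  false false = refl
      lemma true  false true  = refl
      lemma true  true  false = refl
      lemma true  true  true  = refl

    class-parallel-≡ : ∀ {i j} → i ≢ j → ∀ x → outside c (χ i j x) ≡ false → ∀ u v →
      class c (x [ i ]≔ u) ≡ class c x → class c (x [ i ]≔ u [ j ]≔ v) ≡ class c (x [ j ]≔ v)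
    class-parallel-≡ {i} {j} i≢j x lin u v e = xor-false _ _ (trans (class-parallel i≢j x lin u v)
      (trans (cong (_xor class c x) e) (Bool.xor-same (class c x))))

    private
      d : Symbol
      d = proj₁ (∃outside c c≢0)

      -- ρ i changes the class. Up to ∼ the ρ i commute, and ρ i and ρ j agree as soon as they agree at one point;
      -- as they do so along the edges, all of them agree on A, which makes each class connected.
      ρ : Fin n → Word → Word
      ρ i x = move i d x

      class-ρ : ∀ i x → class c (ρ i x) ≡ not (class c x)
      class-ρ i x = trans (class-move c≢0 i d x) (trans (cong (class c x xor_) (proj₂ (∃outside c c≢0))) (xor-not _))

      ρ-≡ : ∀ i {x y} → class c x ≡ class c y → class c (ρ i x) ≡ class c (ρ i y)
      ρ-≡ i {x} {y} e = trans (class-ρ i x) (trans (cong not e) (sym (class-ρ i y)))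

      ρ-line : ∀ {i} → A i ≡ true → ∀ x a b → class c (x [ i ]≔ a) ≡ not (class c (x [ i ]≔ b)) → x [ i ]≔ a ∼ ρ i (x [ i ]≔ b)
      ρ-line {i} m x a b e = subst (x [ i ]≔ a ∼_) (sym ([]≔-idempotent x i))
        (∼-line m x a _ (trans e (trans (sym (class-ρ i _)) (cong (class c) ([]≔-idempotent x i)))))

      -- In a linear face the change of letter j can be repeated after ρ i, and the results then
      -- differ on a line only. In a nonlinear face both points lie in one connected level set.
      ρ-step : ∀ {i j} → A i ≡ true → A j ≡ true → ∀ x b → class c (x [ j ]≔ b) ≡ class c x → ρ i x ∼ ρ i (x [ j ]≔ b)
      ρ-step {i} {j} mi mj x b e with i ≟ j
      ... | yes refl = ρ-line mi x _ b (trans (class-ρ i x) (cong not (sym e)))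
      ... | no i≢j = split _ refl
        where
        y = x [ j ]≔ b
        p = ρ i x [ j ]≔ b
        p≡ : p ≡ y [ i ]≔ value i d x
        p≡ = []≔-commutes x i j i≢j
        p≡₂ : ρ i y ≡ ρ i x [ i ]≔ value i d y [ j ]≔ b
        p≡₂ = trans ([]≔-commutes x j i (i≢j ∘ sym)) (cong (_[ j ]≔ b) (sym ([]≔-idempotent x i)))
        split : ∀ t → outside c (χ i j x) ≡ t → ρ i x ∼ ρ i y
        split false lin = ∼-trans (∼-line₀ mj (ρ i x) b cp)
          (subst (_∼ ρ i y) (sym p≡) (∼-line mi y _ _ (trans (cong (class c) (sym p≡)) (trans cp (ρ-≡ i (sym e))))))
          where
          cp : class c p ≡ class c (ρ i x)
          cp = trans (cong (class c) p≡) (class-parallel-≡ (i≢j ∘ sym) x (trans (cong (outside c) (χ-sym (i≢j ∘ sym) x)) lin) b _ e)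
        split true nonlin = subst (ρ i x ∼_) (sym p≡₂) (∼-face mi mj i≢j (ρ i x)
          (trans (cong (outside c) (χ-updateˡ i≢j x _)) nonlin) _ b
          (trans (cong (class c) (sym p≡₂)) (ρ-≡ i e)))

      ρ-∼ : ∀ {i} → A i ≡ true → ∀ {x y} → x ∼ y → ρ i x ∼ ρ i y
      ρ-∼ mi done = done
      ρ-∼ mi (step j b mj e p) = ∼-trans (ρ-step mi mj _ b e) (ρ-∼ mi p)

      ρ-comm : ∀ {i j} → A i ≡ true → A j ≡ true → ∀ x → ρ i (ρ j x) ∼ ρ j (ρ i x)
      ρ-comm {i} {j} mi mj x with i ≟ j
      ... | yes refl = done
      ... | no i≢j = split _ refl
        where
        not² : ∀ i j x → class c (ρ i (ρ j x)) ≡ class c x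
        not² i j x = trans (class-ρ i _) (trans (cong not (class-ρ j x)) (Bool.not-involutive _))
        split : ∀ t → outside c (χ i j x) ≡ t → ρ i (ρ j x) ∼ ρ j (ρ i x)
        split true nonlin = ∼-trans (∼-sym (subst (x ∼_) ([]≔-commutes x i j i≢j)
            (∼-face mi mj i≢j x nonlin _ _ (trans (cong (class c) ([]≔-commutes x i j i≢j)) (not² i j x)))))
          (∼-face mi mj i≢j x nonlin _ _ (not² j i x))
        -- The corner of the face where both letters are changed as at x shares a line with each of
        -- the two points.
        split false lin = ∼-trans
          (∼-line mi (ρ j x) _ (value i d x) (trans (not² i j x) (sym e₂)))
          (subst (_∼ ρ j (ρ i x)) ([]≔-commutes x i j i≢j) (∼-line mj (ρ i x) _ _
            (trans (cong (class c) ([]≔-commutes x i j i≢j)) (trans e₂ (sym (not² j i x))))))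
          where
          e₂ : class c (ρ j x [ i ]≔ value i d x) ≡ class c x
          e₂ = trans (cong (class c) (sym ([]≔-commutes x i j i≢j))) (lemma _ _ _ (class-parallel i≢j x lin (value i d x) (value j d x))
                 (class-ρ j x) (class-ρ i x))
            where
            lemma : ∀ p q r → p xor q ≡ r xor class c x → q ≡ not (class c x) → r ≡ not (class c x) → p ≡ class c x
            lemma p q r e refl refl = xor-cancelʳ p _ _ e
              where
              xor-cancelʳ : ∀ p s t → p xor s ≡ s xor t → p ≡ t
              xor-cancelʳ false false false _ = refl
              xor-cancelʳ false true  true  ()
              xor-cancelʳ false true  false _ = refl
              xor-cancelʳ true  false true  _ = refl
              xor-cancelʳ true  true  true  _ = refl

      ρ-same : ∀ {i j} → A i ≡ true → A j ≡ true → i ≢ j → ∀ x → outside c (χ i j x) ≡ true → ρ i x ∼ ρ j x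
      ρ-same {i} {j} mi mj i≢j x nonlin = subst (ρ i x ∼_) p≡ (∼-face mi mj i≢j (ρ i x)
        (trans (cong (outside c) (χ-updateˡ i≢j x _)) nonlin) _ _
        (trans (cong (class c) p≡) (trans (class-ρ j x) (sym (class-ρ i x)))))
        where
        p≡ : ρ i x [ i ]≔ lookup x i [ j ]≔ value j d x ≡ ρ j x
        p≡ = cong (_[ j ]≔ value j d x) (trans ([]≔-idempotent x i) ([]≔-lookup x i))

      ρ-elsewhere : ∀ {i l} → A i ≡ true → A l ≡ false → S l ≡ true → ∀ {x} → x ≈[ S ] x₀ → ∀ a → ρ i x [ l ]≔ a ∼ ρ i (x [ l ]≔ a)
      ρ-elsewhere {i} {l} mi l∉A l∈S {x} x≈ a = subst (_∼ ρ i (x [ l ]≔ a)) (sym p≡)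
        (∼-line mi (x [ l ]≔ a) _ _ (trans (cong (class c) (sym p≡)) (trans (lemma (class-parallel i≢l x lin _ a) (class-ρ i x))
        (sym (class-ρ i _)))))
        where
        i≢l : i ≢ l
        i≢l refl = case trans (sym mi) l∉A of λ ()
        lin = closed-linear mi l∉A l∈S x≈
        p≡ : ρ i x [ l ]≔ a ≡ x [ l ]≔ a [ i ]≔ value i d x
        p≡ = []≔-commutes x i l i≢l
        lemma : ∀ {p q r s} → p xor q ≡ r xor s → r ≡ not s → p ≡ not q
        lemma {p} {q} {s = s} e refl = go p q s e
          where
          go : ∀ p q s → p xor q ≡ not s xor s → p ≡ not q
          go false true  _     _ = refl
          go true  false _     _ = refl
          go false false false ()
          go false false true  ()
          go true  true  false ()
          go true  true  true  ()

      ∼-elsewhere : ∀ {l} → A l ≡ false → S l ≡ true → ∀ a {x y} → x ≈[ S ] x₀ → x ∼ y → x [ l ]≔ a ∼ y [ l ]≔ a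
      ∼-elsewhere l∉A l∈S a x≈ done = done
      ∼-elsewhere {l} l∉A l∈S a {x} {y} x≈ (step i b mi e p) =
        step i b mi (trans (cong (class c) ([]≔-commutes x l i (i≢l ∘ sym))) (class-parallel-≡ i≢l x (closed-linear mi l∉A l∈S x≈) b a e))
          (subst (_∼ y [ l ]≔ a) ([]≔-commutes x i l i≢l)
            (∼-elsewhere l∉A l∈S a (≈-update i b (component-⊆ i mi) x≈) p))
        where
        i≢l : i ≢ l
        i≢l refl = case trans (sym mi) l∉A of λ ()

      ρ-≈ : ∀ i {x} → S i ≡ true → x ≈[ S ] x₀ → ρ i x ≈[ S ] x₀
      ρ-≈ i = ≈-update i _

      Same : Fin n → Fin n → Word → Set
      Same i j x = x ≈[ S ] x₀ × ρ i x ∼ ρ j x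

      ∼-or-ρ : ∀ {l} → A l ≡ true → ∀ x a → x ∼ x [ l ]≔ a ⊎ ρ l x ∼ x [ l ]≔ a
      ∼-or-ρ {l} ml x a with class c (x [ l ]≔ a) Bool.≟ class c x
      ... | yes e = inj₁ (∼-line₀ ml x a e)
      ... | no  e = inj₂ (∼-line ml x _ _ (trans (class-ρ l x) (sym (Bool.¬-not e))))

      -- Inside A a change of letter amounts, up to ∼, to nothing or to ρ l, and ρ l commutes with ρ
      -- i and ρ j. Outside A no edge leads to A, so both paths can be carried along in parallel.
      -- Thus a single witness of an edge decides the matter at all points.
      same-update : ∀ {i j} → A i ≡ true → A j ≡ true → ∀ x l a → S l ≡ true → Same i j x → Same i j (x [ l ]≔ a)
      same-update {i} {j} mi mj x l a l∈S (x≈ , p) = ≈-update l a l∈S x≈ , inside (A l) refl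
        where
        inside : ∀ b → A l ≡ b → ρ i (x [ l ]≔ a) ∼ ρ j (x [ l ]≔ a)
        inside true ml with ∼-or-ρ ml x a
        ... | inj₁ q = ∼-trans (∼-sym (ρ-∼ mi q)) (∼-trans p (ρ-∼ mj q))
        ... | inj₂ q = ∼-trans (∼-sym (ρ-∼ mi q)) (∼-trans (ρ-comm mi ml x) (∼-trans (ρ-∼ ml p)
                         (∼-trans (ρ-comm ml mj x) (ρ-∼ mj q))))
        inside false l∉A = ∼-trans (∼-sym (ρ-elsewhere mi l∉A l∈S x≈ a))
          (∼-trans (∼-elsewhere l∉A l∈S a (ρ-≈ i (component-⊆ i mi) x≈) p) (ρ-elsewhere mj l∉A l∈S x≈ a))

      same-edge : ∀ {i j} → A i ≡ true → A j ≡ true → Edge c i j → ∀ x → x ≈[ S ] x₀ → ρ i x ∼ ρ j x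
      same-edge {i} {j} mi mj (_ , _ , i≢j , z , z≈ , nonlin) x x≈ =
        proj₂ (≈-invariant S (Same i j) (same-update mi mj) z x (≈-trans z≈ (≈-sym x≈))
          (z≈ , ρ-same mi mj i≢j z nonlin))

      same-all : ∀ j → A j ≡ true → A j ≡ true × (∀ x → x ≈[ S ] x₀ → ρ i₀ x ∼ ρ j x)
      same-all = generated _ (contains , λ _ _ → done) λ i∈A (_ , p) e → let j∈A = closed i∈A e in
        j∈A , λ x x≈ → ∼-trans (p x x≈) (same-edge i∈A j∈A e x x≈)

    private
      Reached : Word → Word → Set
      Reached x y = (x ∼ y × class c y ≡ class c x) ⊎ (ρ i₀ x ∼ y × class c y ≡ not (class c x))

      ρρ-∼ : ∀ x → x ∼ ρ i₀ (ρ i₀ x)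
      ρρ-∼ x = subst (x ∼_) (sym p) (∼-line₀ contains x _ (trans (cong (class c) (sym p)) (trans (class-ρ i₀ (ρ i₀ x))
        (trans (cong not (class-ρ i₀ x)) (Bool.not-involutive _)))))
        where
        p : ρ i₀ (ρ i₀ x) ≡ x [ i₀ ]≔ value i₀ d (ρ i₀ x)
        p = []≔-idempotent x i₀

      reach : ∀ {x y z l} → A l ≡ true → y ≈[ S ] x₀ → Reached x y → y ∼ z ⊎ ρ l y ∼ z → Reached x z
      reach ml y≈ (inj₁ (p , e)) (inj₁ q) = inj₁ (∼-trans p q , trans (class-∼ q) e)
      reach ml y≈ (inj₂ (p , e)) (inj₁ q) = inj₂ (∼-trans p q , trans (class-∼ q) e)
      reach {x} {y} {z} {l} ml y≈ (inj₁ (p , e)) (inj₂ q) =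
        inj₂ (∼-trans (ρ-∼ contains p) (∼-trans (proj₂ (same-all l ml) y y≈) q) ,
          trans (class-∼ q) (trans (class-ρ l y) (cong not e)))
      reach {x} {y} {z} {l} ml y≈ (inj₂ (p , e)) (inj₂ q) =
        inj₁ (∼-trans (ρρ-∼ x) (∼-trans (ρ-∼ contains p) (∼-trans (proj₂ (same-all l ml) y y≈) q)) ,
          trans (class-∼ q) (trans (class-ρ l y) (trans (cong not e) (Bool.not-involutive _))))

    -- Up to ∼ each change of a letter in A is nothing or ρ i₀, and ρ i₀ applied twice is nothing.
    -- Hence x is joined to y or ρ i₀ x is, and the class rules out the latter.
    connected : ∀ {x y} → x ≈[ S ] x₀ → x ≈[ A ] y → class c x ≡ class c y → x ∼ y
    connected {x} {y} x≈ x≈y e = [ proj₁ , (λ (_ , q) → ⊥-elim (Bool.not-¬ refl (trans e q))) ]′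
      (proj₂ (≈-invariant A (λ z → z ≈[ S ] x₀ × Reached x z)
        (λ z l a ml (z≈ , r) → ≈-update l a (component-⊆ l ml) z≈ , reach ml z≈ r (∼-or-ρ ml z a))
        x y x≈y (x≈ , inj₁ (done , refl))))

-- From complete cuts at one point to a decomposition

abstract
  ⊕-≢ˡ : ∀ c d → d ≢ 0F → c ≢ c ⊕ d
  ⊕-≢ˡ = toWitness {a? = all? λ c → all? λ d → ¬? (d ≟ 0F) →-dec ¬? (c ≟ c ⊕ d)} tt

  ⊕-≢ʳ : ∀ c d → c ≢ 0F → d ≢ c ⊕ d
  ⊕-≢ʳ = toWitness {a? = all? λ c → all? λ d → ¬? (c ≟ 0F) →-dec ¬? (d ≟ c ⊕ d)} tt

  outside-0F : ∀ c → outside c 0F ≡ false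
  outside-0F = toWitness {a? = all? λ c → outside c 0F Bool.≟ false} tt

  outside-same : ∀ c → outside c c ≡ false
  outside-same = toWitness {a? = all? λ c → outside c c Bool.≟ false} tt

false≢true : false ≢ true
false≢true ()

∈-≢ : ∀ {n} {A : Region n} {i j} → A i ≡ true → A j ≡ false → i ≢ j
∈-≢ p q refl = false≢true (trans (sym q) p)

module LocalGlobal {n : ℕ} (Q : Quasigroup n) (S : Region n) (x₀ : Vec Symbol n) where
  open Active Q S x₀ public

  two-colours : ∀ {i j k} → i ≢ j → i ≢ k → j ≢ k → ∀ x {c d} → χ j k x ≡ c → χ i j x ≡ d → d ≢ c →
    χ i k x ≡ c ⊎ χ i k x ≡ d
  two-colours {i} {j} {k} i≢j i≢k j≢k x {c} {d} p q d≢c with χ i k x ≟ c | χ i k x ≟ d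
  ... | yes r | _     = inj₁ r
  ... | no  _ | yes r = inj₂ r
  ... | no r  | no r′ = ⊥-elim (no-rainbow i≢j i≢k j≢k x
    ((λ e → r′ (trans (sym e) q)) , (λ e → d≢c (trans (sym q) (trans e p))) , (λ e → r (trans e p))))

  -- Moving s by c turns the edge rp to the third colour and preserves kr and kp, which makes a rainbow triangle.
  no-alternating-path : ∀ {k r s p} → k ≢ r → k ≢ s → k ≢ p → r ≢ s → r ≢ p → s ≢ p → ∀ x {c d} →
    c ≢ 0F → d ≢ 0F → d ≢ c → χ k r x ≡ d → χ r s x ≡ d → χ s p x ≡ d → χ k s x ≡ c → χ r p x ≡ c → χ k p x ≡ c → ⊥
  no-alternating-path {k} {r} {s} {p} k≢r k≢s k≢p r≢s r≢p s≢p x {c} {d} c≢0 d≢0 d≢c kr rs sp ks rp kp =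
    no-rainbow k≢r k≢p r≢p (move s c x)
      ( (λ e → d≢c (trans (sym kr′) (trans e kp′)))
      , (λ e → ⊕-≢ʳ c d c≢0 (trans (sym kr′) (trans e rp′)))
      , (λ e → ⊕-≢ˡ c d d≢0 (trans (sym kp′) (trans e rp′))))
    where
    rp′ : χ r p (move s c x) ≡ c ⊕ d
    rp′ = colour-flips r≢p r≢s (s≢p ∘ sym) x rp c≢0 rs (trans (χ-sym (s≢p ∘ sym) x) sp) d≢0 d≢c
    kp′ : χ k p (move s c x) ≡ c
    kp′ = colour-stays k≢p k≢s (s≢p ∘ sym) x kp c≢0 (inj₂ ks)
    kr′ : χ k r (move s c x) ≡ d
    kr′ = trans (χ-sym k≢r _) (colour-survives (k≢r ∘ sym) r≢s k≢s x (trans (χ-sym (k≢r ∘ sym) x) kr) rs d≢0 ks c≢0 (d≢c ∘ sym))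

  record Cut (c : Symbol) (x : Word) (J side : Region n) : Set where
    field
      c≢0   : c ≢ 0F
      based : x ≈[ S ] x₀
      J⊆S   : ∀ {i} → J i ≡ true → S i ≡ true
      cross : ∀ {s t} → J s ≡ true → J t ≡ true → side s ≢ side t → χ s t x ≡ c
      left  : ∃[ p ] J p ≡ true × side p ≡ true
      right : ∃[ q ] J q ≡ true × side q ≡ false

  Uncut : Region n → Set
  Uncut J = ∀ c x side → ¬ Cut c x J side

  module _ {c : Symbol} {x : Word} {J side : Region n} (cut : Cut c x J side) {i : Fin n} (i∈S : S i ≡ true) (i∉J : J i ≡ false) (maximal : Uncut (insert i J)) where
    open Cut cut
    private
      i≢ : ∀ {j} → J j ≡ true → i ≢ j
      i≢ p = ∈-≢ {A = J} p i∉J ∘ sym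

      distinct : ∀ {s t} → side s ≢ side t → s ≢ t
      distinct p refl = p refl

      J′⊆S : ∀ {j} → insert i J j ≡ true → S j ≡ true
      J′⊆S {j} p with insert-true {i = i} {J} j p
      ... | inj₁ refl = i∈S
      ... | inj₂ q    = J⊆S q

      opposite : ∀ {s t} → J s ≡ true → J t ≡ true → side s ≢ side t → χ i s x ≢ c → χ i t x ≡ c ⊎ χ i t x ≡ χ i s x
      opposite s∈J t∈J s≢t d≢c = two-colours (i≢ s∈J) (i≢ t∈J) (distinct s≢t) x (cross s∈J t∈J s≢t) refl d≢c

      module _ {s : Fin n} (s∈J : J s ≡ true) where
        joined : Region n
        joined j = if does (j ≟ i) then side s else side j

        joined-i : joined i ≡ side s
        joined-i = cong (if_then side s else side i) (dec-true (i ≟ i) refl)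

        joined-J : ∀ {j} → J j ≡ true → joined j ≡ side j
        joined-J {j} p = cong (if_then side s else side j) (dec-false (j ≟ i) (i≢ p ∘ sym))

        join : (∀ t → J t ≡ true → side t ≢ side s → χ i t x ≡ c) → Cut c x (insert i J) joined
        join p = record
          { c≢0 = c≢0 ; based = based ; J⊆S = J′⊆S
          ; cross = λ {a} {b} a∈ b∈ a≢b → cross′ (insert-true {i = i} {J} a a∈) (insert-true {i = i} {J} b b∈) a≢b
          ; left  = let l , l∈ , e = left in l , insert-⊆ i J l l∈ , trans (joined-J l∈) e
          ; right = let l , l∈ , e = right in l , insert-⊆ i J l l∈ , trans (joined-J l∈) e }
          where
          cross′ : ∀ {a b} → a ≡ i ⊎ J a ≡ true → b ≡ i ⊎ J b ≡ true → joined a ≢ joined b → χ a b x ≡ c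
          cross′ (inj₁ refl) (inj₁ refl) a≢b = ⊥-elim (a≢b refl)
          cross′ (inj₁ refl) (inj₂ b∈)   a≢b = p _ b∈ λ e → a≢b (trans joined-i (trans (sym e) (sym (joined-J b∈))))
          cross′ (inj₂ a∈)   (inj₁ refl) a≢b = trans (χ-sym (i≢ a∈ ∘ sym) x)
            (p _ a∈ λ e → a≢b (trans (joined-J a∈) (trans e (sym joined-i))))
          cross′ (inj₂ a∈)   (inj₂ b∈)   a≢b = cross a∈ b∈ λ e → a≢b (trans (joined-J a∈) (trans e (sym (joined-J b∈))))

      isolate : ∀ {d s} → d ≢ 0F → J s ≡ true → (∀ j → J j ≡ true → χ i j x ≡ d) → Cut d x (insert i J) (λ j → does (j ≟ i))
      isolate {d} {s} d≢0 s∈J p = record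
        { c≢0 = d≢0 ; based = based ; J⊆S = J′⊆S
        ; cross = λ {a} {b} a∈ b∈ a≢b → cross′ (insert-true {i = i} {J} a a∈) (insert-true {i = i} {J} b b∈) a≢b
        ; left  = i , insert-self i J , dec-true (i ≟ i) refl
        ; right = s , insert-⊆ i J s s∈J , dec-false (s ≟ i) (i≢ s∈J ∘ sym) }
        where
        cross′ : ∀ {a b} → a ≡ i ⊎ J a ≡ true → b ≡ i ⊎ J b ≡ true → does (a ≟ i) ≢ does (b ≟ i) → χ a b x ≡ d
        cross′ (inj₁ refl) (inj₁ refl) a≢b = ⊥-elim (a≢b refl)
        cross′ (inj₁ refl) (inj₂ b∈)   a≢b = p _ b∈
        cross′ (inj₂ a∈)   (inj₁ refl) a≢b = trans (χ-sym (i≢ a∈ ∘ sym) x) (p _ a∈)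
        cross′ {a} {b} (inj₂ a∈) (inj₂ b∈) a≢b =
          ⊥-elim (a≢b (trans (dec-false (a ≟ i) (i≢ a∈ ∘ sym)) (sym (dec-false (b ≟ i) (i≢ b∈ ∘ sym)))))

      -- Otherwise the c-neighbours of i on the side of s form one side of a larger cut.
      module _ {d : Symbol} (d≢0 : d ≢ 0F) (d≢c : d ≢ c) (two : ∀ j → J j ≡ true → χ i j x ≡ c ⊎ χ i j x ≡ d)
               {s t : Fin n} (s∈J : J s ≡ true) (is : χ i s x ≡ c) (t∈J : J t ≡ true) (it : χ i t x ≡ d) (s≢t : side s ≢ side t) where

        Near : Fin n → Set
        Near j = J j ≡ true × side j ≡ side s × χ i j x ≡ c

        near? : ∀ j → Dec (Near j)
        near? j = (J j Bool.≟ true) ×-dec (side j Bool.≟ side s) ×-dec (χ i j x ≟ c)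

        near-far : ∀ {a b} → Near a → b ≡ i ⊎ J b ≡ true → ¬ Near b → χ a b x ≡ c
        near-far (a∈ , _ , ia) (inj₁ refl) _ = trans (χ-sym (i≢ a∈ ∘ sym) x) ia
        near-far {a} {b} (a∈ , as , ia) (inj₂ b∈) ¬b with side b Bool.≟ side s
        ... | no  bs = cross a∈ b∈ λ e → bs (trans (sym e) as)
        ... | yes bs with two b b∈
        ...   | inj₁ ib = ⊥-elim (¬b (b∈ , bs , ib))
        -- If ab had colour d, then a, b, i, t would be a path of colour d whose complement has
        -- colour c.
        ...   | inj₂ ib = [ (λ ab → ⊥-elim (no-alternating-path a≢b a≢i (distinct a≢t) b≢i (distinct b≢t) (i≢ t∈J) x
                    c≢0 d≢0 d≢c ab (trans (χ-sym b≢i x) ib) it ai (cross b∈ t∈J b≢t) (cross a∈ t∈J a≢t))) , (λ q → q) ]′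
                  (two-colours a≢i a≢b (b≢i ∘ sym) x ib ai (d≢c ∘ sym))
          where
          a≢i = i≢ a∈ ∘ sym
          b≢i = i≢ b∈ ∘ sym
          ai : χ a i x ≡ c
          ai = trans (χ-sym a≢i x) ia
          a≢b : a ≢ b
          a≢b refl = d≢c (trans (sym ib) ia)
          a≢t : side a ≢ side t
          a≢t e = s≢t (trans (sym as) e)
          b≢t : side b ≢ side t
          b≢t e = s≢t (trans (sym bs) e)

        separate : Cut c x (insert i J) (λ j → does (near? j))
        separate = record
          { c≢0 = c≢0 ; based = based ; J⊆S = J′⊆S
          ; cross = λ {a} {b} a∈ b∈ → cross′ a b (insert-true {i = i} {J} a a∈) (insert-true {i = i} {J} b b∈)
          ; left  = s , insert-⊆ i J s s∈J , dec-true (near? s) (s∈J , refl , is)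
          ; right = t , insert-⊆ i J t t∈J , dec-false (near? t) (λ (_ , e , _) → s≢t (sym e)) }
          where
          cross′ : ∀ a b → a ≡ i ⊎ J a ≡ true → b ≡ i ⊎ J b ≡ true → does (near? a) ≢ does (near? b) → χ a b x ≡ c
          cross′ a b a∈ b∈ = by (near? a) (near? b)
            where
            by : (p : Dec (Near a)) (q : Dec (Near b)) → does p ≢ does q → χ a b x ≡ c
            by (yes p) (yes q) a≢b = ⊥-elim (a≢b refl)
            by (no  p) (no  q) a≢b = ⊥-elim (a≢b refl)
            by (yes p) (no  q) _   = near-far p b∈ q
            by (no  p) (yes q) _   = trans (χ-sym (λ { refl → p q }) x) (near-far q a∈ p)

    -- Let is have a colour d outside {0 , c}. If c joins i to everything opposite to s, then i can
    -- enter the side of s. Otherwise only c and d occur between i and J; if c does not occur, {i}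
    -- is a side of a cut of colour d, and if it does, the c-neighbours of i on one side are. In
    -- each case J with i has a cut.
    outside-cut : ∀ {s} → J s ≡ true → outside c (χ i s x) ≡ false
    outside-cut {s} s∈J = by-cases (outside c (χ i s x)) (λ p → ⊥-elim (impossible (outside-true c _ p))) id
      where
      d = χ i s x
      impossible : d ≢ 0F × d ≢ c → ⊥
      impossible (d≢0 , d≢c) with any? (λ t → (J t Bool.≟ true) ×-dec ¬? (side t Bool.≟ side s) ×-dec (χ i t x ≟ d))
      ... | no none = maximal _ _ _ (join s∈J λ t t∈J t≢s →
              [ id , (λ q → ⊥-elim (none (t , t∈J , t≢s , q))) ]′ (opposite s∈J t∈J (t≢s ∘ sym) d≢c))
      ... | yes (t , t∈J , t≢s , it) = impossible′ (any? (λ j → (J j Bool.≟ true) ×-dec (χ i j x ≟ c)))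
        where
        two : ∀ j → J j ≡ true → χ i j x ≡ c ⊎ χ i j x ≡ d
        two j j∈J with side j Bool.≟ side s
        ... | no j≢s  = opposite s∈J j∈J (j≢s ∘ sym) d≢c
        ... | yes j≡s = [ inj₁ , (λ q → inj₂ (trans q it)) ]′
                (opposite t∈J j∈J (λ e → t≢s (trans e j≡s)) (λ e → d≢c (trans (sym it) e)))
        impossible′ : Dec (∃[ j ] J j ≡ true × χ i j x ≡ c) → ⊥
        impossible′ (no none) = maximal _ _ _ (isolate d≢0 s∈J λ j j∈J →
          [ (λ q → ⊥-elim (none (j , j∈J , q))) , id ]′ (two j j∈J))
        impossible′ (yes (j , j∈J , ij)) with side j Bool.≟ side s
        ... | yes j≡s = maximal _ _ _ (separate d≢0 d≢c two j∈J ij t∈J it (λ e → t≢s (trans (sym e) j≡s)))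
        ... | no  j≢s = maximal _ _ _ (separate d≢0 d≢c two j∈J ij s∈J refl j≢s)

  Maximal : Region n → Set
  Maximal J = ∀ {i} → S i ≡ true → J i ≡ false → Uncut (insert i J)

  -- A cut on a maximal J survives every change preserving f modulo {0 , c}. If the edges of colour c connected S,
  -- such changes would reach a whole level set, so that no edge could cross the cut after all.
  module _ {c : Symbol} {J side : Region n} (maximal : Maximal J) where

    -- If l lies in J, it is opposite to one end of each cross edge and joined to it by c; if not,
    -- `outside-cut` joins it to both ends by 0 or c. Either way `colour-stays` applies to the cross
    -- edges that avoid l.
    cut-move : ∀ {x l} → Cut c x J side → S l ≡ true → Cut c (move l c x) J side
    cut-move {x} {l} cut l∈S = record
      { c≢0 = c≢0 ; based = ≈-update l _ l∈S based ; J⊆S = J⊆S ; left = left ; right = right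
      ; cross = λ {s} {t} s∈J t∈J s≢t → moved s∈J t∈J s≢t (λ { refl → s≢t refl }) (s ≟ l) (t ≟ l) }
      where
      open Cut cut
      beside : ∀ {s} → J s ≡ true → l ≢ s → J l ≡ false → χ s l x ≡ 0F ⊎ χ s l x ≡ c
      beside s∈J l≢s l∉J = outside-false c _ (trans (cong (outside c) (χ-sym (l≢s ∘ sym) x))
        (outside-cut cut l∈S l∉J (maximal l∈S l∉J) s∈J))
      moved : ∀ {s t} → J s ≡ true → J t ≡ true → side s ≢ side t → s ≢ t → Dec (s ≡ l) → Dec (t ≡ l) → χ s t (move l c x) ≡ c
      moved s∈J t∈J s≢t n (yes refl) _ = trans (χ-updateˡ n x _) (cross s∈J t∈J s≢t)
      moved s∈J t∈J s≢t n (no _) (yes refl) = trans (χ-updateʳ n x _) (cross s∈J t∈J s≢t)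
      moved {s} {t} s∈J t∈J s≢t n (no s≢l) (no t≢l) with J l in l∈J? | side l Bool.≟ side s
      ... | false | _      = colour-stays n s≢l t≢l x (cross s∈J t∈J s≢t) c≢0 (beside s∈J (s≢l ∘ sym) l∈J?)
      ... | true  | no l≢s = colour-stays n s≢l t≢l x (cross s∈J t∈J s≢t) c≢0 (inj₂ (cross s∈J l∈J? (l≢s ∘ sym)))
      ... | true  | yes e  = trans (χ-sym n _) (colour-stays (n ∘ sym) t≢l s≢l x (trans (χ-sym (n ∘ sym) x) (cross s∈J t∈J s≢t)) c≢0
        (inj₂ (cross t∈J l∈J? (λ e′ → s≢t (trans (sym e) (sym e′))))))

    cut-update : ∀ {x} → Cut c x J side → ∀ l a → S l ≡ true → class c (x [ l ]≔ a) ≡ class c x → Cut c (x [ l ]≔ a) J side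
    cut-update {x} cut l a l∈S e = subst (λ v → Cut c (x [ l ]≔ v) J side) (sym (value-surjective l x a))
      (go (outside-false c δ (trans (class-⊕ (Cut.c≢0 cut) x _) (trans (cong (class c x xor_) e) (Bool.xor-same (class c x))))))
      where
      δ = f x ⊕ f (x [ l ]≔ a)
      go : δ ≡ 0F ⊎ δ ≡ c → Cut c (move l δ x) J side
      go (inj₁ p) = subst (λ δ → Cut c (move l δ x) J side) (sym p) (subst (λ y → Cut c y J side) (sym (move-0 l x)) cut)
      go (inj₂ p) = subst (λ δ → Cut c (move l δ x) J side) (sym p) (cut-move cut l∈S)

    module _ (c≢0 : c ≢ 0F) where
      open Joined c≢0 S

      cut-∼ : ∀ {x y} → Cut c x J side → x ∼ y → Cut c y J side
      cut-∼ cut done             = cut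
      cut-∼ cut (step l a m e p) = cut-∼ (cut-update cut l a m e) p

      module _ {x : Word} {i₀ : Fin n} (cut : Cut c x J side) (S∋i₀ : S i₀ ≡ true) (isC : IsComponent c i₀ S) where

        cut-everywhere : ∀ y → y ≈[ S ] x₀ → class c y ≡ class c x → Cut c y J side
        cut-everywhere y y≈ e = cut-∼ cut (connected c≢0 S∋i₀ isC (Cut.based cut) (≈-trans (Cut.based cut) (≈-sym y≈)) (sym e))

        part : Fin n → Maybe Bool
        part j = if J j then just (side j) else nothing

        part-in : ∀ {j} → J j ≡ true → part j ≡ just (side j)
        part-in {j} p = cong (if_then just (side j) else nothing) p

        part-out : ∀ {j} → J j ≡ false → part j ≡ nothing
        part-out {j} p = cong (if_then just (side j) else nothing) p

        -- The cut makes f modulo {0 , c} linear between different parts, where the coordinates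
        -- outside J count as a third part. As the edges connect S, all of S is one part, although
        -- both sides of the cut are inhabited.
        across : ∀ {i j} → Edge c i j → part i ≡ part j
        across {i} {j} (i∈S , j∈S , i≢j , y , y≈ , e) with Maybe-≡-dec Bool._≟_ (part i) (part j)
        ... | yes p = p
        ... | no  p = ⊥-elim (false≢true (trans (sym (separated (cut-everywhere y′ y′≈ class≡))) (trans (cong (outside c) (χ-updateˡ i≢j y v)) e)))
          where
          d = proj₁ (∃outside c c≢0)
          -- The witness of the edge may lie in the wrong class; changing its letter at i corrects
          -- this and leaves the colour of ij alone.
          adjust : ∃[ v ] class c (y [ i ]≔ v) ≡ class c x
          adjust with class c y Bool.≟ class c x
          ... | yes q = lookup y i , trans (cong (class c) ([]≔-lookup y i)) q
          ... | no  q = value i d y , trans (class-move c≢0 i d y) (trans (cong (class c y xor_) (proj₂ (∃outside c c≢0)))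
                  (trans (xor-not _) (sym (Bool.¬-not (q ∘ sym)))))
          v = proj₁ adjust
          y′ = y [ i ]≔ v
          y′≈ : y′ ≈[ S ] x₀
          y′≈ = ≈-update i v i∈S y≈
          class≡ = proj₂ adjust
          separated : Cut c y′ J side → outside c (χ i j y′) ≡ false
          separated cut′ = go _ _ refl refl
            where
            go : ∀ a b → J i ≡ a → J j ≡ b → outside c (χ i j y′) ≡ false
            go true  true  i∈J j∈J = trans (cong (outside c) (Cut.cross cut′ i∈J j∈J
              λ e → p (trans (part-in i∈J) (trans (cong just e) (sym (part-in j∈J)))))) (outside-same c)
            go true  false i∈J j∉J = trans (cong (outside c) (χ-sym i≢j y′)) (outside-cut cut′ j∈S j∉J (maximal j∈S j∉J) i∈J)
            go false true  i∉J j∈J = outside-cut cut′ i∈S i∉J (maximal i∈S i∉J) j∈J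
            go false false i∉J j∉J = ⊥-elim (p (trans (part-out i∉J) (sym (part-out j∉J))))

        same-part : ∀ j → S j ≡ true → part j ≡ part i₀
        same-part = Component.IsComponent.generated isC (λ j → part j ≡ part i₀) refl (λ _ p e → trans (sym (across e)) p)

        no-cut : ⊥
        no-cut = let p , p∈ , pt = Cut.left cut ; q , q∈ , qf = Cut.right cut in
          false≢true (trans (sym qf) (trans (just-injective (trans (sym (part-in q∈)) (trans (same-part q (Cut.J⊆S cut q∈))
            (trans (sym (same-part p (Cut.J⊆S cut p∈))) (part-in p∈))))) pt))

  module _ {i₀ : Fin n} (S∋i₀ : S i₀ ≡ true) (full : ∀ c → c ≢ 0F → IsComponent c i₀ S) where

    -- Downward induction on |J|: if all sets with one more coordinate are uncut, then J is maximal
    -- and `no-cut` applies. No largest cut has to be selected.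
    uncut : ∀ m J → n ≤ m + count J → Uncut J
    uncut m J bound c x side cut = no-cut (λ {i} _ i∉J → larger m bound i i∉J) (Cut.c≢0 cut) cut S∋i₀ (full c (Cut.c≢0 cut))
      where
      larger : ∀ m → n ≤ m + count J → ∀ i → J i ≡ false → Uncut (insert i J)
      larger zero bound i i∉J =
        ⊥-elim (ℕ.<-irrefl refl (ℕ.≤-trans (s≤s bound) (subst (_≤ n) (count-insert i J i∉J) (count≤n (insert i J)))))
      larger (suc m) bound i i∉J = uncut m (insert i J)
        (subst (n ≤_) (trans (sym (ℕ.+-suc m (count J))) (cong (m +_) (sym (count-insert i J i∉J)))) bound)

    -- At the witness of an edge the colour of ij is nonzero, so the pair {i , j} by itself carries
    -- a cut of that colour.
    no-edges : ∀ {c i j} → ¬ Edge c i j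
    no-edges {c} {i} {j} (i∈S , j∈S , i≢j , x , x≈ , e) = uncut n J (ℕ.m≤m+n n _) (χ i j x) x (λ k → does (k ≟ i)) record
      { c≢0 = proj₁ (outside-true c _ e) ; based = x≈
      ; J⊆S = λ {k} k∈ → [ (λ { refl → i∈S }) , (λ { refl → j∈S }) ]′ (split k k∈)
      ; cross = λ {s} {t} s∈ t∈ s≢t → cross (split s s∈) (split t t∈) s≢t
      ; left  = i , insert-self i (insert j λ _ → false) , dec-true (i ≟ i) refl
      ; right = j , insert-⊆ i (insert j λ _ → false) j (insert-self j λ _ → false) , dec-false (j ≟ i) (i≢j ∘ sym) }
      where
      J = insert i (insert j λ _ → false)
      split : ∀ k → J k ≡ true → k ≡ i ⊎ k ≡ j
      split k p = [ inj₁ , (λ q → [ inj₂ , (λ ()) ]′ (insert-true {i = j} {λ _ → false} k q)) ]′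
        (insert-true {i = i} {insert j λ _ → false} k p)
      cross : ∀ {s t} → s ≡ i ⊎ s ≡ j → t ≡ i ⊎ t ≡ j → does (s ≟ i) ≢ does (t ≟ i) → χ s t x ≡ χ i j x
      cross (inj₁ refl) (inj₁ refl) p = ⊥-elim (p refl)
      cross (inj₁ refl) (inj₂ refl) p = refl
      cross (inj₂ refl) (inj₁ refl) p = χ-sym (i≢j ∘ sym) x
      cross (inj₂ refl) (inj₂ refl) p = ⊥-elim (p refl)

    singleton : ∀ j → S j ≡ true → j ≡ i₀
    singleton = Component.IsComponent.generated (full 1F λ ()) (λ j → j ≡ i₀) refl (λ _ _ e → ⊥-elim (no-edges e))

  Splits : Fin n → Symbol → Set₁
  Splits i₀ c = c ≢ 0F × Σ[ A ∈ Region n ] IsComponent c i₀ A × ∃[ j ] S j ≡ true × A j ≡ false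

  component-cong : ∀ {c i₀ A B} → (∀ j → A j ≡ B j) → IsComponent c i₀ A → IsComponent c i₀ B
  component-cong {B = B} A≡B isC = record
    { contains = trans (sym (A≡B _)) contains
    ; closed = λ i∈ e → trans (sym (A≡B _)) (closed (trans (A≡B _) i∈) e)
    ; generated = λ C c₀ step j j∈ → generated C c₀ (λ i∈ → step (trans (sym (A≡B _)) i∈)) j (trans (A≡B j) j∈) }
    where open Component.IsComponent isC

  whole-or-split : ∀ {i₀} → S i₀ ≡ true → ∀ c → c ≢ 0F → IsComponent c i₀ S ⊎ Splits i₀ c
  whole-or-split {i₀} S∋i₀ c c≢0 with Comp.component c i₀
  ... | A , isC with any? (λ j → (S j Bool.≟ true) ×-dec (A j Bool.≟ false))
  ...   | yes (j , j∈S , j∉A) = inj₂ (c≢0 , A , isC , j , j∈S , j∉A)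
  ...   | no none = inj₁ (component-cong same isC)
    where
    same : ∀ j → A j ≡ S j
    same j with A j in a | S j in s
    ... | true  | true  = refl
    ... | false | false = refl
    ... | false | true  = ⊥-elim (none (j , s , a))
    ... | true  | false = ⊥-elim (false≢true (trans (sym s) (component-⊆ c≢0 S∋i₀ isC j a)))

  -- If S were connected for each of the three nonzero c, there would be no edges, and a connected
  -- set without edges is a single point.
  splits : ∀ {i₀ j₀} → S i₀ ≡ true → S j₀ ≡ true → j₀ ≢ i₀ → ∃ (Splits i₀)
  splits {i₀} {j₀} S∋i₀ S∋j₀ j₀≢i₀ with whole-or-split S∋i₀ 1F (λ ()) | whole-or-split S∋i₀ 2F (λ ()) | whole-or-split S∋i₀ 3F (λ ())
  ... | inj₂ s | _      | _      = 1F , s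
  ... | inj₁ _ | inj₂ s | _      = 2F , s
  ... | inj₁ _ | inj₁ _ | inj₂ s = 3F , s
  ... | inj₁ p | inj₁ q | inj₁ r = ⊥-elim (j₀≢i₀ (singleton S∋i₀ full j₀ S∋j₀))
    where
    full : ∀ c → c ≢ 0F → IsComponent c i₀ S
    full 0F c≢0 = ⊥-elim (c≢0 refl)
    full 1F _   = p
    full 2F _   = q
    full 3F _   = r

-- Families of symmetries

vec-ext : ∀ {n} {x y : Vec Symbol n} → (∀ i → lookup x i ≡ lookup y i) → x ≡ y
vec-ext {x = x} {y} p = trans (sym (tabulate∘lookup x)) (trans (tabulate-cong p) (tabulate∘lookup y))

patch : ∀ {n} → Region n → Vec Symbol n → Vec Symbol n → Vec Symbol n
patch A x y = tabulate λ i → if A i then lookup x i else lookup y i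

module _ {n : ℕ} (A : Region n) (x y : Vec Symbol n) where

  patch-in : ∀ {i} → A i ≡ true → lookup (patch A x y) i ≡ lookup x i
  patch-in {i} p = trans (lookup∘tabulate _ i) (cong (if_then lookup x i else lookup y i) p)

  patch-out : ∀ {i} → A i ≡ false → lookup (patch A x y) i ≡ lookup y i
  patch-out {i} p = trans (lookup∘tabulate _ i) (cong (if_then lookup x i else lookup y i) p)

patch-unique : ∀ {n} (A : Region n) x y {z} → (∀ i → A i ≡ true → lookup z i ≡ lookup x i) → (∀ i → A i ≡ false → lookup z i ≡ lookup y i) →
  patch A x y ≡ z
patch-unique A x y p q = vec-ext λ i → by-cases (A i)
  (λ i∈ → trans (patch-in A x y i∈) (sym (p i i∈))) (λ i∉ → trans (patch-out A x y i∉) (sym (q i i∉)))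

Transform : ℕ → Set
Transform n = Fin n → Permutation′ 4

apply : ∀ {n} → Transform n → Vec Symbol n → Vec Symbol n
apply θ x = tabulate λ i → θ i ⟨$⟩ʳ lookup x i

infixr 9 _·_

_·_ : ∀ {n} → Transform n → Transform n → Transform n
(θ · φ) i = φ i ∘ₚ θ i

infix 4 _≐_

_≐_ : ∀ {n} → Transform n → Transform n → Set
θ ≐ φ = ∀ i a → θ i ⟨$⟩ʳ a ≡ φ i ⟨$⟩ʳ a

apply-· : ∀ {n} (θ φ : Transform n) x → apply (θ · φ) x ≡ apply θ (apply φ x)
apply-· θ φ x = tabulate-cong λ i → cong (θ i ⟨$⟩ʳ_) (sym (lookup∘tabulate _ i))

apply-cong : ∀ {n} {θ φ : Transform n} → θ ≐ φ → ∀ x → apply θ x ≡ apply φ x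
apply-cong p x = tabulate-cong λ i → p i (lookup x i)

perm-injective : ∀ (π : Permutation′ 4) {a b} → π ⟨$⟩ʳ a ≡ π ⟨$⟩ʳ b → a ≡ b
perm-injective π p = trans (sym (inverseˡ π)) (trans (cong (π ⟨$⟩ˡ_) p) (inverseˡ π))

Supported : ∀ {n} → Transform n → Region n → Set
Supported θ A = ∀ i → A i ≡ false → ∀ a → θ i ⟨$⟩ʳ a ≡ a

apply-off : ∀ {n} (θ : Transform n) (A : Region n) → Supported θ A → ∀ x → apply θ x ≈[ A ] x
apply-off θ A s x = agreeing λ i i∉ → trans (lookup∘tabulate _ i) (s i i∉ _)

infixr 6 _∪_

_∪_ : ∀ {n} → Region n → Region n → Region n
(A ∪ B) i = A i ∨ B i

Separated : ∀ {n} → Region n → Region n → Set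
Separated A B = ∀ i → A i ≡ true → B i ≡ false

∪-left : ∀ {n} (A B : Region n) i → (A ∪ B) i ≡ false → A i ≡ false
∪-left A B i p = go (A i) p
  where
  go : ∀ a {b} → a ∨ b ≡ false → a ≡ false
  go false _ = refl

∪-right : ∀ {n} (A B : Region n) i → (A ∪ B) i ≡ false → B i ≡ false
∪-right A B i p = go (A i) p
  where
  go : ∀ a {b} → a ∨ b ≡ false → b ≡ false
  go false q = q

·-supported : ∀ {n} {θ φ : Transform n} {A B} → Supported θ A → Supported φ B → Supported (θ · φ) (A ∪ B)
·-supported {θ = θ} {A = A} {B} s t i i∉ a = trans (cong (θ i ⟨$⟩ʳ_) (t i (∪-right A B i i∉) a)) (s i (∪-left A B i i∉) a)

·-separateˡ : ∀ {n} {θ φ θ′ φ′ : Transform n} {A B} → Separated A B →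
  Supported θ A → Supported φ B → Supported θ′ A → Supported φ′ B → θ · φ ≐ θ′ · φ′ → θ ≐ θ′
·-separateˡ {θ = θ} {φ} {θ′} {φ′} {A} sep s t s′ t′ p i a = by-cases (A i)
  (λ i∈ → trans (cong (θ i ⟨$⟩ʳ_) (sym (t i (sep i i∈) a))) (trans (p i a) (cong (θ′ i ⟨$⟩ʳ_) (t′ i (sep i i∈) a))))
  (λ i∉ → trans (s i i∉ a) (sym (s′ i i∉ a)))

·-separateʳ : ∀ {n} {θ φ θ′ φ′ : Transform n} {A B} → Separated A B →
  Supported θ A → Supported φ B → Supported θ′ A → Supported φ′ B → θ · φ ≐ θ′ · φ′ → φ ≐ φ′
·-separateʳ {θ = θ} {φ} {θ′} {φ′} {A} sep s t s′ t′ p i a = by-cases (A i)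
  (λ i∈ → trans (t i (sep i i∈) a) (sym (t′ i (sep i i∈) a)))
  (λ i∉ → trans (sym (s i i∉ _)) (trans (p i a) (s′ i i∉ _)))

module Rigidity {n : ℕ} (Q : Quasigroup n) (S : Region n) (x₀ : Vec Symbol n) {c : Symbol} (c≢0 : c ≢ 0F)
  {i₀ : Fin n} (S∋i₀ : S i₀ ≡ true) {A : Region n} (isC : LocalGlobal.IsComponent Q S x₀ c i₀ A) where
  open LocalGlobal Q S x₀
  open Joined c≢0 A

  private
    A⊆S : ∀ {i} → A i ≡ true → S i ≡ true
    A⊆S = component-⊆ c≢0 S∋i₀ isC _

    -- The two words differ only at coordinates of S outside A; changing these one at a time,
    -- `class-parallel-≡` applies because no edge leaves A.
    class-patch : ∀ {i a z w} → A i ≡ true → z ≈[ S ] x₀ → w ≈[ S ] x₀ → class c (z [ i ]≔ a) ≡ class c z →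
      class c (patch A z w [ i ]≔ a) ≡ class c (patch A z w)
    class-patch {i} {a} {z} {w} i∈A z≈ w≈ e = proj₂ (≈-invariant (λ l → not (A l) ∧ S l)
      (λ y → y ≈[ S ] x₀ × class c (y [ i ]≔ a) ≡ class c y) update z (patch A z w)
      (agreeing λ l l∉ → by-cases (A l) (λ l∈A → sym (patch-in A z w l∈A))
        (λ l∉A → let l∉S = subst (λ b → not b ∧ S l ≡ false) l∉A l∉ in
          trans (agree z≈ l l∉S) (sym (trans (patch-out A z w l∉A) (agree w≈ l l∉S)))))
      (z≈ , e))
      where
      update : ∀ y l b → not (A l) ∧ S l ≡ true → y ≈[ S ] x₀ × class c (y [ i ]≔ a) ≡ class c y →
        y [ l ]≔ b ≈[ S ] x₀ × class c (y [ l ]≔ b [ i ]≔ a) ≡ class c (y [ l ]≔ b)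
      update y l b l∈ (y≈ , e) = ≈-update l b l∈S y≈ , trans (cong (class c) ([]≔-commutes y l i (i≢l ∘ sym)))
        (class-parallel-≡ c≢0 S∋i₀ isC i≢l y (closed-linear c≢0 S∋i₀ isC i∈A l∉A l∈S y≈) a b e)
        where
        split : ∀ p q → not p ∧ q ≡ true → p ≡ false × q ≡ true
        split false true _ = refl , refl
        l∉A = proj₁ (split (A l) (S l) l∈)
        l∈S = proj₂ (split (A l) (S l) l∈)
        i≢l : i ≢ l
        i≢l = ∈-≢ {A = A} i∈A l∉A

    difference : ∀ {i a} z → class c (z [ i ]≔ a) ≡ class c z → lookup z i ≢ a → f z ⊕ f (z [ i ]≔ a) ≡ c
    difference {i} {a} z e ne = [ (λ p → ⊥-elim (ne (f-injective i z (trans (cong f ([]≔-lookup z i)) (⊕-zero _ _ p))))) , id ]′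
      (outside-false c _ (trans (class-⊕ c≢0 z _) (trans (cong (class c z xor_) e) (Bool.xor-same (class c z)))))
      where
      ⊕-zero : ∀ a b → a ⊕ b ≡ 0F → a ≡ b
      ⊕-zero a b p = ⊕-injectiveˡ a (trans (⊕-self a) (sym p))

    patch-update : ∀ {i} → A i ≡ true → ∀ z w a → patch A (z [ i ]≔ a) w ≡ patch A z w [ i ]≔ a
    patch-update {i} i∈A z w a = patch-unique A (z [ i ]≔ a) w
      (λ j j∈ → case j ≟ i of λ where
        (yes refl) → trans (lookup∘update j (patch A z w) a) (sym (lookup∘update j z a))
        (no j≢i)   → trans (lookup∘update′ j≢i (patch A z w) a) (trans (patch-in A z w j∈) (sym (lookup∘update′ j≢i z a))))
      (λ j j∉ → trans (lookup∘update′ (∈-≢ {A = A} i∈A j∉ ∘ sym) (patch A z w) a) (patch-out A z w j∉))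

    -- Both sides change by c in every step that moves the point.
    along : ∀ {z z′ w} → z ≈[ S ] x₀ → w ≈[ S ] x₀ → z ∼ z′ → f (patch A z w) ⊕ f (patch A z′ w) ≡ f z ⊕ f z′
    along {z} {w = w} z≈ w≈ done = trans (⊕-self (f (patch A z w))) (sym (⊕-self (f z)))
    along {z} {z′} {w} z≈ w≈ (step i a i∈A e p) = begin
      f p₀ ⊕ f p₂                   ≡⟨ insert-middle (f p₀) (f p₁) (f p₂) ⟨
      (f p₀ ⊕ f p₁) ⊕ (f p₁ ⊕ f p₂) ≡⟨ cong₂ _⊕_ first (along (≈-update i a (A⊆S i∈A) z≈) w≈ p) ⟩
      (f z ⊕ f z₁) ⊕ (f z₁ ⊕ f z′)  ≡⟨ insert-middle (f z) (f z₁) (f z′) ⟩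
      f z ⊕ f z′                    ∎
      where
      open ≡-Reasoning
      z₁ = z [ i ]≔ a
      p₀ = patch A z w
      p₁ = patch A z₁ w
      p₂ = patch A z′ w
      insert-middle : ∀ a b c → (a ⊕ b) ⊕ (b ⊕ c) ≡ a ⊕ c
      insert-middle a b c = trans (⊕-assoc a b (b ⊕ c)) (cong (a ⊕_) (⊕-cancelˡ b c))
      first : f p₀ ⊕ f p₁ ≡ f z ⊕ f z₁
      first with lookup z i ≟ a
      ... | yes refl = trans (cong (λ y → f p₀ ⊕ f (patch A y w)) ([]≔-lookup z i))
              (trans (⊕-self (f p₀)) (sym (trans (cong (λ y → f z ⊕ f y) ([]≔-lookup z i)) (⊕-self (f z)))))
      ... | no ne = trans (cong (λ y → f p₀ ⊕ f y) (patch-update i∈A z w a))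
              (trans (difference p₀ (class-patch i∈A z≈ w≈ e) (λ q → ne (trans (sym (patch-in A z w i∈A)) q)))
              (sym (difference z e ne)))

  -- Connectedness supplies a path inside A from z to z′, and `along` walks it over two different
  -- fillings of the remaining letters. The increments of f agree, since c is the only nonzero
  -- increment possible on either walk.
  rigid : ∀ {z z′ w} → z ≈[ S ] x₀ → z ≈[ A ] z′ → outside c (f z ⊕ f z′) ≡ false → w ≈[ S ] x₀ →
    f (patch A z w) ⊕ f (patch A z′ w) ≡ f z ⊕ f z′
  rigid {z} {z′} z≈ z≈z′ e w≈ = along z≈ w≈ (connected c≢0 S∋i₀ isC z≈ z≈z′ (xor-false _ _ (trans (sym (class-⊕ c≢0 z z′)) e)))

  -- Hence the letters in A enter f only through the value that f takes while the other letters are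
  -- frozen. This is the semilinear form g (h₁ , ... , hₘ) without naming g.
  rigid-≡ : ∀ {z z′ w} → z ≈[ S ] x₀ → z ≈[ A ] z′ → f z ≡ f z′ → w ≈[ S ] x₀ → f (patch A z w) ≡ f (patch A z′ w)
  rigid-≡ {z} {z′} {w} z≈ z≈z′ e w≈ = ⊕-injectiveˡ (f (patch A z w)) (trans (⊕-self (f (patch A z w)))
    (sym (trans (rigid z≈ z≈z′ (trans (cong (outside c) p) (outside-0F c)) w≈) p)))
    where
    p : f z ⊕ f z′ ≡ 0F
    p = trans (cong (f z ⊕_) (sym e)) (⊕-self (f z))

  -- A symmetry found while all letters outside A are frozen at x₀ works for all other fillings too.
  -- For δ outside {0 , c} the compared points would lie in different level sets and `rigid` would
  -- say nothing.
  rigid-shift : ∀ {θ δ} → Supported θ A → outside c δ ≡ false → (∀ x → x ≈[ A ] x₀ → f (apply θ x) ≡ f x ⊕ δ) →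
    ∀ x → x ≈[ S ] x₀ → f (apply θ x) ≡ f x ⊕ δ
  rigid-shift {θ} {δ} sup e inv x x≈ = begin
    f (apply θ x)                ≡⟨ ⊕-cancelˡ (f x) _ ⟨
    f x ⊕ (f x ⊕ f (apply θ x))  ≡⟨ cong (f x ⊕_) shift ⟩
    f x ⊕ δ                      ∎
    where
    open ≡-Reasoning
    y = patch A x x₀
    yA : y ≈[ A ] x₀
    yA = agreeing λ i i∉ → patch-out A x x₀ i∉
    y≈ : y ≈[ S ] x₀
    y≈ = agreeing λ i i∉ → by-cases (A i) (λ i∈ → ⊥-elim (false≢true (trans (sym i∉) (A⊆S i∈)))) (λ i∉A → agree yA i i∉A)
    p₁ : patch A y x ≡ x
    p₁ = patch-unique A y x (λ i i∈ → sym (patch-in A x x₀ i∈)) (λ _ _ → refl)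
    p₂ : patch A (apply θ y) x ≡ apply θ x
    p₂ = patch-unique A (apply θ y) x (λ i i∈ → trans (lookup∘tabulate _ i) (trans (cong (θ i ⟨$⟩ʳ_) (sym (patch-in A x x₀ i∈)))
      (sym (lookup∘tabulate _ i)))) (λ i i∉ → agree (apply-off θ A sup x) i i∉)
    d : f y ⊕ f (apply θ y) ≡ δ
    d = trans (cong (f y ⊕_) (inv y yA)) (⊕-cancelˡ (f y) δ)
    shift : f x ⊕ f (apply θ x) ≡ δ
    shift = trans (cong₂ (λ a b → f a ⊕ f b) (sym p₁) (sym p₂))
      (trans (rigid y≈ (≈-sym (apply-off θ A sup y)) (trans (cong (outside c) d) e) x≈) d)

module Families {n : ℕ} (Q : Quasigroup n) where
  open Levels Q

  record Family (S : Region n) (x₀ : Word) (U : Region n) (N : ℕ) : Set where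
    field
      at        : Fin N → Transform n
      supported : ∀ p → Supported (at p) U
      invariant : ∀ p x → x ≈[ S ] x₀ → f (apply (at p) x) ≡ f x
      injective : ∀ {p q} → at p ≐ at q → p ≡ q

  record Shift (S : Region n) (x₀ : Word) (U : Region n) (δ : Symbol) : Set where
    field
      transform : Transform n
      supported : Supported transform U
      shift     : ∀ x → x ≈[ S ] x₀ → f (apply transform x) ≡ f x ⊕ δ

  apply-≈ : ∀ {S U : Region n} {x x₀} θ → (∀ i → U i ≡ true → S i ≡ true) → Supported θ U → x ≈[ S ] x₀ → apply θ x ≈[ S ] x₀
  apply-≈ {S} {U} {x} θ U⊆S s x≈ = agreeing λ i i∉ → by-cases (U i) (λ i∈ → ⊥-elim (false≢true (trans (sym i∉) (U⊆S i i∈))))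
    (λ i∉U → trans (agree (apply-off θ U s x) i i∉U) (agree x≈ i i∉))

  module _ {S : Region n} {x₀ : Word} where

    trivial : ∀ U → Family S x₀ U 1
    trivial U = record
      { at = λ _ _ → idₚ ; supported = λ _ _ _ _ → refl ; invariant = λ _ x _ → cong f (tabulate∘lookup x)
      ; injective = λ { {0F} {0F} _ → refl } }

    shift-0 : ∀ U → Shift S x₀ U 0F
    shift-0 U = record { transform = λ _ → idₚ ; supported = λ _ _ _ → refl
                       ; shift = λ x _ → trans (cong f (tabulate∘lookup x)) (sym (⊕-identityʳ _)) }

    shift-⊆ : ∀ {U V δ} → (∀ i → V i ≡ false → U i ≡ false) → Shift S x₀ U δ → Shift S x₀ V δ
    shift-⊆ sub σ = record { transform = Shift.transform σ ; shift = Shift.shift σ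
                           ; supported = λ i i∉ → Shift.supported σ i (sub i i∉) }

    family-≗ : ∀ {U V N} → (∀ i → U i ≡ V i) → Family S x₀ U N → Family S x₀ V N
    family-≗ eq F = record { at = at ; invariant = invariant ; injective = injective
                           ; supported = λ p i i∉ → supported p i (trans (eq i) i∉) }
      where open Family F

    module _ {V : Region n} (V⊆S : ∀ i → V i ≡ true → S i ≡ true) where

      shift-· : ∀ {U δ ε} → Shift S x₀ U δ → Shift S x₀ V ε → Shift S x₀ (U ∪ V) (ε ⊕ δ)
      shift-· {U} {δ} {ε} σ τ = record
        { transform = σ.transform · τ.transform
        ; supported = ·-supported {θ = σ.transform} {τ.transform} {U} {V} σ.supported τ.supported
        ; shift = λ x x≈ → trans (cong f (apply-· σ.transform τ.transform x))
            (trans (σ.shift _ (apply-≈ {U = V} τ.transform V⊆S τ.supported x≈)) (trans (cong (_⊕ δ) (τ.shift x x≈)) (⊕-assoc (f x) ε δ))) }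
        where
        module σ = Shift σ
        module τ = Shift τ

      module _ {U : Region n} (sep : Separated U V) {N M : ℕ} (F : Family S x₀ U N) (G : Family S x₀ V M) where
        private
          module F = Family F
          module G = Family G

        product : Family S x₀ (U ∪ V) (N * M)
        product = record
          { at = λ r → F.at (proj₁ (remQuot {N} M r)) · G.at (proj₂ (remQuot {N} M r))
          ; supported = λ r → let p , q = remQuot {N} M r in ·-supported {θ = F.at p} {G.at q} {U} {V} (F.supported p) (G.supported q)
          ; invariant = λ r x x≈ → let p , q = remQuot {N} M r in trans (cong f (apply-· (F.at p) (G.at q) x))
              (trans (F.invariant p _ (apply-≈ {U = V} (G.at q) V⊆S (G.supported q) x≈)) (G.invariant q x x≈))
          ; injective = λ {r} {s} e → inj r s e }
          where
          inj : ∀ r s → F.at (proj₁ (remQuot {N} M r)) · G.at (proj₂ (remQuot {N} M r)) ≐ F.at (proj₁ (remQuot {N} M s)) · G.at (proj₂ (remQuot {N} M s)) → r ≡ s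
          inj r s e = trans (sym (combine-remQuot {N} M r)) (trans (cong₂ combine
            (F.injective (·-separateˡ {θ = F.at p} {G.at q} {F.at p′} {G.at q′} {U} {V} sep
              (F.supported p) (G.supported q) (F.supported p′) (G.supported q′) e))
            (G.injective (·-separateʳ {θ = F.at p} {G.at q} {F.at p′} {G.at q′} {U} {V} sep
              (F.supported p) (G.supported q) (F.supported p′) (G.supported q′) e)))
            (combine-remQuot {N} M s))
            where
            p  = proj₁ (remQuot {N} M r)
            q  = proj₂ (remQuot {N} M r)
            p′ = proj₁ (remQuot {N} M s)
            q′ = proj₂ (remQuot {N} M s)

    twist : Fin 2 → Transform n → Transform n → Transform n
    twist 0F σ θ = θ
    twist 1F σ θ = σ · θ

    twist-supported : ∀ b {σ θ U} → Supported σ U → Supported θ U → Supported (twist b σ θ) U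
    twist-supported 0F s t = t
    twist-supported 1F {σ} s t i i∉ a = trans (cong (σ i ⟨$⟩ʳ_) (t i i∉ a)) (s i i∉ a)

    shift-of : Symbol → Fin 2 → Symbol
    shift-of c 0F = 0F
    shift-of c 1F = c

    shift-of-cancel : ∀ c b a → (a ⊕ shift-of c b) ⊕ shift-of c b ≡ a
    shift-of-cancel c b a = trans (⊕-assoc a _ _) (trans (cong (a ⊕_) (⊕-self (shift-of c b))) (⊕-identityʳ a))

    module _ {c : Symbol} {U : Region n} (U⊆S : ∀ i → U i ≡ true → S i ≡ true) (σ : Shift S x₀ U c) {N : ℕ} (F : Family S x₀ U N) where
      private
        module σ = Shift σ
        module F = Family F

      twisted : Fin 2 → Fin N → Transform n
      twisted b p = twist b σ.transform (F.at p)

      twisted-supported : ∀ b p → Supported (twisted b p) U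
      twisted-supported b p = twist-supported b {σ.transform} {F.at p} σ.supported (F.supported p)

      twisted-shift : ∀ b p x → x ≈[ S ] x₀ → f (apply (twisted b p) x) ≡ f x ⊕ shift-of c b
      twisted-shift 0F p x x≈ = trans (F.invariant p x x≈) (sym (⊕-identityʳ _))
      twisted-shift 1F p x x≈ = trans (cong f (apply-· σ.transform (F.at p) x))
        (trans (σ.shift _ (apply-≈ {U = U} (F.at p) U⊆S (F.supported p) x≈)) (cong (_⊕ c) (F.invariant p x x≈)))

      twisted-injective : c ≢ 0F → ∀ b b′ p p′ → twisted b p ≐ twisted b′ p′ → b ≡ b′ × p ≡ p′
      -- The value at x₀ reveals whether c has been added.
      twisted-injective c≢0 b b′ p p′ e = go b b′ e (⊕-injectiveˡ (f x₀) (trans (sym (twisted-shift b p x₀ ≈-refl))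
        (trans (cong f (apply-cong {θ = twisted b p} {twisted b′ p′} e x₀)) (twisted-shift b′ p′ x₀ ≈-refl))))
        where
        go : ∀ b b′ → twisted b p ≐ twisted b′ p′ → shift-of c b ≡ shift-of c b′ → b ≡ b′ × p ≡ p′
        go 0F 0F e _ = refl , F.injective e
        go 1F 1F e _ = refl , F.injective λ i a → perm-injective (σ.transform i) (e i a)
        go 0F 1F e q = ⊥-elim (c≢0 (sym q))
        go 1F 0F e q = ⊥-elim (c≢0 q)

    -- The extra factor two is the simultaneous shift by c on both parts, which leaves f unchanged.
    module _ {c : Symbol} (c≢0 : c ≢ 0F) {U V : Region n}
      (U⊆S : ∀ i → U i ≡ true → S i ≡ true) (V⊆S : ∀ i → V i ≡ true → S i ≡ true) (sep : Separated U V)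
      (σ : Shift S x₀ U c) (τ : Shift S x₀ V c) {N M : ℕ} (F : Family S x₀ U N) (G : Family S x₀ V M) where

      linked : Family S x₀ (U ∪ V) (2 * (N * M))
      linked = record
        { at = λ r → element (coordinates r)
        ; supported = λ r → let b , p , q = coordinates r in
            ·-supported {θ = twisted U⊆S σ F b p} {twisted V⊆S τ G b q} {U} {V} (twisted-supported U⊆S σ F b p) (twisted-supported V⊆S τ G b q)
        ; invariant = λ r x x≈ → let b , p , q = coordinates r in
            trans (cong f (apply-· (twisted U⊆S σ F b p) (twisted V⊆S τ G b q) x))
              (trans (twisted-shift U⊆S σ F b p _ (apply-≈ {U = V} (twisted V⊆S τ G b q) V⊆S (twisted-supported V⊆S τ G b q) x≈))
              (trans (cong (_⊕ shift-of c b) (twisted-shift V⊆S τ G b q x x≈)) (shift-of-cancel c b (f x))))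
        ; injective = λ {r} {s} e → inj r s (coordinates r) (coordinates s) refl refl e }
        where
        coordinates : Fin (2 * (N * M)) → Fin 2 × Fin N × Fin M
        coordinates r = let b , pq = remQuot {2} (N * M) r in b , remQuot {N} M pq
        element : Fin 2 × Fin N × Fin M → Transform n
        element (b , p , q) = twisted U⊆S σ F b p · twisted V⊆S τ G b q
        rebuild : Fin 2 × Fin N × Fin M → Fin (2 * (N * M))
        rebuild (b , p , q) = combine b (combine p q)
        rebuild-coordinates : ∀ r → rebuild (coordinates r) ≡ r
        rebuild-coordinates r = trans (cong (combine (proj₁ (remQuot {2} (N * M) r))) (combine-remQuot {N} M (proj₂ (remQuot {2} (N * M) r))))
          (combine-remQuot {2} (N * M) r)
        inj : ∀ r s t u → coordinates r ≡ t → coordinates s ≡ u → element t ≐ element u → r ≡ s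
        inj r s (b , p , q) (b′ , p′ , q′) er es e = trans (sym (rebuild-coordinates r)) (trans (cong rebuild
          (trans er (trans (cong₂ _,_ (proj₁ left) (cong₂ _,_ (proj₂ left) (proj₂ right))) (sym es)))) (rebuild-coordinates s))
          where
          left : b ≡ b′ × p ≡ p′
          left = twisted-injective U⊆S σ F c≢0 b b′ p p′ (·-separateˡ {θ = twisted U⊆S σ F b p} {twisted V⊆S τ G b q}
            {twisted U⊆S σ F b′ p′} {twisted V⊆S τ G b′ q′} {U} {V} sep (twisted-supported U⊆S σ F b p)
            (twisted-supported V⊆S τ G b q) (twisted-supported U⊆S σ F b′ p′) (twisted-supported V⊆S τ G b′ q′) e)
          right : b ≡ b′ × q ≡ q′
          right = twisted-injective V⊆S τ G c≢0 b b′ q q′ (·-separateʳ {θ = twisted U⊆S σ F b p} {twisted V⊆S τ G b q}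
            {twisted U⊆S σ F b′ p′} {twisted V⊆S τ G b′ q′} {U} {V} sep (twisted-supported U⊆S σ F b p)
            (twisted-supported V⊆S τ G b q) (twisted-supported U⊆S σ F b′ p′) (twisted-supported V⊆S τ G b′ q′) e)

  -- A symmetry whose action on the values need not be a translation. The cube of `root` serves as
  -- its inverse, and `moves` separates it from the symmetries that fix all values.
  record Motion (S : Region n) (x₀ : Word) : Set where
    field
      transform : Transform n
      supported : Supported transform S
      root      : Symbol → Symbol
      order-4   : ∀ a → root (root (root (root a))) ≡ a
      moves     : ∃[ a ] root a ≢ a
      effect    : ∀ x → x ≈[ S ] x₀ → f (apply transform x) ≡ root (f x)

  -- With s = |S|, each case yields at least 2 ^ (⌊ s /2⌋ + 2) symmetries.
  data Rich (S : Region n) (x₀ : Word) : Set where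
    all-shifts : ∀ k → Family S x₀ S (2 ^ k) → count S ≤ k + k ⊎ count S ≡ 1 → (∀ δ → Shift S x₀ S δ) → Rich S x₀
    one-shift  : ∀ k → Family S x₀ S (2 ^ k) → suc (count S) ≤ k + k → ∀ δ → δ ≢ 0F → Shift S x₀ S δ → Rich S x₀
    no-shift   : ∀ k → Family S x₀ S (2 ^ k) → 3 + count S ≤ k + k → Rich S x₀
    motion     : ∀ k → Family S x₀ S (2 ^ k) → 2 + count S ≤ k + k → Motion S x₀ → Rich S x₀

  module _ (S : Region n) (x₀ : Word) (c : Symbol) where

    -- A shift by c will later double the family, hence the allowance of one in the first case.
    data Progress (U : Region n) (v : ℕ) : Set where
      flagged : ∀ k → Family S x₀ U (2 ^ k) → Shift S x₀ U c → v ≤ suc k → Progress U v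
      plain   : ∀ k → Family S x₀ U (2 ^ k) → v ≤ k → Progress U v

    module _ (c≢0 : c ≢ 0F) {U V : Region n} (U⊆S : ∀ i → U i ≡ true → S i ≡ true) (V⊆S : ∀ i → V i ≡ true → S i ≡ true)
             (sep : Separated U V) where

      product-^ : ∀ k l → Family S x₀ U (2 ^ k) → Family S x₀ V (2 ^ l) → Family S x₀ (U ∪ V) (2 ^ (k + l))
      product-^ k l F G = subst (Family S x₀ (U ∪ V)) (sym (ℕ.^-distribˡ-+-* 2 k l)) (product V⊆S sep F G)

      linked-^ : ∀ k l → Shift S x₀ U c → Shift S x₀ V c → Family S x₀ U (2 ^ k) → Family S x₀ V (2 ^ l) →
        Family S x₀ (U ∪ V) (2 ^ suc (k + l))
      linked-^ k l σ τ F G = subst (λ N → Family S x₀ (U ∪ V) (2 * N)) (sym (ℕ.^-distribˡ-+-* 2 k l))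
        (linked c≢0 U⊆S V⊆S sep σ τ F G)

      -- Two flagged parts would need an allowance of one each; linking their shifts by c gains a
      -- factor two and pays for one of them.
      merge : ∀ {v w} → Progress U v → Progress V w → Progress (U ∪ V) (v + w)
      merge (plain k F v≤) (plain l G w≤) = plain (k + l) (product-^ k l F G) (ℕ.+-mono-≤ v≤ w≤)
      merge (plain k F v≤) (flagged l G τ w≤) = flagged (k + l) (product-^ k l F G) (shift-⊆ (∪-right U V) τ)
        (ℕ.≤-trans (ℕ.+-mono-≤ v≤ w≤) (ℕ.≤-reflexive (ℕ.+-suc k l)))
      merge (flagged k F σ v≤) (plain l G w≤) = flagged (k + l) (product-^ k l F G) (shift-⊆ (∪-left U V) σ) (ℕ.+-mono-≤ v≤ w≤)
      merge (flagged k F σ v≤) (flagged l G τ w≤) = flagged (suc (k + l)) (linked-^ k l σ τ F G) (shift-⊆ (∪-left U V) σ)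
        (ℕ.≤-trans (ℕ.+-mono-≤ v≤ w≤) (ℕ.≤-reflexive (cong suc (ℕ.+-suc k l))))

-- Counting coordinates and halving

+-interchange : ∀ a b c d → (a + b) + (c + d) ≡ (a + c) + (b + d)
+-interchange = solve-∀

count-mono : ∀ {n} {A B : Region n} → (∀ i → A i ≡ true → B i ≡ true) → count A ≤ count B
count-mono {zero}  p = z≤n
count-mono {suc n} {A} {B} p = ℕ.+-mono-≤ (go (A zero) (B zero) (p zero)) (count-mono (p ∘ suc))
  where
  go : ∀ a b → (a ≡ true → b ≡ true) → (if a then 1 else 0) ≤ (if b then 1 else 0)
  go false b     q = z≤n
  go true  true  q = ℕ.≤-refl
  go true  false q = ⊥-elim (false≢true (q refl))

count-< : ∀ {n} {A B : Region n} {j} → (∀ i → A i ≡ true → B i ≡ true) → B j ≡ true → A j ≡ false → count A < count B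
count-< {A = A} {B} {j} p j∈B j∉A = subst (_≤ count B) (count-insert j A j∉A)
  (count-mono λ i i∈ → [ (λ { refl → j∈B }) , p i ]′ (insert-true {i = j} {A} i i∈))

count-∪ : ∀ {n} (A B : Region n) → Separated A B → count (A ∪ B) ≡ count A + count B
count-∪ {zero}  A B sep = refl
count-∪ {suc n} A B sep = trans (cong₂ _+_ (go (A zero) (B zero) (sep zero)) (count-∪ (A ∘ suc) (B ∘ suc) (sep ∘ suc)))
  (+-interchange (if A zero then 1 else 0) (if B zero then 1 else 0) _ _)
  where
  go : ∀ a b → (a ≡ true → b ≡ false) → (if a ∨ b then 1 else 0) ≡ (if a then 1 else 0) + (if b then 1 else 0)
  go true  true  q = ⊥-elim (false≢true (sym (q refl)))
  go true  false q = refl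
  go false b     q = refl

count-∅ : ∀ {n} (A : Region n) → (∀ i → A i ≡ false) → count A ≡ 0
count-∅ {zero}  A p = refl
count-∅ {suc n} A p = cong₂ (λ b m → (if b then 1 else 0) + m) (p zero) (count-∅ (A ∘ suc) (p ∘ suc))

count-singleton : ∀ {n} {A : Region n} {i} → A i ≡ true → (∀ j → A j ≡ true → j ≡ i) → count A ≡ 1
count-singleton {n} {A} {i} i∈ only = trans (count-cong same) (trans (count-insert i (λ _ → false) refl)
  (cong suc (count-∅ {n} (λ _ → false) λ _ → refl)))
  where
  same : ∀ j → A j ≡ insert i (λ _ → false) j
  same j with j ≟ i
  ... | yes refl = i∈
  ... | no j≢i   = by-cases (A j) (λ j∈ → ⊥-elim (j≢i (only j j∈))) (λ j∉ → j∉)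

singleton-unique : ∀ {n} {A : Region n} {i} → count A ≡ 1 → A i ≡ true → ∀ j → A j ≡ true → j ≡ i
singleton-unique {A = A} {i} c1 i∈ j j∈ with j ≟ i
... | yes p = p
... | no j≢i = ⊥-elim (ℕ.<-irrefl refl (subst₂ _<_ (count-singleton {A = insert i λ _ → false} (insert-self i λ _ → false) only) c1
        (count-< {A = insert i λ _ → false} {A} {j} (λ k k∈ → [ (λ { refl → i∈ }) , (λ ()) ]′ (insert-true {i = i} {λ _ → false} k k∈)) j∈
          (cong (_∨ false) (dec-false (j ≟ i) j≢i)))))
  where
  only : ∀ k → insert i (λ _ → false) k ≡ true → k ≡ i
  only k k∈ = [ id , (λ ()) ]′ (insert-true {i = i} {λ _ → false} k k∈)

parity : ∀ s → s ≡ ⌊ s /2⌋ + ⌊ s /2⌋ ⊎ s ≡ suc (⌊ s /2⌋ + ⌊ s /2⌋)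
parity 0 = inj₁ refl
parity 1 = inj₂ refl
parity (suc (suc s)) = [ (λ p → inj₁ (cong suc (trans (cong suc p) (sym (ℕ.+-suc _ _))))) ,
  (λ p → inj₂ (cong suc (cong suc (trans p (sym (ℕ.+-suc _ _)))))) ]′ (parity s)

half-≤ : ∀ {s k} → s ≤ k + k → ⌊ s /2⌋ ≤ k
half-≤ {s} {k} p = subst (⌊ s /2⌋ ≤_) (sym (ℕ.n≡⌊n+n/2⌋ k)) (ℕ.⌊n/2⌋-mono p)

half-< : ∀ {s k} → s < k + k → ⌊ s /2⌋ < k
half-< {s} {k} p = subst (⌊ suc (suc s) /2⌋ ≤_) (sym (ℕ.n≡⌈n+n/2⌉ k)) (ℕ.⌊n/2⌋-mono (s≤s p))

odd-< : ∀ {h k} → suc (h + h) ≤ k + k → suc (suc (h + h)) ≤ k + k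
odd-< {h} {k} p = subst (_≤ k + k) (cong suc (ℕ.+-suc h h)) (ℕ.+-mono-≤ h<k h<k)
  where
  h<k : h < k
  h<k = subst (λ m → suc m ≤ k) (sym (ℕ.n≡⌊n+n/2⌋ h)) (half-< p)

weight : ∀ s → suc s ≤ suc ⌊ s /2⌋ + suc ⌊ s /2⌋
weight s = [ (λ p → subst (λ t → suc t ≤ suc h + suc h) (sym p) (s≤s (ℕ.+-monoʳ-≤ h (ℕ.n≤1+n h)))) ,
  (λ p → subst (λ t → suc t ≤ suc h + suc h) (sym p) (s≤s (ℕ.≤-reflexive (sym (ℕ.+-suc h h))))) ]′ (parity s)
  where h = ⌊ s /2⌋

even-weight : ∀ s → s ≡ ⌊ s /2⌋ + ⌊ s /2⌋ → 2 + s ≤ suc ⌊ s /2⌋ + suc ⌊ s /2⌋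
even-weight s p = ℕ.≤-reflexive (trans (cong (2 +_) p) (cong suc (sym (ℕ.+-suc _ _))))

abstract
  -- The reaction of one argument of a square that turns a shift of the other argument into a shift of the value.
  fix : Symbol → Symbol → Symbol → Symbol
  fix ψ δ a = a ⊕ (if outside ψ δ ∧ outside ψ a then ψ else 0F)

  fix-involutive : ∀ ψ δ a → fix ψ δ (fix ψ δ a) ≡ a
  fix-involutive = toWitness {a? = all? λ ψ → all? λ δ → all? λ a → fix ψ δ (fix ψ δ a) ≟ a} tt

  square-fix : ∀ ψ δ a b → square ψ (fix ψ δ a) (b ⊕ δ) ≡ square ψ a b ⊕ δ
  square-fix = toWitness {a? = all? λ ψ → all? λ δ → all? λ a → all? λ b → square ψ (fix ψ δ a) (b ⊕ δ) ≟ square ψ a b ⊕ δ} tt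

  square-0F : ∀ δ a b → square 0F (a ⊕ δ) b ≡ square 0F a b ⊕ δ
  square-0F = toWitness {a? = all? λ δ → all? λ a → all? λ b → square 0F (a ⊕ δ) b ≟ square 0F a b ⊕ δ} tt

  -- In the ℤ₄ with involution ψ, adding δ outside {0 , ψ} by ⊕ is the reflection a ↦ δ - a. Two
  -- such reflections of the arguments reflect the sum, z ↦ (δ + ε) - z, and this formula writes
  -- that map with ⊕.
  reflect : Symbol → Symbol → Symbol → Symbol → Symbol
  reflect ψ δ ε z = z ⊕ δ ⊕ ε ⊕ (if outside ψ z then 0F else ψ)

  square-reflect : ∀ ψ δ ε → ψ ≢ 0F → outside ψ δ ≡ true → outside ψ ε ≡ true → ∀ a b →
    square ψ (a ⊕ δ) (b ⊕ ε) ≡ reflect ψ δ ε (square ψ a b)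
  square-reflect = toWitness {a? = all? λ ψ → all? λ δ → all? λ ε → ¬? (ψ ≟ 0F) →-dec (outside ψ δ Bool.≟ true) →-dec
    (outside ψ ε Bool.≟ true) →-dec all? λ a → all? λ b → square ψ (a ⊕ δ) (b ⊕ ε) ≟ reflect ψ δ ε (square ψ a b)} tt

  reflect-moves : ∀ ψ δ ε → ψ ≢ 0F → ∃[ z ] reflect ψ δ ε z ≢ z
  reflect-moves = toWitness {a? = all? λ ψ → all? λ δ → all? λ ε → ¬? (ψ ≟ 0F) →-dec any? λ z → ¬? (reflect ψ δ ε z ≟ z)} tt

  -- For arbitrary parameters the map may be a 4-cycle, for instance when ψ ≠ 0 and δ ⊕ ε lies
  -- outside {0 , ψ}; the fourth power is trivial in all cases.
  reflect-order-4 : ∀ ψ δ ε z → let r = reflect ψ δ ε in r (r (r (r z))) ≡ z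
  reflect-order-4 = toWitness {a? = all? λ ψ → all? λ δ → all? λ ε → all? λ z → let r = reflect ψ δ ε in r (r (r (r z))) ≟ z} tt

  ⊕-generated : ∀ c δ → c ≢ 0F → δ ≢ 0F → δ ≢ c → ∀ ε → ε ≡ 0F ⊎ ε ≡ c ⊎ ε ≡ δ ⊎ ε ≡ δ ⊕ c
  ⊕-generated = toWitness {a? = all? λ c → all? λ δ → ¬? (c ≟ 0F) →-dec ¬? (δ ≟ 0F) →-dec ¬? (δ ≟ c) →-dec
    all? λ ε → (ε ≟ 0F) ⊎-dec ((ε ≟ c) ⊎-dec ((ε ≟ δ) ⊎-dec (ε ≟ δ ⊕ c)))} tt

  outside-intro : ∀ c a → a ≢ 0F → a ≢ c → outside c a ≡ true
  outside-intro = toWitness {a? = all? λ c → all? λ a → ¬? (a ≟ 0F) →-dec ¬? (a ≟ c) →-dec (outside c a Bool.≟ true)} tt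

module Leaf {n : ℕ} (Q : Quasigroup n) (x₀ : Vec Symbol n) (i : Fin n) where
  open Levels Q

  height : Symbol → Symbol
  height v = f x₀ ⊕ f (x₀ [ i ]≔ v)

  height-value : ∀ a → height (value i a x₀) ≡ a
  height-value a = trans (cong (f x₀ ⊕_) (f-move i a x₀)) (⊕-cancelˡ (f x₀) a)

  module _ (α : Symbol → Symbol) (involutive : ∀ a → α (α a) ≡ a) where

    -- Along a single coordinate f is a bijection, so a map α of the heights can be conjugated into
    -- a map of the letters. As α is an involution, the result is its own inverse.
    leaf-map : Symbol → Symbol
    leaf-map v = value i (α (height v)) x₀

    leaf-map-involutive : ∀ v → leaf-map (leaf-map v) ≡ v
    leaf-map-involutive v = trans (cong (λ a → value i a x₀) (trans (cong α (height-value _)) (involutive _))) (sym (value-surjective i x₀ v))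

    leaf-perm : Permutation′ 4
    leaf-perm = permutation leaf-map leaf-map leaf-map-involutive leaf-map-involutive

    leaf-transform : Transform n
    leaf-transform j = if does (j ≟ i) then leaf-perm else idₚ

    leaf-at : leaf-transform i ≡ leaf-perm
    leaf-at = cong (if_then leaf-perm else idₚ) (dec-true (i ≟ i) refl)

    leaf-off : ∀ {j} → j ≢ i → leaf-transform j ≡ idₚ
    leaf-off {j} p = cong (if_then leaf-perm else idₚ) (dec-false (j ≟ i) p)

    leaf-supported : ∀ {A : Region n} → A i ≡ true → Supported leaf-transform A
    leaf-supported {A} i∈ j j∉ a = cong (_⟨$⟩ʳ a) (leaf-off (∈-≢ {A = A} i∈ j∉ ∘ sym))

    leaf-effect : ∀ {A : Region n} → (∀ j → A j ≡ true → j ≡ i) → ∀ y → y ≈[ A ] x₀ → f x₀ ⊕ f (apply leaf-transform y) ≡ α (f x₀ ⊕ f y)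
    leaf-effect {A} only y y≈ = begin
      f x₀ ⊕ f (apply leaf-transform y)  ≡⟨ cong (λ z → f x₀ ⊕ f z) moved ⟩
      height (leaf-map (lookup y i))     ≡⟨ height-value _ ⟩
      α (height (lookup y i))            ≡⟨ cong (λ z → α (f x₀ ⊕ f z)) same ⟩
      α (f x₀ ⊕ f y)                     ∎
      where
      open ≡-Reasoning
      off : ∀ j → j ≢ i → lookup y j ≡ lookup x₀ j
      off j p = agree y≈ j (by-cases (A j) (λ j∈ → ⊥-elim (p (only j j∈))) id)
      same : x₀ [ i ]≔ lookup y i ≡ y
      same = vec-ext λ j → case j ≟ i of λ where
        (yes refl) → lookup∘update i x₀ _
        (no p) → trans (lookup∘update′ p x₀ _) (sym (off j p))
      moved : apply leaf-transform y ≡ x₀ [ i ]≔ leaf-map (lookup y i)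
      moved = vec-ext λ j → case j ≟ i of λ where
        (yes refl) → trans (lookup∘tabulate _ i) (trans (cong (_⟨$⟩ʳ lookup y i) leaf-at) (sym (lookup∘update i x₀ _)))
        (no p) → trans (lookup∘tabulate _ j) (trans (cong (_⟨$⟩ʳ lookup y j) (leaf-off p)) (trans (off j p) (sym (lookup∘update′ p x₀ _))))

-- Two components of odd size

module Pair {n : ℕ} (Q : Quasigroup n) (S : Region n) (x₀ : Vec Symbol n) {c : Symbol} (c≢0 : c ≢ 0F)
  {A B : Region n} {i₀ j₀ : Fin n} (S∋i₀ : S i₀ ≡ true) (S∋j₀ : S j₀ ≡ true)
  (isA : LocalGlobal.IsComponent Q S x₀ c i₀ A) (isB : LocalGlobal.IsComponent Q S x₀ c j₀ B)
  (sep : Separated A B) (cover : ∀ i → S i ≡ true → A i ≡ true ⊎ B i ≡ true) where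
  open LocalGlobal Q S x₀
  open Families Q

  private
    module RA = Rigidity Q S x₀ c≢0 S∋i₀ isA
    module RB = Rigidity Q S x₀ c≢0 S∋j₀ isB
    i₀∈A = Component.IsComponent.contains isA
    j₀∈B = Component.IsComponent.contains isB

  A⊆S : ∀ i → A i ≡ true → S i ≡ true
  A⊆S = component-⊆ c≢0 S∋i₀ isA

  B⊆S : ∀ i → B i ≡ true → S i ≡ true
  B⊆S = component-⊆ c≢0 S∋j₀ isB

  S∌ : ∀ {i} → A i ≡ false → B i ≡ false → S i ≡ false
  S∌ {i} i∉A i∉B = by-cases (S i) (λ i∈ → ⊥-elim ([ (λ p → false≢true (trans (sym i∉A) p)) , (λ p → false≢true (trans (sym i∉B) p)) ]′ (cover i i∈))) id

  ∪-S : ∀ i → (A ∪ B) i ≡ S i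
  ∪-S i = by-cases (A i) (λ i∈A → trans (cong (_∨ B i) i∈A) (sym (A⊆S i i∈A)))
    (λ i∉A → trans (cong (_∨ B i) i∉A) (by-cases (B i) (λ i∈B → trans i∈B (sym (B⊆S i i∈B))) (λ i∉B → trans i∉B (sym (S∌ i∉A i∉B)))))

  ψ : Symbol
  ψ = χ i₀ j₀ x₀

  i₀≢j₀ : i₀ ≢ j₀
  i₀≢j₀ = ∈-≢ {A = B} j₀∈B (sep i₀ i₀∈A) ∘ sym

  outside-ψ : outside c ψ ≡ false
  outside-ψ = closed-linear c≢0 S∋i₀ isA i₀∈A
    (by-cases (A j₀) (λ j∈A → ⊥-elim (false≢true (trans (sym (sep j₀ j∈A)) j₀∈B))) id) S∋j₀ ≈-refl

  height : Region n → Word → Symbol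
  height U x = f x₀ ⊕ f (patch U x x₀)

  patch-≈ : ∀ U x → patch U x x₀ ≈[ U ] x₀
  patch-≈ U x = agreeing λ i i∉ → patch-out U x x₀ i∉

  ≈-weaken : ∀ {U : Region n} {x} → (∀ i → U i ≡ true → S i ≡ true) → x ≈[ U ] x₀ → x ≈[ S ] x₀
  ≈-weaken {U} sub x≈ = agreeing λ i i∉ → agree x≈ i (by-cases (U i) (λ i∈ → ⊥-elim (false≢true (trans (sym i∉) (sub i i∈)))) id)

  -- As f is rigid along both A and B, it is a binary quasigroup of its restrictions to A and to B.
  f-pair : ∀ x → x ≈[ S ] x₀ → f x₀ ⊕ f x ≡ square ψ (height A x) (height B x)
  f-pair x x≈ = trans (cong (f x₀ ⊕_) (trans (trans (cong f (sym w₁)) (RA.rigid-≡ (≈-weaken A⊆S (patch-≈ A x)) z≈A p-value x≈))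
      (trans (cong f (sym w₂)) (trans (RB.rigid-≡ (≈-weaken B⊆S (patch-≈ B x)) z≈B q-value p≈) (cong f w₃)))))
    (trans (cong (f x₀ ⊕_) (f-face i₀≢j₀ x₀ a b)) (⊕-cancelˡ (f x₀) _))
    where
    a = height A x
    b = height B x
    p = move i₀ a x₀
    q = move j₀ b x₀
    p≈ : p ≈[ S ] x₀
    p≈ = ≈-update i₀ _ S∋i₀ ≈-refl
    z≈A : patch A x x₀ ≈[ A ] p
    z≈A = ≈-trans (patch-≈ A x) (≈-sym (≈-update i₀ _ i₀∈A ≈-refl))
    z≈B : patch B x x₀ ≈[ B ] q
    z≈B = ≈-trans (patch-≈ B x) (≈-sym (≈-update j₀ _ j₀∈B ≈-refl))
    p-value : f (patch A x x₀) ≡ f p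
    p-value = sym (trans (f-move i₀ a x₀) (⊕-cancelˡ (f x₀) _))
    q-value : f (patch B x x₀) ≡ f q
    q-value = sym (trans (f-move j₀ b x₀) (⊕-cancelˡ (f x₀) _))
    w₁ : patch A (patch A x x₀) x ≡ x
    w₁ = patch-unique A (patch A x x₀) x (λ i i∈ → sym (patch-in A x x₀ i∈)) (λ _ _ → refl)
    w₂ : patch B (patch B x x₀) p ≡ patch A p x
    w₂ = patch-unique B (patch B x x₀) p
      (λ i i∈ → trans (patch-out A p x (by-cases (A i) (λ i∈A → ⊥-elim (false≢true (trans (sym (sep i i∈A)) i∈))) id)) (sym (patch-in B x x₀ i∈)))
      (λ i i∉ → by-cases (A i) (patch-in A p x) (λ i∉A → trans (patch-out A p x i∉A) (trans (agree x≈ i (S∌ i∉A i∉)) (sym (agree p≈ i (S∌ i∉A i∉))))))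
    w₃ : patch B q p ≡ face i₀ j₀ x₀ a b
    w₃ = patch-unique B q p
      (λ i i∈ → case i ≟ j₀ of λ where
        (yes refl) → trans (lookup∘update j₀ p _) (sym (lookup∘update j₀ x₀ _))
        (no i≢j)   → trans (lookup∘update′ i≢j p _) (trans (lookup∘update′ (∈-≢ {A = B} i∈ (sep i₀ i₀∈A)) x₀ _) (sym (lookup∘update′ i≢j x₀ _))))
      (λ i i∉ → lookup∘update′ (∈-≢ {A = B} j₀∈B i∉ ∘ sym) p _)

  record Effect (U : Region n) (θ : Transform n) (α : Symbol → Symbol) : Set where
    constructor effective
    field effect : ∀ y → y ≈[ U ] x₀ → f x₀ ⊕ f (apply θ y) ≡ α (f x₀ ⊕ f y)

  open Effect

  shift-effect : ∀ {U δ} (σ : Shift U x₀ U δ) → Effect U (Shift.transform σ) (_⊕ δ)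
  shift-effect {δ = δ} σ = effective λ y y≈ → trans (cong (f x₀ ⊕_) (Shift.shift σ y y≈)) (sym (⊕-assoc (f x₀) (f y) δ))

  id-effect : ∀ U → Effect U (λ _ → idₚ) id
  id-effect U = effective λ y _ → cong (λ z → f x₀ ⊕ f z) (tabulate∘lookup y)

  module _ {θ φ : Transform n} {α β : Symbol → Symbol} (θ-supp : Supported θ A) (φ-supp : Supported φ B)
           (θ-effect : Effect A θ α) (φ-effect : Effect B φ β) where

    pair-supported : Supported (θ · φ) S
    pair-supported i i∉ = ·-supported {θ = θ} {φ} {A} {B} θ-supp φ-supp i (trans (∪-S i) i∉)

    pair-effect : ∀ (ρ : Symbol → Symbol) → (∀ a b → square ψ (α a) (β b) ≡ ρ (square ψ a b)) → Effect S (θ · φ) ρ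
    pair-effect ρ eq = effective λ x x≈ → begin
      f x₀ ⊕ f (apply (θ · φ) x)                                         ≡⟨ f-pair _ (≈-trans (apply-off (θ · φ) S pair-supported x) x≈) ⟩
      square ψ (height A (apply (θ · φ) x)) (height B (apply (θ · φ) x)) ≡⟨ cong₂ (square ψ) (onA x) (onB x) ⟩
      square ψ (α (height A x)) (β (height B x))                         ≡⟨ eq _ _ ⟩
      ρ (square ψ (height A x) (height B x))                             ≡⟨ cong ρ (f-pair x x≈) ⟨
      ρ (f x₀ ⊕ f x)                                                     ∎
      where
      open ≡-Reasoning
      module _ (x : Word) where
        pA : patch A (apply (θ · φ) x) x₀ ≡ apply θ (patch A x x₀)
        pA = patch-unique A (apply (θ · φ) x) x₀
          (λ i i∈ → trans (lookup∘tabulate _ i) (trans (cong (θ i ⟨$⟩ʳ_) (trans (patch-in A x x₀ i∈) (sym (φ-supp i (sep i i∈) _)))) (sym (lookup∘tabulate _ i))))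
          (λ i i∉ → trans (agree (apply-off θ A θ-supp (patch A x x₀)) i i∉) (patch-out A x x₀ i∉))
        pB : patch B (apply (θ · φ) x) x₀ ≡ apply φ (patch B x x₀)
        pB = patch-unique B (apply (θ · φ) x) x₀
          (λ i i∈ → trans (lookup∘tabulate _ i) (trans (cong (φ i ⟨$⟩ʳ_) (patch-in B x x₀ i∈))
            (trans (sym (θ-supp i (by-cases (A i) (λ i∈A → ⊥-elim (false≢true (trans (sym (sep i i∈A)) i∈))) id) _)) (sym (lookup∘tabulate _ i)))))
          (λ i i∉ → trans (agree (apply-off φ B φ-supp (patch B x x₀)) i i∉) (patch-out B x x₀ i∉))
        onA : height A (apply (θ · φ) x) ≡ α (height A x)
        onA = trans (cong (λ z → f x₀ ⊕ f z) pA) (effect θ-effect _ (patch-≈ A x))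
        onB : height B (apply (θ · φ) x) ≡ β (height B x)
        onB = trans (cong (λ z → f x₀ ⊕ f z) pB) (effect φ-effect _ (patch-≈ B x))

  effect-shift : ∀ {θ δ} → Supported θ S → Effect S θ (_⊕ δ) → Shift S x₀ S δ
  effect-shift {θ} {δ} s e = record
    { transform = θ ; supported = s
    ; shift = λ x x≈ → trans (sym (⊕-cancelˡ (f x₀) _)) (trans (cong (f x₀ ⊕_) (effect e x x≈)) (trans (sym (⊕-assoc (f x₀) _ δ)) (cong (_⊕ δ) (⊕-cancelˡ (f x₀) (f x))))) }

  -- Here δ may lie outside {0 , c}. If the colour ψ is nonzero and δ lies outside {0 , ψ}, then δ
  -- reflects the summand of B in ℤ₄, and the value is reflected alike once the summand of A is
  -- negated. A single coordinate can be negated directly; `fix` does so.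
  leaf-shift : (∀ j → A j ≡ true → j ≡ i₀) → ∀ {δ} → Shift B x₀ B δ → Shift S x₀ S δ
  leaf-shift only {δ} σ = effect-shift (pair-supported sA sB eA eB) (pair-effect sA sB eA eB (_⊕ δ) (square-fix ψ δ))
    where
    open Leaf Q x₀ i₀
    sA = leaf-supported (fix ψ δ) (fix-involutive ψ δ) {A} i₀∈A
    sB = Shift.supported σ
    eA : Effect A (leaf-transform (fix ψ δ) (fix-involutive ψ δ)) (fix ψ δ)
    eA = effective (leaf-effect (fix ψ δ) (fix-involutive ψ δ) {A} only)
    eB = shift-effect σ

  linear-shift : ψ ≡ 0F → ∀ {δ} → Shift A x₀ A δ → Shift S x₀ S δ
  linear-shift ψ≡0 {δ} σ = effect-shift (pair-supported sA sB eA eB) (pair-effect sA sB eA eB (_⊕ δ)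
      λ a b → subst (λ ψ → square ψ (a ⊕ δ) b ≡ square ψ a b ⊕ δ) (sym ψ≡0) (square-0F δ a b))
    where
    sA = Shift.supported σ
    eA = shift-effect σ
    sB : Supported (λ _ → idₚ) B
    sB _ _ _ = refl
    eB = id-effect B

  -- Both shifts are reflections in ℤ₄ with involution ψ, so together they act on the value as
  -- inversion followed by a translation.
  twisted-motion : ψ ≢ 0F → ∀ {δ ε} → outside ψ δ ≡ true → outside ψ ε ≡ true → Shift A x₀ A δ → Shift B x₀ B ε → Motion S x₀
  twisted-motion ψ≢0 {δ} {ε} oδ oε σ τ = record
    { transform = Shift.transform σ · Shift.transform τ
    ; supported = pair-supported sA sB eA eB
    ; root      = root
    ; order-4   = λ a → trans (cong (λ w → f x₀ ⊕ r w) (trans (⊕-cancelˡ (f x₀) _) (cong r (trans (⊕-cancelˡ (f x₀) _) (cong r (⊕-cancelˡ (f x₀) _))))))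
                    (trans (cong (f x₀ ⊕_) (reflect-order-4 ψ δ ε (f x₀ ⊕ a))) (⊕-cancelˡ (f x₀) a))
    ; moves     = let z , z≢ = reflect-moves ψ δ ε ψ≢0 in f x₀ ⊕ z , λ e → z≢ (⊕-injectiveˡ (f x₀)
                    (trans (cong (λ w → f x₀ ⊕ reflect ψ δ ε w) (sym (⊕-cancelˡ (f x₀) z))) e))
    ; effect    = λ x x≈ → trans (sym (⊕-cancelˡ (f x₀) _))
                    (cong (f x₀ ⊕_) (effect (pair-effect sA sB eA eB (reflect ψ δ ε) (square-reflect ψ δ ε ψ≢0 oδ oε)) x x≈)) }
    where
    r = reflect ψ δ ε
    root = λ w → f x₀ ⊕ reflect ψ δ ε (f x₀ ⊕ w)
    sA = Shift.supported σ
    eA = shift-effect σ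
    sB = Shift.supported τ
    eB = shift-effect τ

-- Lifting and combining the symmetries of components

module Lift {n : ℕ} (Q : Quasigroup n) (S : Region n) (x₀ : Vec Symbol n) {c : Symbol} (c≢0 : c ≢ 0F)
  {i₀ : Fin n} (S∋i₀ : S i₀ ≡ true) {A : Region n} (isA : LocalGlobal.IsComponent Q S x₀ c i₀ A) where
  open Levels Q using (f)
  open Families Q
  open Rigidity Q S x₀ c≢0 S∋i₀ isA

  lift-shift : ∀ {δ} → outside c δ ≡ false → Shift A x₀ A δ → Shift S x₀ A δ
  lift-shift e σ = record { transform = transform ; supported = supported ; shift = rigid-shift {transform} supported e shift }
    where open Shift σ

  lift-family : ∀ {N} → Family A x₀ A N → Family S x₀ A N
  lift-family F = record
    { at = at ; supported = supported ; injective = injective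
    ; invariant = λ p x x≈ → trans (rigid-shift {at p} (supported p) (outside-0F c)
        (λ y y≈ → trans (invariant p y y≈) (sym (⊕-identityʳ _))) x x≈) (⊕-identityʳ (f x)) }
    where open Family F

  -- A shift is kept only where all shifts exist, since the one by c is then among them. In the
  -- other cases the family alone has the required exponent, so nothing is lost when its shift or
  -- motion cannot be lifted.
  progress : Rich A x₀ → Progress S x₀ c A (suc ⌊ count A /2⌋)
  progress (all-shifts k F (inj₁ p) σ) = flagged k (lift-family F) (lift-shift (outside-same c) (σ c)) (s≤s (half-≤ p))
  progress (all-shifts k F (inj₂ p) σ) = flagged k (lift-family F) (lift-shift (outside-same c) (σ c))
    (s≤s (subst (λ s → ⌊ s /2⌋ ≤ k) (sym p) z≤n))
  progress (one-shift k F p _ _ _) = plain k (lift-family F) (half-< p)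
  progress (no-shift k F p)        = plain k (lift-family F) (half-< (ℕ.≤-trans (ℕ.m≤n+m _ 2) p))
  progress (motion k F p _)        = plain k (lift-family F) (half-< (ℕ.≤-trans (ℕ.n≤1+n _) p))

module _ {n : ℕ} (Q : Quasigroup n) (A : Region n) (x₀ : Vec Symbol n) where
  open Families Q

  data OddRich : Set where
    all-shifts : ∀ k → Family A x₀ A (2 ^ k) → suc (count A) ≤ k + k ⊎ count A ≡ 1 → (∀ δ → Shift A x₀ A δ) → OddRich
    one-shift  : ∀ k → Family A x₀ A (2 ^ k) → suc (count A) ≤ k + k → ∀ δ → δ ≢ 0F → Shift A x₀ A δ → OddRich
    no-shift   : ∀ k → Family A x₀ A (2 ^ k) → 3 + count A ≤ k + k → OddRich

  -- The bounds compare with the even number k + k, so an odd left side can be raised by one. For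
  -- odd |A| this turns the `motion` case into `no-shift`.
  odd-rich : ∀ {h} → count A ≡ suc (h + h) → Rich A x₀ → OddRich
  odd-rich {h} e (all-shifts k F (inj₁ p) σ) =
    all-shifts k F (inj₁ (subst (λ s → suc s ≤ k + k) (sym e) (odd-< {h} {k} (subst (_≤ k + k) e p)))) σ
  odd-rich e (all-shifts k F (inj₂ p) σ) = all-shifts k F (inj₂ p) σ
  odd-rich e (one-shift k F p δ δ≢0 σ)   = one-shift k F p δ δ≢0 σ
  odd-rich e (no-shift k F p)            = no-shift k F p
  odd-rich {h} e (motion k F p _)        = no-shift k F
    (subst (λ s → 3 + s ≤ k + k) (sym e) (subst (_≤ k + k) (cong (2 +_) (cong suc (ℕ.+-suc h h)))
      (odd-< {suc h} {k} (subst (_≤ k + k) (cong suc (cong suc (sym (ℕ.+-suc h h)))) (subst (λ s → 2 + s ≤ k + k) e p)))))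

suc+suc : ∀ k l → suc (k + l) + suc (k + l) ≡ suc (suc ((k + k) + (l + l)))
suc+suc = solve-∀

double-sum : ∀ k l → (k + l) + (k + l) ≡ (k + k) + (l + l)
double-sum = solve-∀

module RichPair {n : ℕ} (Q : Quasigroup n) (S : Region n) (x₀ : Vec Symbol n) {c : Symbol} (c≢0 : c ≢ 0F)
  {A B : Region n} {i₀ j₀ : Fin n} (S∋i₀ : S i₀ ≡ true) (S∋j₀ : S j₀ ≡ true)
  (isA : LocalGlobal.IsComponent Q S x₀ c i₀ A) (isB : LocalGlobal.IsComponent Q S x₀ c j₀ B)
  (sep : Separated A B) (cover : ∀ i → S i ≡ true → A i ≡ true ⊎ B i ≡ true) where
  open Families Q
  open Pair Q S x₀ c≢0 S∋i₀ S∋j₀ isA isB sep cover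
  private
    module LA = Lift Q S x₀ c≢0 S∋i₀ isA
    module LB = Lift Q S x₀ c≢0 S∋j₀ isB

    i₀∈A = Component.IsComponent.contains isA

    size : count S ≡ count A + count B
    size = trans (count-cong (λ i → sym (∪-S i))) (count-∪ A B sep)

    bounded : ∀ {m k l} → m + (count A + count B) ≤ (k + k) + (l + l) → m + count S ≤ (k + l) + (k + l)
    bounded {m} {k} {l} p = subst₂ (λ s t → m + s ≤ t) (sym size) (sym (double-sum k l)) p

    bounded′ : ∀ {m k l} → m + (count A + count B) ≤ suc (suc ((k + k) + (l + l))) → m + count S ≤ suc (k + l) + suc (k + l)
    bounded′ {m} {k} {l} p = subst₂ (λ s t → m + s ≤ t) (sym size) (sym (suc+suc k l)) p

    both : ∀ {k l} → Family A x₀ A (2 ^ k) → Family B x₀ B (2 ^ l) → Family S x₀ S (2 ^ (k + l))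
    both {k} {l} F G = family-≗ ∪-S (product-^ S x₀ c c≢0 A⊆S B⊆S sep k l (LA.lift-family F) (LB.lift-family G))

    linked-both : ∀ {k l} → Shift A x₀ A c → Shift B x₀ B c → Family A x₀ A (2 ^ k) → Family B x₀ B (2 ^ l) → Family S x₀ S (2 ^ suc (k + l))
    linked-both {k} {l} σ τ F G = family-≗ ∪-S (linked-^ S x₀ c c≢0 A⊆S B⊆S sep k l
      (LA.lift-shift (outside-same c) σ) (LB.lift-shift (outside-same c) τ) (LA.lift-family F) (LB.lift-family G))

    left-shift : Shift A x₀ A c → Shift S x₀ S c
    left-shift σ = shift-⊆ (λ i i∉ → ∪-left A B i (trans (∪-S i) i∉)) (LA.lift-shift (outside-same c) σ)

    right-shift : Shift B x₀ B c → Shift S x₀ S c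
    right-shift σ = shift-⊆ (λ i i∉ → ∪-right A B i (trans (∪-S i) i∉)) (LB.lift-shift (outside-same c) σ)

    compose : ∀ {δ ε} → Shift S x₀ S δ → Shift S x₀ S ε → Shift S x₀ S (ε ⊕ δ)
    compose σ τ = shift-⊆ (λ i i∉ → trans (cong (λ b → b ∨ S i) i∉) i∉) (shift-· (λ _ p → p) σ τ)

    every-shift : ∀ {δ} → δ ≢ 0F → δ ≢ c → Shift S x₀ S c → Shift S x₀ S δ → ∀ ε → Shift S x₀ S ε
    every-shift {δ} δ≢0 δ≢c σ τ ε with ⊕-generated c δ c≢0 δ≢0 δ≢c ε
    ... | inj₁ refl                 = shift-0 S
    ... | inj₂ (inj₁ refl)          = σ
    ... | inj₂ (inj₂ (inj₁ refl))   = τ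
    ... | inj₂ (inj₂ (inj₂ refl))   = compose σ τ

    at-most : ∀ {s k} → suc s ≤ k + k ⊎ s ≡ 1 → s ≤ suc (k + k)
    at-most (inj₁ p) = ℕ.≤-trans (ℕ.n≤1+n _) (ℕ.m≤n⇒m≤1+n p)
    at-most (inj₂ refl) = s≤s z≤n

    slide : ∀ m a b → m + (a + b) ≡ a + (m + b)
    slide = solve-∀

    only : count A ≡ 1 → ∀ j → A j ≡ true → j ≡ i₀
    only p = singleton-unique p i₀∈A

  -- Two cases are postponed until A and B are exchanged. Because the postponing constructors fix
  -- the shape of both arguments, the exchanged call can only be `settled`.
  data Outcome : OddRich Q A x₀ → OddRich Q B x₀ → Set where
    settled : ∀ {a b} → Rich S x₀ → Outcome a b
    swap₁   : ∀ {k F p δ δ≢0 σ l G q τ} → Outcome (one-shift k F p δ δ≢0 σ) (all-shifts l G q τ)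
    swap₂   : ∀ {k F p l G q τ} → Outcome (no-shift k F p) (all-shifts l G q τ)

  -- The product of the families may fall short of the `no-shift` bound, and what is missing is
  -- found by linking shifts by c, by a shift of the whole value, or by a motion. The motion is
  -- needed when both parts have only a shift off {0 , c} and ψ is nonzero, hence equal to c.
  combine-rich : ∀ a b → Outcome a b
  combine-rich (all-shifts k F (inj₂ p) σ) (all-shifts l G (inj₂ q) τ) = settled (all-shifts (suc (k + l))
    (linked-both {k} {l} (σ c) (τ c) F G) (inj₁ (bounded′ {0} {k} {l} (subst₂ (λ a b → a + b ≤ _) (sym p) (sym q) (s≤s (s≤s z≤n)))))
    (λ δ → leaf-shift (only p) (τ δ)))
  combine-rich (all-shifts k F (inj₁ p) σ) (all-shifts l G q τ) = settled (one-shift (suc (k + l))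
    (linked-both {k} {l} (σ c) (τ c) F G) (bounded′ {1} {k} {l} (ℕ.m≤n⇒m≤1+n
      (ℕ.≤-trans (ℕ.+-mono-≤ p (at-most {count B} {l} q)) (ℕ.≤-reflexive (ℕ.+-suc (k + k) (l + l)))))) c c≢0 (left-shift (σ c)))
  combine-rich (all-shifts k F (inj₂ p) σ) (all-shifts l G (inj₁ q) τ) = settled (one-shift (suc (k + l))
    (linked-both {k} {l} (σ c) (τ c) F G) (bounded′ {1} {k} {l} (subst (λ a → suc (a + count B) ≤ suc (suc _)) (sym p)
      (s≤s (ℕ.≤-trans q (ℕ.≤-trans (ℕ.m≤n+m (l + l) (k + k)) (ℕ.n≤1+n _)))))) c c≢0 (left-shift (σ c)))
  combine-rich (all-shifts k F (inj₁ p) σ) (one-shift l G q δ δ≢0 τ) = settled (one-shift (k + l) (both {k} {l} F G)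
    (bounded {1} {k} {l} (ℕ.+-mono-≤ p (ℕ.≤-trans (ℕ.n≤1+n _) q))) c c≢0 (left-shift (σ c)))
  combine-rich (all-shifts k F (inj₂ p) σ) (one-shift l G q δ δ≢0 τ) with δ ≟ c
  ... | yes refl = settled (one-shift (suc (k + l)) (linked-both {k} {l} (σ c) τ F G)
          (bounded′ {1} {k} {l} (subst (λ a → suc (a + count B) ≤ suc (suc _)) (sym p)
            (s≤s (ℕ.≤-trans q (ℕ.≤-trans (ℕ.m≤n+m (l + l) (k + k)) (ℕ.n≤1+n _)))))) c c≢0 (left-shift (σ c)))
  -- The leaf shifts by c, B shifts by δ with the leaf compensating, and these two translations
  -- generate the rest.
  ... | no δ≢c   = settled (all-shifts (k + l) (both {k} {l} F G)
          (inj₁ (bounded {0} {k} {l} (subst (λ a → a + count B ≤ _) (sym p) (ℕ.≤-trans q (ℕ.m≤n+m (l + l) (k + k))))))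
          (every-shift δ≢0 δ≢c (left-shift (σ c)) (leaf-shift (only p) τ)))
  combine-rich (all-shifts k F p σ) (no-shift l G q) = settled (one-shift (k + l) (both {k} {l} F G)
    (bounded {1} {k} {l} (ℕ.≤-trans (ℕ.≤-reflexive (slide 1 (count A) (count B)))
      (ℕ.≤-trans (ℕ.+-monoˡ-≤ _ (at-most {count A} {k} p)) (ℕ.≤-trans (ℕ.≤-reflexive (sym (ℕ.+-suc (k + k) _)))
        (ℕ.+-monoʳ-≤ (k + k) (ℕ.≤-trans (ℕ.n≤1+n _) q)))))) c c≢0 (left-shift (σ c)))
  combine-rich (one-shift k F p δ δ≢0 σ) (one-shift l G q ε ε≢0 τ) with δ ≟ c | ε ≟ c | ψ ≟ 0F
  ... | yes refl | _        | _       = settled (one-shift (k + l) (both {k} {l} F G)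
          (bounded {1} {k} {l} (ℕ.+-mono-≤ p (ℕ.≤-trans (ℕ.n≤1+n _) q))) c c≢0 (left-shift σ))
  ... | no _     | yes refl | _       = settled (one-shift (k + l) (both {k} {l} F G)
          (bounded {1} {k} {l} (ℕ.+-mono-≤ p (ℕ.≤-trans (ℕ.n≤1+n _) q))) c c≢0 (right-shift τ))
  ... | no _     | no _     | yes ψ≡0 = settled (one-shift (k + l) (both {k} {l} F G)
          (bounded {1} {k} {l} (ℕ.+-mono-≤ p (ℕ.≤-trans (ℕ.n≤1+n _) q))) δ δ≢0 (linear-shift ψ≡0 σ))
  ... | no δ≢c   | no ε≢c   | no ψ≢0  = settled (motion (k + l) (both {k} {l} F G)
          (bounded {2} {k} {l} (ℕ.≤-trans (ℕ.≤-reflexive (cong suc (slide 1 (count A) (count B)))) (ℕ.+-mono-≤ p q)))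
          (twisted-motion ψ≢0 (out δ≢0 δ≢c) (out ε≢0 ε≢c) σ τ))
    where
    ψ≡c : ψ ≡ c
    ψ≡c = [ (λ e → ⊥-elim (ψ≢0 e)) , id ]′ (outside-false c ψ outside-ψ)
    out : ∀ {δ} → δ ≢ 0F → δ ≢ c → outside ψ δ ≡ true
    out δ≢0 δ≢c = outside-intro ψ _ δ≢0 (λ e → δ≢c (trans e ψ≡c))
  combine-rich (one-shift k F p δ δ≢0 σ) (no-shift l G q) = settled (no-shift (k + l) (both {k} {l} F G)
    (bounded {3} {k} {l} (ℕ.≤-trans (ℕ.≤-reflexive (slide 3 (count A) (count B))) (ℕ.+-mono-≤ (ℕ.≤-trans (ℕ.n≤1+n _) p) q))))
  combine-rich (no-shift k F p) (one-shift l G q δ δ≢0 τ) = settled (no-shift (k + l) (both {k} {l} F G)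
    (bounded {3} {k} {l} (ℕ.+-mono-≤ p (ℕ.≤-trans (ℕ.n≤1+n _) q))))
  combine-rich (no-shift k F p) (no-shift l G q) = settled (no-shift (k + l) (both {k} {l} F G)
    (bounded {3} {k} {l} (ℕ.+-mono-≤ p (ℕ.≤-trans (ℕ.m≤n+m _ 3) q))))
  combine-rich (one-shift _ _ _ _ _ _) (all-shifts _ _ _ _) = swap₁
  combine-rich (no-shift _ _ _)        (all-shifts _ _ _ _) = swap₂

-- The induction on the number of active coordinates

module Induction {n : ℕ} (Q : Quasigroup n) (x₀ : Vec Symbol n) where
  open Levels Q using (f)
  open Families Q

  leaf-rich : ∀ {S : Region n} {i} → S i ≡ true → (∀ j → S j ≡ true → j ≡ i) → Rich S x₀
  leaf-rich {S} {i} i∈ only = all-shifts 0 (trivial S) (inj₂ (count-singleton i∈ only)) λ δ → record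
    { transform = leaf-transform (_⊕ δ) (inv δ) ; supported = leaf-supported (_⊕ δ) (inv δ) {S} i∈
    ; shift = λ x x≈ → trans (sym (⊕-cancelˡ (f x₀) _)) (trans (cong (f x₀ ⊕_) (leaf-effect (_⊕ δ) (inv δ) {S} only x x≈))
        (trans (sym (⊕-assoc (f x₀) _ δ)) (cong (_⊕ δ) (⊕-cancelˡ (f x₀) (f x))))) }
    where
    open Leaf Q x₀ i
    inv : ∀ δ a → (a ⊕ δ) ⊕ δ ≡ a
    inv δ a = trans (⊕-assoc a δ δ) (trans (cong (a ⊕_) (⊕-self δ)) (⊕-identityʳ a))

  finish : ∀ {S c v} → c ≢ 0F → Progress S x₀ c S v → 3 + count S ≤ v + v → Rich S x₀
  finish {S} {c} {v} c≢0 (flagged k F σ v≤) p = one-shift k F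
    (ℕ.≤-pred (ℕ.≤-pred (subst (3 + count S ≤_) (cong suc (ℕ.+-suc k k)) (ℕ.≤-trans p (ℕ.+-mono-≤ v≤ v≤))))) c c≢0 σ
  finish c≢0 (plain k F v≤) p = no-shift k F (ℕ.≤-trans p (ℕ.+-mono-≤ v≤ v≤))

  progress-≗ : ∀ {S c U V v} → (∀ i → U i ≡ V i) → Progress S x₀ c U v → Progress S x₀ c V v
  progress-≗ eq (flagged k F σ p) = flagged k (family-≗ eq F) (shift-⊆ (λ i i∉ → trans (eq i) i∉) σ) p
  progress-≗ eq (plain k F p)     = plain k (family-≗ eq F) p

  module Step (S : Region n) (smaller : ∀ C {i} → C i ≡ true → count C < count S → Rich C x₀)
              {c : Symbol} (c≢0 : c ≢ 0F) where
    open LocalGlobal Q S x₀ using (Edge; edge?; IsComponent; component-⊆; module Comp; χ-sym)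

    edge-sym : ∀ {i j} → Edge c i j → Edge c j i
    edge-sym (i∈ , j∈ , i≢j , x , x≈ , e) = j∈ , i∈ , i≢j ∘ sym , x , x≈ , trans (cong (outside c) (sym (χ-sym i≢j x))) e

    Closed : Region n → Set
    Closed U = ∀ {i j} → U i ≡ true → Edge c i j → U j ≡ true

    -- A union of components that have already been merged. The excess e gains at least one for each
    -- component, because 2 (⌊s/2⌋ + 1) ≥ s + 1, and two for a component of even size; `finish`
    -- requires 3.
    record Partial (e : ℕ) : Set where
      field
        U        : Region n
        v        : ℕ
        U⊆S      : ∀ i → U i ≡ true → S i ≡ true
        nonempty : ∃[ i ] U i ≡ true
        closed   : Closed U
        state    : Progress S x₀ c U v
        bound    : e + count U ≤ v + v

    avoids : ∀ {U} → Closed U → ∀ {j C} → U j ≡ false → IsComponent c j C → ∀ k → C k ≡ true → U k ≡ false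
    avoids {U} closed {j} j∉ isC = Component.IsComponent.generated isC (λ k → U k ≡ false) j∉ λ {i} {k} _ i∉ e →
      by-cases (U k) (λ k∈ → ⊥-elim (false≢true (trans (sym i∉) (closed k∈ (edge-sym e))))) id

    module _ {e : ℕ} (P : Partial e) {j : Fin n} (j∈S : S j ≡ true) (j∉U : Partial.U P j ≡ false) where
      open Partial P
      private
        C = proj₁ (Comp.component c j)
        isC = proj₂ (Comp.component c j)
        j∈C = Component.IsComponent.contains isC
        C⊆S = component-⊆ c≢0 j∈S isC
        C∌ = avoids closed j∉U isC
        sep : Separated U C
        sep i i∈ = by-cases (C i) (λ i∈C → ⊥-elim (false≢true (trans (sym (C∌ i i∈C)) i∈))) id
        small : count C < count S
        small = let i , i∈ = nonempty in count-< {j = i} C⊆S (U⊆S i i∈) (sep i i∈)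

      extend : Partial (suc e)
      extend = record
        { U = U ∪ C ; v = v + suc ⌊ count C /2⌋
        ; U⊆S = λ i i∈ → by-cases (U i) (U⊆S i) (λ i∉ → C⊆S i (trans (cong (_∨ C i) (sym i∉)) i∈))
        ; nonempty = let i , i∈ = nonempty in i , cong (_∨ C i) i∈
        ; closed = λ {i} {k} i∈ edge → by-cases (U i) (λ i∈U → cong (_∨ C k) (closed i∈U edge))
            (λ i∉ → trans (cong (U k ∨_) (Component.IsComponent.closed isC (trans (cong (_∨ C i) (sym i∉)) i∈) edge)) (Bool.∨-zeroʳ (U k)))
        ; state = merge S x₀ c c≢0 U⊆S C⊆S sep state (Lift.progress Q S x₀ c≢0 j∈S isC (smaller C j∈C small))
        ; bound = subst₂ _≤_ (trans (rearrange e (count U) (count C)) (cong (suc e +_) (sym (count-∪ U C sep))))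
            (+-interchange v v (suc ⌊ count C /2⌋) (suc ⌊ count C /2⌋)) (ℕ.+-mono-≤ bound (weight (count C))) }
        where
        rearrange : ∀ e u c → (e + u) + suc c ≡ suc e + (u + c)
        rearrange = solve-∀

      extend-grows : count U < count (U ∪ C)
      extend-grows = count-< {A = U} {U ∪ C} {j} (λ i i∈ → cong (_∨ C i) i∈) (trans (cong (U j ∨_) j∈C) (Bool.∨-zeroʳ (U j))) j∉U

    sweep : ∀ m (P : Partial 3) → count S ≤ m + count (Partial.U P) → Rich S x₀
    sweep m P bnd with any? (λ j → (S j Bool.≟ true) ×-dec (Partial.U P j Bool.≟ false))
    ... | no none = finish c≢0 (progress-≗ all (Partial.state P)) (subst (λ s → 3 + s ≤ v + v) (count-cong all) (Partial.bound P))
      where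
      v = Partial.v P
      all : ∀ i → Partial.U P i ≡ S i
      all i = by-cases (Partial.U P i) (λ i∈ → trans i∈ (sym (Partial.U⊆S P i i∈)))
        (λ i∉ → by-cases (S i) (λ i∈S → ⊥-elim (none (i , i∈S , i∉))) (λ i∉S → trans i∉ (sym i∉S)))
    ... | yes (j , j∈S , j∉U) = next m bnd
      where
      P′ : Partial 3
      -- The excess has grown to 4 and is relaxed to the 3 that `finish` requires.
      P′ = record { Partial (extend P j∈S j∉U) ; bound = ℕ.≤-trans (ℕ.n≤1+n _) (Partial.bound (extend P j∈S j∉U)) }
      next : ∀ m → count S ≤ m + count (Partial.U P) → Rich S x₀
      next zero bnd = ⊥-elim (ℕ.<-irrefl refl (ℕ.≤-trans (s≤s (ℕ.≤-trans (count-mono (Partial.U⊆S P′)) bnd)) (extend-grows P j∈S j∉U)))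
      next (suc m) bnd = sweep m P′ (ℕ.≤-trans bnd (subst (_≤ m + count (Partial.U P′)) (ℕ.+-suc m _) (ℕ.+-monoʳ-≤ m (extend-grows P j∈S j∉U))))

    module _ {i₀ j₀ : Fin n} (S∋i₀ : S i₀ ≡ true) (S∋j₀ : S j₀ ≡ true) {A : Region n} (isA : IsComponent c i₀ A) (j₀∉A : A j₀ ≡ false) where
      private
        B = proj₁ (Comp.component c j₀)
        isB : IsComponent c j₀ B
        isB = proj₂ (Comp.component c j₀)
        i₀∈A = Component.IsComponent.contains isA
        j₀∈B = Component.IsComponent.contains isB
        A⊆S = component-⊆ c≢0 S∋i₀ isA
        B⊆S = component-⊆ c≢0 S∋j₀ isB
        B∌ = avoids {A} (Component.IsComponent.closed isA) j₀∉A isB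
        sep : Separated A B
        sep i i∈ = by-cases (B i) (λ i∈B → ⊥-elim (false≢true (trans (sym (B∌ i i∈B)) i∈))) id
        sep′ : Separated B A
        sep′ i i∈ = B∌ i i∈
        richA : Rich A x₀
        richA = smaller A i₀∈A (count-< {j = j₀} A⊆S S∋j₀ j₀∉A)
        richB : Rich B x₀
        richB = smaller B j₀∈B (count-< {j = i₀} B⊆S S∋i₀ (sep i₀ i₀∈A))
        first : Partial 1
        first = record
          { U = A ; v = suc ⌊ count A /2⌋ ; U⊆S = A⊆S ; nonempty = i₀ , i₀∈A ; closed = Component.IsComponent.closed isA
          ; state = Lift.progress Q S x₀ c≢0 S∋i₀ isA richA ; bound = weight (count A) }
        second : Partial 2
        second = extend first S∋j₀ j₀∉A

        from-even : count A ≡ ⌊ count A /2⌋ + ⌊ count A /2⌋ ⊎ count B ≡ ⌊ count B /2⌋ + ⌊ count B /2⌋ → Partial 3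
        from-even p = record { Partial second ; bound = subst₂ _≤_ (cong (3 +_) (sym (count-∪ A B sep)))
            (+-interchange (suc hA) (suc hA) (suc hB) (suc hB)) (go p) }
          where
          hA = ⌊ count A /2⌋
          hB = ⌊ count B /2⌋
          go : count A ≡ hA + hA ⊎ count B ≡ hB + hB → 3 + (count A + count B) ≤ (suc hA + suc hA) + (suc hB + suc hB)
          go (inj₁ p) = ℕ.≤-trans (ℕ.≤-reflexive (rearrange₁ (count A) (count B))) (ℕ.+-mono-≤ (even-weight (count A) p) (weight (count B)))
            where
            rearrange₁ : ∀ a b → 3 + (a + b) ≡ (2 + a) + suc b
            rearrange₁ = solve-∀
          go (inj₂ p) = ℕ.≤-trans (ℕ.≤-reflexive (rearrange₂ (count A) (count B))) (ℕ.+-mono-≤ (weight (count A)) (even-weight (count B) p))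
            where
            rearrange₂ : ∀ a b → 3 + (a + b) ≡ suc a + (2 + b)
            rearrange₂ = solve-∀

        from-odd : count A ≡ suc (⌊ count A /2⌋ + ⌊ count A /2⌋) → count B ≡ suc (⌊ count B /2⌋ + ⌊ count B /2⌋) →
          (∀ i → S i ≡ true → A i ≡ true ⊎ B i ≡ true) → Rich S x₀
        from-odd pA pB cover = go (RichPair.combine-rich Q S x₀ c≢0 S∋i₀ S∋j₀ isA isB sep cover
            (odd-rich Q A x₀ {⌊ count A /2⌋} pA richA) (odd-rich Q B x₀ {⌊ count B /2⌋} pB richB))
          where
          module R = RichPair Q S x₀ c≢0 S∋i₀ S∋j₀ isA isB sep cover
          module R′ = RichPair Q S x₀ c≢0 S∋j₀ S∋i₀ isB isA sep′ (λ i i∈ → [ inj₂ , inj₁ ]′ (cover i i∈))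
          go : ∀ {a b} → R.Outcome a b → Rich S x₀
          go (R.settled r) = r
          go (R.swap₁ {k} {F} {p} {δ} {δ≢0} {σ} {l} {G} {q} {τ}) with R′.combine-rich (all-shifts l G q τ) (one-shift k F p δ δ≢0 σ)
          ... | R′.settled r = r
          go (R.swap₂ {k} {F} {p} {l} {G} {q} {τ}) with R′.combine-rich (all-shifts l G q τ) (no-shift k F p)
          ... | R′.settled r = r

      from-split : Rich S x₀
      from-split with any? (λ k → (S k Bool.≟ true) ×-dec (Partial.U second k Bool.≟ false))
      ... | yes (k , k∈S , k∉U) = sweep (count S) (extend second k∈S k∉U) (ℕ.m≤m+n _ _)
      ... | no none with parity (count A) | parity (count B)
      ...   | inj₁ p | _      = sweep (count S) (from-even (inj₁ p)) (ℕ.m≤m+n _ _)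
      ...   | inj₂ _ | inj₁ q = sweep (count S) (from-even (inj₂ q)) (ℕ.m≤m+n _ _)
      ...   | inj₂ p | inj₂ q = from-odd p q λ i i∈S → by-cases (A i) inj₁ (λ i∉A → by-cases (B i) inj₂
                (λ i∉B → ⊥-elim (none (i , i∈S , trans (cong (_∨ B i) i∉A) i∉B))))

  rich : ∀ m S {i₀} → S i₀ ≡ true → count S ≤ m → Rich S x₀
  rich zero S {i₀} i₀∈ p = ⊥-elim (ℕ.<-irrefl refl (ℕ.≤-trans (count-< {A = λ _ → false} {S} {i₀} (λ _ ()) i₀∈ refl) (ℕ.≤-trans p z≤n)))
  rich (suc m) S {i₀} i₀∈ p with any? (λ j → (S j Bool.≟ true) ×-dec ¬? (j ≟ i₀))
  ... | no none = leaf-rich i₀∈ λ j j∈ → case j ≟ i₀ of λ { (yes e) → e ; (no ne) → ⊥-elim (none (j , j∈ , ne)) }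
  ... | yes (j , j∈ , j≢i₀) with LocalGlobal.splits Q S x₀ i₀∈ j∈ j≢i₀
  ...   | c , c≢0 , A , isA , k , k∈S , k∉A =
    Step.from-split S (λ C i∈ lt → rich m C i∈ (ℕ.≤-pred (ℕ.≤-trans lt p))) c≢0 i₀∈ k∈S isA k∉A

-- The order of the autotopy group

all-word? : ∀ {n} {P : Vec Symbol n → Set} → (∀ x → Dec (P x)) → Dec (∀ x → P x)
all-word? {zero}  P? = map′ (λ p → λ { [] → p }) (λ p → p []) (P? [])
all-word? {suc n} P? = map′ (λ p → λ { (a ∷ x) → p a x }) (λ p a x → p (a ∷ x)) (all? λ a → all-word? λ x → P? (a ∷ x))

funToFin-cong : ∀ {m n} {f g : Fin m → Fin n} → f ≗ g → funToFin f ≡ funToFin g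
funToFin-cong {zero}  p = refl
funToFin-cong {suc m} p = cong₂ combine (p zero) (funToFin-cong (p ∘ suc))

Table : ℕ → Set
Table m = Fin m → Symbol → Symbol

abstract
  -- One number per tuple of maps, m maps with four values each. The block is abstract so that this
  -- power and the coding do not unfold in later types.
  tables : ℕ → ℕ
  tables m = 4 ^ (m * 4)

  encode : ∀ {m} → Table m → Fin (tables m)
  encode {m} t = funToFin λ r → t (proj₁ (remQuot {m} 4 r)) (proj₂ (remQuot {m} 4 r))

  decode : ∀ {m} → Fin (tables m) → Table m
  decode {m} c i a = finToFun c (combine i a)

  encode-cong : ∀ {m} {t u : Table m} → (∀ i a → t i a ≡ u i a) → encode t ≡ encode u
  encode-cong {m} p = funToFin-cong λ r → p (proj₁ (remQuot {m} 4 r)) (proj₂ (remQuot {m} 4 r))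

  decode-encode : ∀ {m} (t : Table m) i a → decode (encode t) i a ≡ t i a
  decode-encode {m} t i a = trans (finToFun-funToFin _ (combine i a)) (cong (λ (j , b) → t j b) (remQuot-combine {m} {4} i a))

  encode-decode : ∀ {m} (c : Fin (tables m)) → encode (decode c) ≡ c
  encode-decode {m} c = trans (funToFin-cong λ r → cong (finToFun c) (combine-remQuot {m} 4 r)) (funToFin-finToFin {m * 4} {4} c)

record Enumeration {N : ℕ} (P : Fin N → Set) : Set where
  field
    size      : ℕ
    index     : ∀ i → P i → Fin size
    element   : Fin size → Fin N
    holds     : ∀ j → P (element j)
    index-element : ∀ j p → index (element j) p ≡ j
    element-index : ∀ i p → element (index i p) ≡ i

enumerate : ∀ {N} {P : Fin N → Set} → (∀ i → Dec (P i)) → Enumeration P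
enumerate {zero} P? = record
  { size = 0 ; index = λ () ; element = λ () ; holds = λ () ; index-element = λ () ; element-index = λ () }
enumerate {suc N} {P} P? with P? zero | enumerate (P? ∘ suc)
... | yes p | E = record
  { size = suc size ; index = λ { zero _ → zero ; (suc i) q → suc (index i q) }
  ; element = λ { zero → zero ; (suc j) → suc (element j) } ; holds = λ { zero → p ; (suc j) → holds j }
  ; index-element = λ { zero _ → refl ; (suc j) q → cong suc (index-element j q) }
  ; element-index = λ { zero _ → refl ; (suc i) q → cong suc (element-index i q) } }
  where open Enumeration E
... | no ¬p | E = record
  { size = size ; index = λ { zero p → ⊥-elim (¬p p) ; (suc i) q → index i q }
  ; element = suc ∘ element ; holds = holds ; index-element = index-element
  ; element-index = λ { zero p → ⊥-elim (¬p p) ; (suc i) q → cong suc (element-index i q) } }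
  where open Enumeration E

permutation? : (t : Symbol → Symbol) → Dec (Σ[ π ∈ Permutation′ 4 ] (∀ a → π ⟨$⟩ʳ a ≡ t a))
permutation? t with all? (λ b → any? λ a → t a ≟ b) | all? (λ a → all? λ b → (t a ≟ t b) →-dec (a ≟ b))
... | yes sur | yes inj = yes (permutation t (proj₁ ∘ sur) (proj₂ ∘ sur) (λ a → inj _ _ (proj₂ (sur (t a)))) , λ _ → refl)
... | no ¬sur | _       = no λ { (π , e) → ¬sur λ b → π ⟨$⟩ˡ b , trans (sym (e _)) (inverseʳ π) }
... | _       | no ¬inj = no λ { (π , e) → ¬inj λ a b p → perm-injective π (trans (e a) (trans p (sym (e b)))) }

from-cong : ∀ (π ρ : Permutation′ 4) → (∀ a → π ⟨$⟩ʳ a ≡ ρ ⟨$⟩ʳ a) → ∀ b → π ⟨$⟩ˡ b ≡ ρ ⟨$⟩ˡ b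
from-cong π ρ e b = perm-injective π (trans (inverseʳ π) (sym (trans (e _) (inverseʳ ρ))))

module Order {n : ℕ} (Q : Quasigroup n) where
  open Quasigroup Q renaming (op to f)
  open Group (Atp Q) using (Carrier; setoid) renaming (_≈_ to _≈ᴳ_)

  isAutotopy-cong : ∀ {θ φ : Perms n} → (∀ i a → θ i ⟨$⟩ʳ a ≡ φ i ⟨$⟩ʳ a) → IsAutotopy f θ → IsAutotopy f φ
  isAutotopy-cong {θ} {φ} e p x = trans (p x) (trans (from-cong (θ zero) (φ zero) (e zero) _)
    (cong (λ y → φ zero ⟨$⟩ˡ f y) (tabulate-cong λ i → e (suc i) (lookup x i))))

  table : Perms n → Table (suc n)
  table θ i a = θ i ⟨$⟩ʳ a

  code : Perms n → Fin (tables (suc n))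
  code θ = encode (table θ)

  code-injective : ∀ θ φ → code θ ≡ code φ → ∀ i a → θ i ⟨$⟩ʳ a ≡ φ i ⟨$⟩ʳ a
  code-injective θ φ e i a = trans (sym (decode-encode (table θ) i a)) (trans (cong (λ c → decode c i a) e) (decode-encode (table φ) i a))

  -- Permutations contain inverses and proofs, so only their value tables can be enumerated. The
  -- predicate carries the autotopy itself in order that the inverse of the numbering can return it.
  Coded : Fin (tables (suc n)) → Set
  Coded c = Σ[ θ ∈ Carrier ] code (proj₁ θ) ≡ c

  coded? : ∀ c → Dec (Coded c)
  coded? c with all? (λ i → permutation? (decode c i))
  ... | no ¬perm = no λ { ((θ , _) , refl) → ¬perm λ i → θ i , λ a → sym (decode-encode (table θ) i a) }
  ... | yes perm with all-word? (λ x → f x ≟ proj₁ (perm zero) ⟨$⟩ˡ f (act (proj₁ ∘ perm) x))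
  ...   | yes p = yes ((proj₁ ∘ perm , p) , trans (encode-cong λ i a → proj₂ (perm i) a) (encode-decode c))
  ...   | no ¬p = no λ { ((θ , p) , refl) → ¬p (isAutotopy-cong {θ} {proj₁ ∘ perm}
            (λ i a → trans (sym (decode-encode (table θ) i a)) (sym (proj₂ (perm i) a))) p) }

  private
    module E = Enumeration (enumerate coded?)

    -- `index-element` accepts any proof, so the index cannot depend on which autotopy witnesses a
    -- code.
    index-irrelevant : ∀ {c d} p q → c ≡ d → E.index c p ≡ E.index d q
    index-irrelevant {c} p q refl = trans (sym (E.index-element _ (subst Coded (sym (E.element-index c p)) q)))
      (go (E.element-index c p) q)
      where
      go : ∀ {d} (e : d ≡ c) q → E.index d (subst Coded (sym e) q) ≡ E.index c q
      go refl q = refl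

    numbered : Carrier → Fin E.size
    numbered θ = E.index (code (proj₁ θ)) (θ , refl)

    named : Fin E.size → Carrier
    named j = proj₁ (E.holds j)

    numbered-cong : ∀ {θ φ} → θ ≈ᴳ φ → numbered θ ≡ numbered φ
    numbered-cong {θ} {φ} e = index-irrelevant (θ , refl) (φ , refl) (encode-cong e)

    numbered-named : ∀ j → numbered (named j) ≡ j
    numbered-named j = trans (index-irrelevant (named j , refl) (E.holds j) (proj₂ (E.holds j))) (E.index-element j _)

    named-numbered : ∀ θ → named (numbered θ) ≈ᴳ θ
    named-numbered θ = code-injective (proj₁ (named (numbered θ))) (proj₁ θ) (trans (proj₂ (E.holds (numbered θ))) (E.element-index _ (θ , refl)))

  order : ℕ
  order = E.size

  hasOrder : HasOrder (Atp Q) order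
  hasOrder = record
    { to = numbered ; from = named ; to-cong = λ {θ} {φ} → numbered-cong {θ} {φ} ; from-cong = λ { refl _ _ → refl }
    ; inverse = (λ {j} {θ} e → trans (numbered-cong {θ} {named j} e) (numbered-named j))
              , (λ {θ} {j} e i a → trans (cong (λ k → proj₁ (named k) i ⟨$⟩ʳ a) e) (named-numbered θ i a)) }

  order-≥ : ∀ {N} (g : Fin N → Carrier) → (∀ {p q} → g p ≈ᴳ g q → p ≡ q) → N ≤ order
  order-≥ g inj = injective⇒≤ {f = numbered ∘ g} λ {p} {q} e → inj λ i a →
    trans (sym (named-numbered (g p) i a)) (trans (cong (λ j → proj₁ (named j) i ⟨$⟩ʳ a) e) (named-numbered (g q) i a))

  order-≤ : ∀ {N} (g : Carrier → Fin N) → (∀ θ φ → g θ ≡ g φ → θ ≈ᴳ φ) → order ≤ N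
  order-≤ g inj = injective⇒≤ {f = g ∘ named} λ {j} {k} e →
    trans (sym (numbered-named j)) (trans (numbered-cong {named j} {named k} (inj _ _ e)) (numbered-named k))

count-full : ∀ n → count {n} (λ _ → true) ≡ n
count-full zero    = refl
count-full (suc n) = cong suc (count-full n)

module LowerBound {n : ℕ} (Q : Quasigroup n) where
  open Levels Q using (f; Word)
  open Families Q
  open Order Q

  private
    full : Region n
    full _ = true

    x₀ : Word
    x₀ = tabulate λ _ → 0F

    everywhere : ∀ x → x ≈[ full ] x₀
    everywhere x = agreeing λ _ ()

  -- A representative of a coset of the subgroup of autotopies with θ₀ = id. Families lie in this
  -- subgroup, and different θ₀ mean different cosets, so the orders multiply.
  record Coset : Set where
    field
      root      : Permutation′ 4
      transform : Transform n
      effect    : ∀ x → f (apply transform x) ≡ root ⟨$⟩ʳ f x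

  perms : Coset → Transform n → Perms n
  perms C θ zero    = Coset.root C
  perms C θ (suc i) = (Coset.transform C · θ) i

  module _ {N : ℕ} (F : Family full x₀ full N) where
    open Family F

    element-isAutotopy : ∀ C p → IsAutotopy f (perms C (at p))
    element-isAutotopy C p x = sym (trans (cong (Coset.root C ⟨$⟩ˡ_) (trans (cong f (apply-· (Coset.transform C) (at p) x))
      (trans (Coset.effect C _) (cong (Coset.root C ⟨$⟩ʳ_) (invariant p x (everywhere x)))))) (inverseˡ (Coset.root C)))

    cosets-≤ : ∀ {M} (C : Fin M → Coset) → (∀ {b d} → (∀ a → Coset.root (C b) ⟨$⟩ʳ a ≡ Coset.root (C d) ⟨$⟩ʳ a) → b ≡ d) → M * N ≤ order
    cosets-≤ {M} C distinct = order-≥ (λ r → let b , p = remQuot {M} N r in perms (C b) (at p) , element-isAutotopy (C b) p)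
      λ {r} {s} e → trans (sym (combine-remQuot {M} N r)) (trans (same (proj₁ (remQuot {M} N r)) (proj₁ (remQuot {M} N s))
        (proj₂ (remQuot {M} N r)) (proj₂ (remQuot {M} N s)) e) (combine-remQuot {M} N s))
      where
      same : ∀ b d p q → (∀ i a → perms (C b) (at p) i ⟨$⟩ʳ a ≡ perms (C d) (at q) i ⟨$⟩ʳ a) → combine b p ≡ combine d q
      same b d p q e with distinct {b} {d} (e zero)
      ... | refl = cong (combine b) (injective λ i a → perm-injective (Coset.transform (C b) i) (e (suc i) a))

  private
    identity : Coset
    identity = record { root = idₚ ; transform = λ _ → idₚ ; effect = λ x → cong f (tabulate∘lookup x) }

    translation : Symbol → Permutation′ 4
    translation δ = permutation (_⊕ δ) (_⊕ δ) back back
      where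
      back : ∀ a → (a ⊕ δ) ⊕ δ ≡ a
      back a = trans (⊕-assoc a δ δ) (trans (cong (a ⊕_) (⊕-self δ)) (⊕-identityʳ a))

    shift-coset : ∀ {δ} → Shift full x₀ full δ → Coset
    shift-coset {δ} σ = record { root = translation δ ; transform = Shift.transform σ ; effect = λ x → Shift.shift σ x (everywhere x) }

    motion-coset : Motion full x₀ → Coset
    motion-coset m = record
      { root = permutation root (root ∘ root ∘ root) order-4 order-4 ; transform = transform ; effect = λ x → effect x (everywhere x) }
      where open Motion m

    pair : Coset → Fin 2 → Coset
    pair C 0F = identity
    pair C 1F = C

    pair-distinct : ∀ C → ∃[ a ] Coset.root C ⟨$⟩ʳ a ≢ a → ∀ {b d} →
      (∀ a → Coset.root (pair C b) ⟨$⟩ʳ a ≡ Coset.root (pair C d) ⟨$⟩ʳ a) → b ≡ d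
    pair-distinct C (a , ne) {0F} {0F} e = refl
    pair-distinct C (a , ne) {1F} {1F} e = refl
    pair-distinct C (a , ne) {0F} {1F} e = ⊥-elim (ne (sym (e a)))
    pair-distinct C (a , ne) {1F} {0F} e = ⊥-elim (ne (e a))

    enough : ∀ k m → ⌊ n /2⌋ + 2 ≤ m + k → 2 ^ m * 2 ^ k ≤ order → 2 ^ (⌊ n /2⌋ + 2) ≤ order
    enough k m p q = ℕ.≤-trans (ℕ.^-monoʳ-≤ 2 p) (subst (_≤ order) (sym (ℕ.^-distribˡ-+-* 2 m k)) q)

    half : ∀ {m k} → m + count full ≤ k + k → m + n ≤ k + k
    half {m} {k} = subst (λ s → m + s ≤ k + k) (count-full n)

    from-rich : Rich full x₀ → 2 ^ (⌊ n /2⌋ + 2) ≤ order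
    from-rich (all-shifts k F p σ) = enough k 2 (subst (_≤ 2 + k) (ℕ.+-comm 2 ⌊ n /2⌋) (ℕ.+-monoʳ-≤ 2 (small p)))
      -- A translation is recovered from its value at 0.
      (cosets-≤ F (λ δ → shift-coset (σ δ)) λ {b} {d} e → e 0F)
      where
      small : count full ≤ k + k ⊎ count full ≡ 1 → ⌊ n /2⌋ ≤ k
      small (inj₁ p) = half-≤ (half {0} {k} p)
      small (inj₂ p) = subst (λ s → ⌊ s /2⌋ ≤ k) (trans (sym p) (count-full n)) z≤n
    from-rich (one-shift k F p δ δ≢0 σ) = enough k 1 (subst (_≤ 1 + k) (ℕ.+-comm 2 ⌊ n /2⌋) (s≤s (half-< (half {1} {k} p))))
      (cosets-≤ F (pair (shift-coset σ)) (pair-distinct (shift-coset σ) (0F , δ≢0)))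
    from-rich (no-shift k F p) = enough k 0 (subst (_≤ k) (ℕ.+-comm 2 ⌊ n /2⌋) (half-< {2 + n} (half {3} {k} p)))
      (cosets-≤ F {1} (λ _ → identity) λ { {0F} {0F} _ → refl })
    from-rich (motion k F p m) = enough k 1 (subst (_≤ 1 + k) (ℕ.+-comm 2 ⌊ n /2⌋) (s≤s (half-< (half {1} {k} (ℕ.≤-trans (ℕ.n≤1+n _) p)))))
      (cosets-≤ F (pair (motion-coset m)) (pair-distinct (motion-coset m) (Motion.moves m)))

  order-bound : n ≥ 1 → 2 ^ (⌊ n /2⌋ + 2) ≤ order
  order-bound n≥1 = from-rich (start n≥1 full refl)
    where
    start : n ≥ 1 → ∀ S → S ≡ full → Rich S x₀
    start (s≤s _) S refl = Induction.rich Q x₀ n full {zero} refl (ℕ.≤-reflexive (count-full n))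

-- Quasigroups with few autotopies

swap : Symbol → Symbol
swap 1F = 2F
swap 2F = 1F
swap a  = a

low high : Symbol → Bool
low 0F = false
low 1F = true
low 2F = false
low 3F = true
high 0F = false
high 1F = false
high 2F = true
high 3F = true

-- Modulo {0 , 2}, mix is additive in y, z and in the class of v modulo {0 , 1}.
mix : Symbol → Symbol → Symbol → Symbol
mix v y z = swap v ⊕ y ⊕ z ⊕ (if low (swap v) ∧ low y ∧ low z then 2F else 0F)

-- Adding 2 does not affect the low bit, so u has the low bit of `swap v`, and the correction can be
-- recomputed and removed.
unmix : Symbol → Symbol → Symbol → Symbol
unmix w y z = let u = w ⊕ y ⊕ z in swap (u ⊕ (if low u ∧ low y ∧ low z then 2F else 0F))

-- As in `mix`, the correction is the product of all the low bits, a Boolean monomial that is not a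
-- sum of functions of fewer arguments. Since `chain` adds two arguments, even arities start from
-- here; this block is always innermost, so it contains no `swap`.
quad : Symbol → Symbol → Symbol → Symbol → Symbol
quad a b c d = a ⊕ b ⊕ c ⊕ d ⊕ (if low a ∧ low b ∧ low c ∧ low d then 2F else 0F)

Translates : (Symbol → Symbol) → Set
Translates q = (q 0F ≡ 0F ⊎ q 0F ≡ 2F) × (∀ a → q a ≡ a ⊕ q 0F)

translates? : ∀ q → Dec (Translates q)
translates? q = ((q 0F ≟ 0F) ⊎-dec (q 0F ≟ 2F)) ×-dec all? λ a → q a ≟ a ⊕ q 0F

Identical : (Symbol → Symbol) → Set
Identical q = ∀ a → q a ≡ a

identical? : ∀ q → Dec (Identical q)
identical? q = all? λ a → q a ≟ a

table : Symbol → Symbol → Symbol → Symbol → Symbol → Symbol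
table a b c d = lookup (a ∷ b ∷ c ∷ d ∷ [])

module Mix (p : Symbol → Symbol) (q₀ r₀ : Symbol) where

  output : Symbol → Symbol
  output w = mix (p (unmix w 0F 0F)) q₀ r₀

  Facts : (Symbol → Symbol) → (Symbol → Symbol) → Set
  Facts q r = (∀ a → low (output a) ≡ low a) × (∀ a → high (p a) ≡ high a) ×
    (Identical p → Translates q × Translates r × (∀ a → output a ≡ a ⊕ (q₀ ⊕ r₀))) ×
    (Identical output → Translates q × Translates r)

  facts? : ∀ q r → Dec (Facts q r)
  facts? q r = (all? λ a → low (output a) Bool.≟ low a) ×-dec (all? λ a → high (p a) Bool.≟ high a) ×-dec
    (identical? p →-dec translates? q ×-dec translates? r ×-dec all? λ a → output a ≟ a ⊕ (q₀ ⊕ r₀)) ×-dec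
    (identical? output →-dec translates? q ×-dec translates? r)

abstract
  mix-unmix : ∀ w y z → mix (unmix w y z) y z ≡ w
  mix-unmix = toWitness {a? = all? λ w → all? λ y → all? λ z → mix (unmix w y z) y z ≟ w} tt

  unmix-mix : ∀ v y z → unmix (mix v y z) y z ≡ v
  unmix-mix = toWitness {a? = all? λ v → all? λ y → all? λ z → unmix (mix v y z) y z ≟ v} tt

  -- From p, q 0 and r 0 one gets s, because each w is a value of `mix` with last arguments 0; and s
  -- determines the other values of q and r. The premises on q₁, ..., r₃ impose this at once,
  -- leaving 24 · 16 candidates for the full equation.
  mix-facts : ∀ a b → b ≢ a → ∀ c → c ≢ a → c ≢ b → ∀ d → d ≢ a → d ≢ b → d ≢ c → ∀ q₀ r₀ →
    let p = table a b c d ; s = Mix.output p q₀ r₀ in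
    ∀ q₁ → s 1F ≡ mix a q₁ r₀ → ∀ q₂ → s 2F ≡ mix a q₂ r₀ → ∀ q₃ → s 3F ≡ mix a q₃ r₀ →
    ∀ r₁ → s 1F ≡ mix a q₀ r₁ → ∀ r₂ → s 2F ≡ mix a q₀ r₂ → ∀ r₃ → s 3F ≡ mix a q₀ r₃ →
    let q = table q₀ q₁ q₂ q₃ ; r = table r₀ r₁ r₂ r₃ in
    (∀ v y z → s (mix v y z) ≡ mix (p v) (q y) (r z)) → Mix.Facts p q₀ r₀ q r
  mix-facts = toWitness {a? = all? λ a → all? λ b → ¬? (b ≟ a) →-dec all? λ c → ¬? (c ≟ a) →-dec ¬? (c ≟ b) →-dec
    all? λ d → ¬? (d ≟ a) →-dec ¬? (d ≟ b) →-dec ¬? (d ≟ c) →-dec all? λ q₀ → all? λ r₀ →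
    let p = table a b c d
        s = Mix.output p q₀ r₀ in
    all? λ q₁ → (s 1F ≟ mix a q₁ r₀) →-dec all? λ q₂ → (s 2F ≟ mix a q₂ r₀) →-dec all? λ q₃ → (s 3F ≟ mix a q₃ r₀) →-dec
    all? λ r₁ → (s 1F ≟ mix a q₀ r₁) →-dec all? λ r₂ → (s 2F ≟ mix a q₀ r₂) →-dec all? λ r₃ → (s 3F ≟ mix a q₀ r₃) →-dec
    let q = table q₀ q₁ q₂ q₃
        r = table r₀ r₁ r₂ r₃ in
    (all? λ v → all? λ y → all? λ z → s (mix v y z) ≟ mix (p v) (q y) (r z)) →-dec Mix.facts? p q₀ r₀ q r} tt

unquad : Symbol → Symbol → Symbol → Symbol → Symbol
unquad w b c d = let u = w ⊕ b ⊕ c ⊕ d in u ⊕ (if low u ∧ low b ∧ low c ∧ low d then 2F else 0F)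

QuadEquation : (p q r t s : Vec Symbol 4) → Symbol → Symbol → Symbol → Symbol → Set
QuadEquation p q r t s a b c d = lookup s (quad a b c d) ≡ quad (lookup p a) (lookup q b) (lookup r c) (lookup t d)

quad-equation? : ∀ p q r t s a b c d → Dec (QuadEquation p q r t s a b c d)
quad-equation? p q r t s a b c d = lookup s (quad a b c d) ≟ quad (lookup p a) (lookup q b) (lookup r c) (lookup t d)

QuadFacts : (q r t s : Vec Symbol 4) → Set
QuadFacts q r t s = (∀ a → low (lookup s a) ≡ low a) ×
  (Identical (lookup s) → Translates (lookup q) × Translates (lookup r) × Translates (lookup t))

module _ (p : Vec Symbol 4) (q₀ r₀ t₀ : Symbol) where

  quad-output : Symbol → Symbol
  quad-output w = quad (lookup p w) q₀ r₀ t₀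

  outputs : Vec Symbol 4
  outputs = quad-output 0F ∷ quad-output 1F ∷ quad-output 2F ∷ quad-output 3F ∷ []

-- `quad` is symmetric and returns w when its other arguments are 0. Evaluating the autotopy
-- equation with all but one argument 0 therefore determines each of q, r, t from s by the same
-- `unquad`.
solutions : Symbol → Symbol → Symbol → Vec Symbol 4 → Vec Symbol 4
solutions a b c s = unquad (lookup s 0F) a b c ∷ unquad (lookup s 1F) a b c ∷ unquad (lookup s 2F) a b c ∷ unquad (lookup s 3F) a b c ∷ []

-- The first three premises are instances of the fourth, which discard most candidates early.
QuadCase : (p q r t s : Vec Symbol 4) → Set
QuadCase p q r t s = let E = QuadEquation p q r t s in
  E 1F 1F 1F 1F → E 0F 0F 1F 1F → E 1F 1F 0F 0F → (∀ a b c d → E a b c d) → QuadFacts q r t s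

quad-case? : ∀ p q r t s → Dec (QuadCase p q r t s)
quad-case? p q r t s = let E? = quad-equation? p q r t s in
  E? 1F 1F 1F 1F →-dec E? 0F 0F 1F 1F →-dec E? 1F 1F 0F 0F →-dec
  (all? λ a → all? λ b → all? λ c → all? λ d → E? a b c d) →-dec
  (all? λ a → low (lookup s a) Bool.≟ low a) ×-dec
  (identical? (lookup s) →-dec translates? (lookup q) ×-dec translates? (lookup r) ×-dec translates? (lookup t))

QuadSolved : (p : Vec Symbol 4) (q₀ r₀ t₀ : Symbol) (s : Vec Symbol 4) → Set
QuadSolved p q₀ r₀ t₀ s = let p₀ = lookup p 0F in
  QuadCase p (solutions p₀ r₀ t₀ s) (solutions p₀ q₀ t₀ s) (solutions p₀ q₀ r₀ s) s

quad-solved? : ∀ p q₀ r₀ t₀ s → Dec (QuadSolved p q₀ r₀ t₀ s)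
quad-solved? p q₀ r₀ t₀ s = let p₀ = lookup p 0F in
  quad-case? p (solutions p₀ r₀ t₀ s) (solutions p₀ q₀ t₀ s) (solutions p₀ q₀ r₀ s) s

abstract
  quad-unquad : ∀ w b c d → quad (unquad w b c d) b c d ≡ w
  quad-unquad = toWitness {a? = all? λ w → all? λ b → all? λ c → all? λ d → quad (unquad w b c d) b c d ≟ w} tt

  unquad-quad : ∀ a b c d → unquad (quad a b c d) b c d ≡ a
  unquad-quad = toWitness {a? = all? λ a → all? λ b → all? λ c → all? λ d → unquad (quad a b c d) b c d ≟ a} tt

  quad-swap₁₂ : ∀ a b c d → quad a b c d ≡ quad b a c d
  quad-swap₁₂ = toWitness {a? = all? λ a → all? λ b → all? λ c → all? λ d → quad a b c d ≟ quad b a c d} tt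

  quad-swap₁₃ : ∀ a b c d → quad a b c d ≡ quad c a b d
  quad-swap₁₃ = toWitness {a? = all? λ a → all? λ b → all? λ c → all? λ d → quad a b c d ≟ quad c a b d} tt

  quad-swap₁₄ : ∀ a b c d → quad a b c d ≡ quad d a b c
  quad-swap₁₄ = toWitness {a? = all? λ a → all? λ b → all? λ c → all? λ d → quad a b c d ≟ quad d a b c} tt

  mix-swap : ∀ v y z → mix v y z ≡ mix v z y
  mix-swap = toWitness {a? = all? λ v → all? λ y → all? λ z → mix v y z ≟ mix v z y} tt

  -- `mix` is symmetric in `swap v`, y and z; invertibility in the second argument is thereby
  -- reduced to the first.
  mix-turn : ∀ v y z → mix v y z ≡ mix (swap y) (swap v) z
  mix-turn = toWitness {a? = all? λ v → all? λ y → all? λ z → mix v y z ≟ mix (swap y) (swap v) z} tt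

  swap-involutive : ∀ a → swap (swap a) ≡ a
  swap-involutive = toWitness {a? = all? λ a → swap (swap a) ≟ a} tt

  quad-facts : ∀ a b → b ≢ a → ∀ c → c ≢ a → c ≢ b → ∀ d → d ≢ a → d ≢ b → d ≢ c → ∀ q₀ r₀ t₀ →
    let p = a ∷ b ∷ c ∷ d ∷ [] in QuadSolved p q₀ r₀ t₀ (outputs p q₀ r₀ t₀)
  quad-facts = toWitness {a? = all? λ a → all? λ b → ¬? (b ≟ a) →-dec all? λ c → ¬? (c ≟ a) →-dec ¬? (c ≟ b) →-dec
    all? λ d → ¬? (d ≟ a) →-dec ¬? (d ≟ b) →-dec ¬? (d ≟ c) →-dec all? λ q₀ → all? λ r₀ → all? λ t₀ →
    let p = a ∷ b ∷ c ∷ d ∷ [] in quad-solved? p q₀ r₀ t₀ (outputs p q₀ r₀ t₀)} tt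

-- Building quasigroups as chains

invertible : ∀ {g : Symbol → Symbol} (h : Symbol → Symbol) → (∀ a → h (g a) ≡ a) → (∀ b → g (h b) ≡ b) → Bijective _≡_ _≡_ g
invertible {g} h hg gh = (λ {a} {b} p → trans (sym (hg a)) (trans (cong h p) (hg b))) , λ b → h b , λ { refl → gh b }

bijective-≗ : ∀ {g h : Symbol → Symbol} → (∀ a → g a ≡ h a) → Bijective _≡_ _≡_ h → Bijective _≡_ _≡_ g
bijective-≗ e (inj , sur) = (λ {a} {b} p → inj (trans (sym (e a)) (trans p (e b)))) ,
  λ b → proj₁ (sur b) , λ { refl → trans (e _) (proj₂ (sur b) refl) }

bijective-∘ : ∀ {g h : Symbol → Symbol} → Bijective _≡_ _≡_ g → Bijective _≡_ _≡_ h → Bijective _≡_ _≡_ (g ∘ h)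
bijective-∘ {g} (inj , sur) (inj′ , sur′) = (λ p → inj′ (inj p)) ,
  λ b → proj₁ (sur′ (proj₁ (sur b))) , λ { refl → trans (cong g (proj₂ (sur′ (proj₁ (sur b))) refl)) (proj₂ (sur b) refl) }

mix-bijective₁ : ∀ y z → Bijective _≡_ _≡_ (λ v → mix v y z)
mix-bijective₁ y z = invertible (λ w → unmix w y z) (λ v → unmix-mix v y z) (λ w → mix-unmix w y z)

swap-bijective : Bijective _≡_ _≡_ swap
swap-bijective = invertible swap swap-involutive swap-involutive

mix-bijective₂ : ∀ v z → Bijective _≡_ _≡_ (λ y → mix v y z)
mix-bijective₂ v z = bijective-≗ (λ y → mix-turn v y z) (bijective-∘ (mix-bijective₁ (swap v) z) swap-bijective)

mix-bijective₃ : ∀ v y → Bijective _≡_ _≡_ (mix v y)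
mix-bijective₃ v y = bijective-≗ (λ z → mix-swap v y z) (mix-bijective₂ v y)

chain : ∀ {n} → Quasigroup n → Quasigroup (2 + n)
chain {n} Q = record { op = op′ ; isQuasigroup = isQ }
  where
  open Quasigroup Q
  op′ : Operation (2 + n)
  op′ (y ∷ z ∷ x) = mix (op x) y z
  isQ : IsQuasigroup op′
  isQ zero          (y ∷ z ∷ x) = mix-bijective₂ (op x) z
  isQ (suc zero)    (y ∷ z ∷ x) = mix-bijective₃ (op x) y
  isQ (suc (suc i)) (y ∷ z ∷ x) = bijective-∘ (mix-bijective₁ y z) (isQuasigroup i x)

unary : Quasigroup 1
unary = record { op = λ { (x ∷ []) → x } ; isQuasigroup = λ { 0F (x ∷ []) → invertible id (λ _ → refl) (λ _ → refl) } }

quaternary : Quasigroup 4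
quaternary = record
  { op = λ { (a ∷ b ∷ c ∷ d ∷ []) → quad a b c d }
  ; isQuasigroup = λ where
      0F (a ∷ b ∷ c ∷ d ∷ []) → first b c d
      1F (a ∷ b ∷ c ∷ d ∷ []) → bijective-≗ (λ x → quad-swap₁₂ a x c d) (first a c d)
      2F (a ∷ b ∷ c ∷ d ∷ []) → bijective-≗ (λ x → quad-swap₁₃ a b x d) (first a b d)
      3F (a ∷ b ∷ c ∷ d ∷ []) → bijective-≗ (λ x → quad-swap₁₄ a b c x) (first a b c) }
  where
  first : ∀ b c d → Bijective _≡_ _≡_ (λ a → quad a b c d)
  first b c d = invertible (λ w → unquad w b c d) (λ a → unquad-quad a b c d) (λ w → quad-unquad w b c d)

bit : Symbol → Fin 2
bit 0F = 0F
bit _  = 1F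

abstract
  bit-injective : ∀ a b → a ≡ 0F ⊎ a ≡ 2F → b ≡ 0F ⊎ b ≡ 2F → bit a ≡ bit b → a ≡ b
  bit-injective = toWitness {a? = all? λ a → all? λ b → ((a ≟ 0F) ⊎-dec (a ≟ 2F)) →-dec ((b ≟ 0F) ⊎-dec (b ≟ 2F)) →-dec
    (bit a ≟ bit b) →-dec (a ≟ b)} tt

  low-high : ∀ a b → low a ≡ low b → high a ≡ high b → a ≡ b
  low-high = toWitness {a? = all? λ a → all? λ b → (low a Bool.≟ low b) →-dec (high a Bool.≟ high b) →-dec (a ≟ b)} tt

translates-≗ : ∀ {q q′} → (∀ a → q a ≡ q′ a) → Translates q → Translates q′
translates-≗ e (z , t) = subst (λ a → a ≡ 0F ⊎ a ≡ 2F) (e 0F) z , λ a → trans (sym (e a)) (trans (t a) (cong (a ⊕_) (e 0F)))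

translates-unique : ∀ {q q′} → Translates q → Translates q′ → bit (q 0F) ≡ bit (q′ 0F) → ∀ a → q a ≡ q′ a
translates-unique (z , t) (z′ , t′) e a = trans (t a) (trans (cong (a ⊕_) (bit-injective _ _ z z′ e)) (sym (t′ a)))

table-≗ : ∀ (q : Symbol → Symbol) a → table (q 0F) (q 1F) (q 2F) (q 3F) a ≡ q a
table-≗ q 0F = refl
table-≗ q 1F = refl
table-≗ q 2F = refl
table-≗ q 3F = refl

-- Autotopies of chains

record MixAutotopy (p q r s : Permutation′ 4) : Set where
  constructor mixAutotopy
  field equation : ∀ v y z → s ⟨$⟩ʳ mix v y z ≡ mix (p ⟨$⟩ʳ v) (q ⟨$⟩ʳ y) (r ⟨$⟩ʳ z)

module _ {p q r s : Permutation′ 4} (m : MixAutotopy p q r s) where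
  open MixAutotopy m
  private
    P = p ⟨$⟩ʳ_
    R = q ⟨$⟩ʳ_
    T = r ⟨$⟩ʳ_
    Z = s ⟨$⟩ʳ_

    P′ = table (P 0F) (P 1F) (P 2F) (P 3F)
    R′ = table (R 0F) (R 1F) (R 2F) (R 3F)
    T′ = table (T 0F) (T 1F) (T 2F) (T 3F)

    open Mix P′ (R 0F) (T 0F)

    output-≗ : ∀ w → output w ≡ Z w
    output-≗ w = trans (cong (λ a → mix a (R 0F) (T 0F)) (table-≗ P (unmix w 0F 0F)))
      (trans (sym (equation (unmix w 0F 0F) 0F 0F)) (cong Z (mix-unmix w 0F 0F)))

    distinct : ∀ {a b} → a ≢ b → P a ≢ P b
    distinct a≢b e = a≢b (perm-injective p e)

    at-y : ∀ y → output (mix 0F y 0F) ≡ mix (P 0F) (R y) (T 0F)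
    at-y y = trans (output-≗ _) (equation 0F y 0F)

    at-z : ∀ z → output (mix 0F 0F z) ≡ mix (P 0F) (R 0F) (T z)
    at-z z = trans (output-≗ _) (equation 0F 0F z)

    facts : Facts R′ T′
    facts = mix-facts (P 0F) (P 1F) (distinct λ ()) (P 2F) (distinct λ ()) (distinct λ ()) (P 3F) (distinct λ ()) (distinct λ ()) (distinct λ ())
      (R 0F) (T 0F) (R 1F) (at-y 1F) (R 2F) (at-y 2F) (R 3F) (at-y 3F) (T 1F) (at-z 1F) (T 2F) (at-z 2F) (T 3F) (at-z 3F)
      λ v y z → trans (output-≗ _) (trans (equation v y z)
        (sym (trans (cong₂ (λ a b → mix a b (T′ z)) (table-≗ P v) (table-≗ R y)) (cong (mix (P v) (R y)) (table-≗ T z)))))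

  mix-low : ∀ a → low (s ⟨$⟩ʳ a) ≡ low a
  mix-low a = trans (cong low (sym (output-≗ a))) (proj₁ facts a)

  mix-high : ∀ a → high (p ⟨$⟩ʳ a) ≡ high a
  mix-high a = trans (cong high (sym (table-≗ P a))) (proj₁ (proj₂ facts) a)

  mix-fixed-input : Identical (p ⟨$⟩ʳ_) → Translates (q ⟨$⟩ʳ_) × Translates (r ⟨$⟩ʳ_) × (∀ a → s ⟨$⟩ʳ a ≡ a ⊕ ((q ⟨$⟩ʳ 0F) ⊕ (r ⟨$⟩ʳ 0F)))
  mix-fixed-input i = let tq , tr , ts = proj₁ (proj₂ (proj₂ facts)) (λ a → trans (table-≗ P a) (i a)) in
    translates-≗ (table-≗ R) tq , translates-≗ (table-≗ T) tr , λ a → trans (sym (output-≗ a)) (ts a)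

  mix-fixed-output : Identical (s ⟨$⟩ʳ_) → Translates (q ⟨$⟩ʳ_) × Translates (r ⟨$⟩ʳ_)
  mix-fixed-output i = let tq , tr = proj₂ (proj₂ (proj₂ facts)) (λ a → trans (output-≗ a) (i a)) in
    translates-≗ (table-≗ R) tq , translates-≗ (table-≗ T) tr

_≋_ : ∀ {n} → Perms n → Perms n → Set
θ ≋ φ = ∀ i a → θ i ⟨$⟩ʳ a ≡ φ i ⟨$⟩ʳ a

autotopy-equation : ∀ {n} (f : Operation n) (θ : Perms n) → IsAutotopy f θ → ∀ x → θ zero ⟨$⟩ʳ f x ≡ f (act θ x)
autotopy-equation f θ p x = trans (cong (θ zero ⟨$⟩ʳ_) (p x)) (inverseʳ (θ zero))

-- The root permutation of an autotopy preserves {0,2}, whereas the permutation of the first argument of mix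
-- preserves {0,1}; hence it is the identity wherever a rigid quasigroup is plugged into mix.
record Rigid (n : ℕ) : Set where
  field
    quasigroup : Quasigroup n
  open Quasigroup quasigroup
  field
    onto      : ∀ v → ∃[ x ] op x ≡ v
    root-low  : ∀ θ → IsAutotopy op θ → ∀ a → low (θ zero ⟨$⟩ʳ a) ≡ low a
    label     : (Fin n → Permutation′ 4) → Fin (2 ^ suc ⌊ n /2⌋)
    label-inj : ∀ θ φ → IsAutotopy op θ → IsAutotopy op φ → Identical (θ zero ⟨$⟩ʳ_) → Identical (φ zero ⟨$⟩ʳ_) →
                label (θ ∘ suc) ≡ label (φ ∘ suc) → θ ≋ φ

module Plugged {n : ℕ} (Q : Quasigroup n) (onto : ∀ v → ∃[ x ] Quasigroup.op Q x ≡ v)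
               (θ : Perms (2 + n)) (isA : IsAutotopy (Quasigroup.op (chain Q)) θ) where
  open Quasigroup Q

  private
    y₀ = θ 1F ⟨$⟩ʳ 0F
    z₀ = θ 2F ⟨$⟩ʳ 0F
    eq = autotopy-equation (Quasigroup.op (chain Q)) θ isA

    inner : Perms n
    inner zero    = θ zero
    inner (suc i) = θ (suc (suc (suc i)))

  -- With 0 in both outer arguments the autotopy equation shows that the transformed value of `op`
  -- is a function of the old value of `op`. This permutation of the inner edge splits the autotopy
  -- into one of `op` and one of `mix`.
  joint : Permutation′ 4
  joint = permutation (λ v → unmix (θ zero ⟨$⟩ʳ mix v 0F 0F) y₀ z₀) (λ v → unmix (θ zero ⟨$⟩ˡ mix v y₀ z₀) 0F 0F)
    (λ v → trans (cong (λ w → unmix (θ zero ⟨$⟩ʳ w) y₀ z₀) (mix-unmix _ 0F 0F))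
             (trans (cong (λ w → unmix w y₀ z₀) (inverseʳ (θ zero))) (unmix-mix v y₀ z₀)))
    (λ v → trans (cong (λ w → unmix (θ zero ⟨$⟩ˡ w) 0F 0F) (mix-unmix _ y₀ z₀))
             (trans (cong (λ w → unmix w 0F 0F) (inverseˡ (θ zero))) (unmix-mix v 0F 0F)))

  joint-op : ∀ x → joint ⟨$⟩ʳ op x ≡ op (act inner x)
  joint-op x = trans (cong (λ w → unmix w y₀ z₀) (eq (0F ∷ 0F ∷ x))) (unmix-mix _ y₀ z₀)

  plugged : Perms n
  plugged zero    = joint
  plugged (suc i) = θ (suc (suc (suc i)))

  plugged-isAutotopy : IsAutotopy op plugged
  plugged-isAutotopy x = sym (trans (cong (joint ⟨$⟩ˡ_) (sym (joint-op x))) (inverseˡ joint))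

  mixed : MixAutotopy joint (θ 1F) (θ 2F) (θ zero)
  mixed = mixAutotopy λ v y z → let x , e = onto v in
    subst (λ v → θ zero ⟨$⟩ʳ mix v y z ≡ mix (joint ⟨$⟩ʳ v) (θ 1F ⟨$⟩ʳ y) (θ 2F ⟨$⟩ʳ z)) e
      (trans (eq (y ∷ z ∷ x)) (cong (λ w → mix w (θ 1F ⟨$⟩ʳ y) (θ 2F ⟨$⟩ʳ z)) (sym (joint-op x))))

chain-onto : ∀ {n} (Q : Quasigroup n) → (∀ v → ∃[ x ] Quasigroup.op Q x ≡ v) → ∀ v → ∃[ x ] Quasigroup.op (chain Q) x ≡ v
chain-onto Q onto v = let x , e = onto (unmix v 0F 0F) in 0F ∷ 0F ∷ x , trans (cong (λ w → mix w 0F 0F) e) (mix-unmix v 0F 0F)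

module Growth {n : ℕ} (R : Rigid n) where
  open Rigid R
  private
    Q′ = chain quasigroup
    f′ = Quasigroup.op Q′

  module _ (θ : Perms (2 + n)) (isA : IsAutotopy f′ θ) where
    open Plugged quasigroup onto θ isA

    joint-identical : Identical (joint ⟨$⟩ʳ_)
    joint-identical a = low-high _ _ (root-low plugged plugged-isAutotopy a) (mix-high mixed a)

    ends : Translates (θ 1F ⟨$⟩ʳ_) × Translates (θ 2F ⟨$⟩ʳ_) × (∀ a → θ zero ⟨$⟩ʳ a ≡ a ⊕ ((θ 1F ⟨$⟩ʳ 0F) ⊕ (θ 2F ⟨$⟩ʳ 0F)))
    ends = mix-fixed-input mixed joint-identical

  -- When θ₀ is unrestricted, the translations in both new arguments are free, one bit more than in
  -- the label of `grow`. The number of labels is 2 ^ (⌊n/2⌋ + 3), the bound for arity n + 2.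
  full-label : Perms (2 + n) → Fin (2 * (2 * 2 ^ suc ⌊ n /2⌋))
  full-label θ = combine (bit (θ 1F ⟨$⟩ʳ 0F)) (combine (bit (θ 2F ⟨$⟩ʳ 0F)) (label (λ i → θ (suc (suc (suc i))))))

  module _ (θ φ : Perms (2 + n)) (isA : IsAutotopy f′ θ) (isB : IsAutotopy f′ φ) where
    private
      module Θ = Plugged quasigroup onto θ isA
      module Φ = Plugged quasigroup onto φ isB

    same : bit (θ 1F ⟨$⟩ʳ 0F) ≡ bit (φ 1F ⟨$⟩ʳ 0F) → bit (θ 2F ⟨$⟩ʳ 0F) ≡ bit (φ 2F ⟨$⟩ʳ 0F) →
      label (λ i → θ (suc (suc (suc i)))) ≡ label (λ i → φ (suc (suc (suc i)))) → θ ≋ φ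
    same ey ez el = go
      where
      y-same : ∀ a → θ 1F ⟨$⟩ʳ a ≡ φ 1F ⟨$⟩ʳ a
      y-same = translates-unique (proj₁ (ends θ isA)) (proj₁ (ends φ isB)) ey
      z-same : ∀ a → θ 2F ⟨$⟩ʳ a ≡ φ 2F ⟨$⟩ʳ a
      z-same = translates-unique (proj₁ (proj₂ (ends θ isA))) (proj₁ (proj₂ (ends φ isB))) ez
      go : θ ≋ φ
      go 0F a = trans (proj₂ (proj₂ (ends θ isA)) a) (trans (cong₂ (λ u v → a ⊕ (u ⊕ v)) (y-same 0F) (z-same 0F)) (sym (proj₂ (proj₂ (ends φ isB)) a)))
      go 1F = y-same
      go 2F = z-same
      go (suc (suc (suc i))) = label-inj Θ.plugged Φ.plugged Θ.plugged-isAutotopy Φ.plugged-isAutotopy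
        (joint-identical θ isA) (joint-identical φ isB) el (suc i)

    full-label-injective : full-label θ ≡ full-label φ → θ ≋ φ
    full-label-injective e = let ey , e′ = combine-injective _ _ _ _ e ; ez , el = combine-injective _ _ _ _ e′ in same ey ez el

  grow : Rigid (2 + n)
  grow = record
    { quasigroup = Q′
    ; onto       = chain-onto quasigroup onto
    ; root-low   = λ θ isA → mix-low (Plugged.mixed quasigroup onto θ isA)
    ; label      = λ θ → combine (bit (θ 0F ⟨$⟩ʳ 0F)) (label (λ i → θ (suc (suc i))))
    ; label-inj  = λ θ φ isA isB iθ iφ e → let ey , el = combine-injective _ _ _ _ e in same θ φ isA isB ey
        (trans (sym (cong bit (balanced θ isA iθ))) (trans ey (cong bit (balanced φ isB iφ)))) el }
    where
    -- As θ₀ is the identity, the translations in the two new arguments cancel.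
    balanced : ∀ θ → IsAutotopy f′ θ → Identical (θ zero ⟨$⟩ʳ_) → θ 1F ⟨$⟩ʳ 0F ≡ θ 2F ⟨$⟩ʳ 0F
    balanced θ isA i = ⊕-injectiveˡ (θ 1F ⟨$⟩ʳ 0F) (trans (⊕-self (θ 1F ⟨$⟩ʳ 0F)) (trans (sym (i 0F)) (proj₂ (proj₂ (ends θ isA)) 0F)))

unary-onto : ∀ v → ∃[ x ] Quasigroup.op unary x ≡ v
unary-onto v = v ∷ [] , refl

-- The unary quasigroup is not rigid, since its root permutation is arbitrary, so `Growth` cannot
-- start from it. Here θ₀ = id forces the translations instead, and these determine the joint, which
-- is the permutation of the last argument.
ternary-rigid : Rigid 3
ternary-rigid = record
  { quasigroup = chain unary
  ; onto       = chain-onto unary unary-onto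
  ; root-low   = λ θ isA → mix-low (Plugged.mixed unary unary-onto θ isA)
  ; label      = λ θ → combine (bit (θ 0F ⟨$⟩ʳ 0F)) (combine (bit (θ 1F ⟨$⟩ʳ 0F)) (zero {0}))
  ; label-inj  = label-inj }
  where
  f₃ = Quasigroup.op (chain unary)
  label-inj : ∀ θ φ → IsAutotopy f₃ θ → IsAutotopy f₃ φ → Identical (θ zero ⟨$⟩ʳ_) → Identical (φ zero ⟨$⟩ʳ_) →
    combine (bit (θ 1F ⟨$⟩ʳ 0F)) (combine (bit (θ 2F ⟨$⟩ʳ 0F)) (zero {0})) ≡ combine (bit (φ 1F ⟨$⟩ʳ 0F)) (combine (bit (φ 2F ⟨$⟩ʳ 0F)) (zero {0})) → θ ≋ φ
  label-inj θ φ isA isB iθ iφ e = go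
    where
    module Θ = Plugged unary unary-onto θ isA
    module Φ = Plugged unary unary-onto φ isB
    ey = proj₁ (combine-injective _ _ _ _ e)
    ez = proj₁ (combine-injective _ _ _ _ (proj₂ (combine-injective (bit (θ 1F ⟨$⟩ʳ 0F)) _ (bit (φ 1F ⟨$⟩ʳ 0F)) _ e)))
    y-same = translates-unique (proj₁ (mix-fixed-output Θ.mixed iθ)) (proj₁ (mix-fixed-output Φ.mixed iφ)) ey
    z-same = translates-unique (proj₂ (mix-fixed-output Θ.mixed iθ)) (proj₂ (mix-fixed-output Φ.mixed iφ)) ez
    joint-same : ∀ v → Θ.joint ⟨$⟩ʳ v ≡ Φ.joint ⟨$⟩ʳ v
    joint-same v = trans (cong (λ w → unmix w (θ 1F ⟨$⟩ʳ 0F) (θ 2F ⟨$⟩ʳ 0F)) (trans (iθ _) (sym (iφ _))))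
      (cong₂ (unmix (φ zero ⟨$⟩ʳ mix v 0F 0F)) (y-same 0F) (z-same 0F))
    go : θ ≋ φ
    go 0F a = trans (iθ a) (sym (iφ a))
    go 1F = y-same
    go 2F = z-same
    go 3F a = trans (sym (Θ.joint-op (a ∷ []))) (trans (joint-same a) (Φ.joint-op (a ∷ [])))

module QuaternaryAutotopy (θ : Perms 4) (isA : IsAutotopy (Quasigroup.op quaternary) θ) where
  private
    s = θ 0F ⟨$⟩ʳ_
    p = θ 1F ⟨$⟩ʳ_
    q = θ 2F ⟨$⟩ʳ_
    r = θ 3F ⟨$⟩ʳ_
    t = θ (suc 3F) ⟨$⟩ʳ_

  equation : ∀ a b c d → s (quad a b c d) ≡ quad (p a) (q b) (r c) (t d)
  equation a b c d = autotopy-equation (Quasigroup.op quaternary) θ isA (a ∷ b ∷ c ∷ d ∷ [])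

  private
    values : (Symbol → Symbol) → Vec Symbol 4
    values g = g 0F ∷ g 1F ∷ g 2F ∷ g 3F ∷ []

    lookup-values : ∀ (h : Symbol → Symbol) {v} → v ≡ values h → ∀ a → lookup v a ≡ h a
    lookup-values h refl = table-≗ h

    values-cong : ∀ {g h : Symbol → Symbol} → (∀ a → g a ≡ h a) → values g ≡ values h
    values-cong e = cong₂ _∷_ (e 0F) (cong₂ _∷_ (e 1F) (cong₂ _∷_ (e 2F) (cong (_∷ []) (e 3F))))

    P = values p
    S = outputs P (q 0F) (r 0F) (t 0F)

    quad-0 : ∀ w → quad w 0F 0F 0F ≡ w
    quad-0 0F = refl
    quad-0 1F = refl
    quad-0 2F = refl
    quad-0 3F = refl

    S≡ : S ≡ values s
    S≡ = values-cong {λ w → quad (lookup P w) (q 0F) (r 0F) (t 0F)} λ w →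
      trans (cong (λ a → quad a (q 0F) (r 0F) (t 0F)) (table-≗ p w)) (trans (sym (equation w 0F 0F 0F)) (cong s (quad-0 w)))

    solved : ∀ (g : Symbol → Symbol) a b c → (∀ w → s w ≡ quad (g w) a b c) → solutions a b c S ≡ values g
    solved g a b c e = values-cong {λ w → unquad (lookup S w) a b c} λ w →
      trans (cong (λ w → unquad w a b c) (trans (lookup-values s S≡ w) (e w))) (unquad-quad (g w) a b c)

    distinct : ∀ {a b} → a ≢ b → p a ≢ p b
    distinct a≢b e = a≢b (perm-injective (θ 1F) e)

    Q = solutions (p 0F) (r 0F) (t 0F) S
    R = solutions (p 0F) (q 0F) (t 0F) S
    T = solutions (p 0F) (q 0F) (r 0F) S

    Q≡ : ∀ a → lookup Q a ≡ q a
    Q≡ = lookup-values q (solved q _ _ _ λ w → trans (cong s (trans (sym (quad-0 w)) (quad-swap₁₂ w 0F 0F 0F))) (trans (equation 0F w 0F 0F) (quad-swap₁₂ (p 0F) (q w) (r 0F) (t 0F))))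

    R≡ : ∀ a → lookup R a ≡ r a
    R≡ = lookup-values r (solved r _ _ _ λ w → trans (cong s (trans (sym (quad-0 w)) (sym (quad-swap₁₃ 0F 0F w 0F)))) (trans (equation 0F 0F w 0F) (quad-swap₁₃ (p 0F) (q 0F) (r w) (t 0F))))

    T≡ : ∀ a → lookup T a ≡ t a
    T≡ = lookup-values t (solved t _ _ _ λ w → trans (cong s (trans (sym (quad-0 w)) (sym (quad-swap₁₄ 0F 0F 0F w)))) (trans (equation 0F 0F 0F w) (quad-swap₁₄ (p 0F) (q 0F) (r 0F) (t w))))

    tabulated : ∀ a b c d → QuadEquation P Q R T S a b c d
    tabulated a b c d = trans (lookup-values s S≡ _) (trans (equation a b c d) (sym (trans
      (cong₂ (λ x y → quad x y (lookup R c) (lookup T d)) (table-≗ p a) (Q≡ b)) (cong₂ (quad (p a) (q b)) (R≡ c) (T≡ d)))))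

    facts : QuadFacts Q R T S
    facts = quad-facts (p 0F) (p 1F) (distinct λ ()) (p 2F) (distinct λ ()) (distinct λ ()) (p 3F) (distinct λ ()) (distinct λ ()) (distinct λ ())
      (q 0F) (r 0F) (t 0F) (tabulated 1F 1F 1F 1F) (tabulated 0F 0F 1F 1F) (tabulated 1F 1F 0F 0F) tabulated

  root-low : ∀ a → low (s a) ≡ low a
  root-low a = trans (cong low (sym (lookup-values s S≡ a))) (proj₁ facts a)

  module _ (i : Identical s) where
    private
      fixed = proj₂ facts (λ a → trans (lookup-values s S≡ a) (i a))

    q-translates : Translates q
    q-translates = translates-≗ Q≡ (proj₁ fixed)

    r-translates : Translates r
    r-translates = translates-≗ R≡ (proj₁ (proj₂ fixed))

    t-translates : Translates t
    t-translates = translates-≗ T≡ (proj₂ (proj₂ fixed))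

    p-determined : ∀ a → p a ≡ unquad a (q 0F) (r 0F) (t 0F)
    p-determined a = trans (sym (unquad-quad (p a) (q 0F) (r 0F) (t 0F))) (cong (λ w → unquad w (q 0F) (r 0F) (t 0F))
      (trans (sym (equation a 0F 0F 0F)) (trans (i _) (quad-0 a))))

quaternary-rigid : Rigid 4
quaternary-rigid = record
  { quasigroup = quaternary
  ; onto       = λ v → unquad v 0F 0F 0F ∷ 0F ∷ 0F ∷ 0F ∷ [] , quad-unquad v 0F 0F 0F
  ; root-low   = QuaternaryAutotopy.root-low
  ; label      = λ θ → label (θ 1F) (θ 2F) (θ 3F)
  ; label-inj  = label-inj }
  where
  f₄ = Quasigroup.op quaternary
  label : (q r t : Permutation′ 4) → Fin 8
  label q r t = combine (bit (q ⟨$⟩ʳ 0F)) (combine (bit (r ⟨$⟩ʳ 0F)) (combine (bit (t ⟨$⟩ʳ 0F)) (zero {0})))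
  label-inj : ∀ θ φ → IsAutotopy f₄ θ → IsAutotopy f₄ φ → Identical (θ zero ⟨$⟩ʳ_) → Identical (φ zero ⟨$⟩ʳ_) →
    label (θ 2F) (θ 3F) (θ (suc 3F)) ≡ label (φ 2F) (φ 3F) (φ (suc 3F)) → θ ≋ φ
  label-inj θ φ isA isB iθ iφ e = go
    where
    module Θ = QuaternaryAutotopy θ isA
    module Φ = QuaternaryAutotopy φ isB
    e₁ = combine-injective (bit (θ 2F ⟨$⟩ʳ 0F)) _ (bit (φ 2F ⟨$⟩ʳ 0F)) _ e
    e₂ = combine-injective (bit (θ 3F ⟨$⟩ʳ 0F)) _ (bit (φ 3F ⟨$⟩ʳ 0F)) _ (proj₂ e₁)
    e₃ = combine-injective (bit (θ (suc 3F) ⟨$⟩ʳ 0F)) _ (bit (φ (suc 3F) ⟨$⟩ʳ 0F)) _ (proj₂ e₂)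
    q-same = translates-unique (Θ.q-translates iθ) (Φ.q-translates iφ) (proj₁ e₁)
    r-same = translates-unique (Θ.r-translates iθ) (Φ.r-translates iφ) (proj₁ e₂)
    t-same = translates-unique (Θ.t-translates iθ) (Φ.t-translates iφ) (proj₁ e₃)
    go : θ ≋ φ
    go 0F a = trans (iθ a) (sym (iφ a))
    go 1F a = trans (Θ.p-determined iθ a) (trans (cong₂ (λ u v → unquad a u v (θ (suc 3F) ⟨$⟩ʳ 0F)) (q-same 0F) (r-same 0F))
      (trans (cong (unquad a _ _) (t-same 0F)) (sym (Φ.p-determined iφ a))))
    go 2F = q-same
    go 3F = r-same
    go (suc 3F) = t-same

rigid : ∀ m → Rigid (3 + m)
rigid 0             = ternary-rigid
rigid 1             = quaternary-rigid
rigid (suc (suc m)) = Growth.grow (rigid m)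

-- For n ≥ 5 the argument of the outermost `mix` is a rigid quasigroup of arity at least 3, as
-- `full-label` requires.
sharp : ∀ n → n ≥ 5 → Σ[ Q ∈ Quasigroup n ] HasOrder (Atp Q) (2 ^ (⌊ n /2⌋ + 2))
sharp (suc (suc (suc (suc (suc m))))) (s≤s (s≤s (s≤s (s≤s (s≤s _))))) = Q , subst (HasOrder (Atp Q)) exact hasOrder
  where
  open Growth (rigid m)
  Q : Quasigroup (5 + m)
  Q = chain (Rigid.quasigroup (rigid m))
  open Order Q
  upper : order ≤ 2 ^ (⌊ 5 + m /2⌋ + 2)
  upper = subst (λ e → order ≤ 2 ^ e) (ℕ.+-comm 2 ⌊ 5 + m /2⌋)
    (order-≤ (full-label ∘ proj₁) λ (θ , isA) (φ , isB) → full-label-injective θ φ isA isB)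
  exact : order ≡ 2 ^ (⌊ 5 + m /2⌋ + 2)
  exact = ℕ.≤-antisym upper (LowerBound.order-bound Q (s≤s z≤n))

theorem2 : (∀ (n : ℕ) → n ≥ 1 → (f : Quasigroup n) →
    ∃[ k ] (HasOrder (Atp f) k × k ≥ 2 ^ (⌊ n /2⌋ + 2)))
    × (∀ (n : ℕ) → n ≥ 5 →
    Σ[ f ∈ Quasigroup n ] HasOrder (Atp f) (2 ^ (⌊ n /2⌋ + 2)))
theorem2 = (λ n n≥1 Q → Order.order Q , Order.hasOrder Q , LowerBound.order-bound Q n≥1) , sharp
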